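{- Let $d\ge 1$ be an integer. Let $\mathcal{X}_d$ be the family of all graphs $X_{f,q}$, where $q$ ranges over odd prime powers and $f\in\mathbb{F}_q[x,y]$ ranges over admissible polynomials of degree $d$. Then $\mathcal{X}_d$ is a family of quasi-random graphs with property $QR(3/4)$: there is a constant $c>0$ (depending only on $d$) such that for every $X_{f,q}\in\mathcal{X}_d$ and all subsets $S,T\subset\mathbb{F}_q$, $$\left|e(S,T)-\frac{|S||T|}{2}\right|\le c\,q^{3/4}\sqrt{|S||T|}.$$
   Context: $q$ is an odd prime power and $\mathbb{F}_q$ the field with $q$ elements; an element of $\mathbb{F}_q$ is a square if it equals $z^2$ for some $z\in\mathbb{F}_q$ (so $0$ is a square). For $f\in\mathbb{F}_q[x,y]$, $X_{f,q}$ is the simple graph (no loops) with vertex set $\mathbb{F}_q$ in which distinct $a,b$ are adjacent iff $f(a,b)$ is a square in $\mathbb{F}_q$. Every $f$ can be written $f(x,y)=F(x)G(y)H(x,y)$ with $F\in\mathbb{F}_q[x]$, $G\in\mathbb{F}_q[y]$ and $H$ primitive in both $x$ and $y$ (i.e. $H$ has no nonconstant factor lying in $\mathbb{F}_q[x]$ or in $\mathbb{F}_q[y]$); $H$, unique up to a constant factor, is the primitive kernel of $f$. The polynomial $f$ is admissible if (i) for all $u,v\in\mathbb{F}_q$, $f(u,v)$ is a square iff $f(v,u)$ is a square, and (ii) $H$ is not a constant multiple of the square of a polynomial in $\mathbb{F}_q[x,y]$. For a graph $G$ and vertex subsets $S,T$, $e(S,T)$ is the number of pairs $(s,t)\in S\times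 T$ with $s,t$ adjacent (edges with both endpoints in $S\cap T$ are counted twice). For $0<\theta<1$, a family $\mathcal{G}$ of graphs with unbounded numbers of vertices has property $QR(\theta)$ if there is $c>0$ such that for all $G\in\mathcal{G}$ with $n$ vertices and all $S,T\subset V(G)$, $|e(S,T)-|S||T|/2|\le c n^\theta\sqrt{|S||T|}$. -}

module Defs where

open import Data.Nat using (ℕ; zero; suc; _<_; _∸_) renaming (_+_ to _+ℕ_; _*_ to _*ℕ_; _^_ to _^ℕ_)
open import Data.Nat.Primality using (Prime)
open import Data.Fin using (Fin)
import Data.Fin as Fin
import Data.Fin.Properties as FinP
open import Data.Bool using (Bool; true; false; if_then_else_; _∧_; not)
open import Data.Product using (Σ; ∃; _×_; _,_; proj₁; proj₂)
open import Relation.Nullary using (¬_; Dec; does)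
open import Relation.Nullary.Decidable using (map′)
open import Relation.Binary.Definitions using (DecidableEquality)
open import Relation.Binary.PropositionalEquality using (_≡_; _≢_; subst)
open import Function.Bundles using (_↔_; Inverse)
open import Algebra.Structures using (IsCommutativeRing)

-- Finite fields (with propositional equality).  F_q is modelled by any
-- finite field whose cardinality is q; all notions below are invariant
-- under field isomorphism.

record FiniteField : Set₁ where
  infixl 6 _+_
  infixl 7 _*_
  field
    Carrier : Set
    _≟_     : DecidableEquality Carrier
    _+_ _*_ : Carrier → Carrier → Carrier
    -_      : Carrier → Carrier
    0# 1#   : Carrier
    isCommutativeRing : IsCommutativeRing _≡_ _+_ _*_ -_ 0# 1#
    0≢1     : 0# ≢ 1#
    inverse : ∀ x → x ≢ 0# → ∃ λ y → x * y ≡ 1#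
    size    : ℕ
    enum    : Carrier ↔ Fin size

OddPrimePower : ℕ → Set
OddPrimePower q = ∃ λ p → ∃ λ k → Prime p × p ≢ 2 × 0 < k × q ≡ p ^ℕ k

module _ (K : FiniteField) where
  open FiniteField K

  pow : Carrier → ℕ → Carrier
  pow x zero    = 1#
  pow x (suc n) = x * pow x n

  sumTo : ℕ → (ℕ → Carrier) → Carrier
  sumTo zero    g = g 0
  sumTo (suc n) g = sumTo n g + g (suc n)

  -- Polynomials in F[x,y]: finitely supported coefficient arrays;
  -- coef i j is the coefficient of x^i y^j.
  record Poly2 : Set where
    field
      coef   : ℕ → ℕ → Carrier
      bound  : ℕ
      vanish : ∀ i j → bound < i +ℕ j → coef i j ≡ 0#
  open Poly2 public

  eval : Poly2 → Carrier → Carrier → Carrier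
  eval f u v = sumTo (bound f) λ i → sumTo (bound f) λ j →
                 coef f i j * pow u i * pow v j

  IsProd : Poly2 → Poly2 → Poly2 → Set
  IsProd f g h = ∀ i j → coef f i j ≡
    sumTo i λ a → sumTo j λ b → coef g a b * coef h (i ∸ a) (j ∸ b)

  _∣ₚ_ : Poly2 → Poly2 → Set
  P ∣ₚ H = ∃ λ Q → IsProd H P Q

  InFx : Poly2 → Set
  InFx P = ∀ i j → 0 < j → coef P i j ≡ 0#

  InFy : Poly2 → Set
  InFy P = ∀ i j → 0 < i → coef P i j ≡ 0#

  Nonconstant : Poly2 → Set
  Nonconstant P = ∃ λ i → ∃ λ j → 0 < i +ℕ j × coef P i j ≢ 0#

  PrimitiveXY : Poly2 → Set
  PrimitiveXY H =
    (∀ P → InFx P → P ∣ₚ H → ¬ Nonconstant P) ×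
    (∀ P → InFy P → P ∣ₚ H → ¬ Nonconstant P)

  IsPrimitiveKernel : Poly2 → Poly2 → Set
  IsPrimitiveKernel f H = ∃ λ Fp → ∃ λ Gp → ∃ λ FG →
    InFx Fp × InFy Gp × IsProd FG Fp Gp × IsProd f FG H × PrimitiveXY H

  ConstTimesSquare : Poly2 → Set
  ConstTimesSquare H = ∃ λ c → ∃ λ P → ∃ λ P² →
    IsProd P² P P × (∀ i j → coef H i j ≡ c * coef P² i j)

  HasDegree : Poly2 → ℕ → Set
  HasDegree f d =
    (∃ λ i → ∃ λ j → i +ℕ j ≡ d × coef f i j ≢ 0#) ×
    (∀ i j → d < i +ℕ j → coef f i j ≡ 0#)

  IsSquare : Carrier → Set
  IsSquare a = ∃ λ z → z * z ≡ a

  isSquare? : ∀ a → Dec (IsSquare a)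
  isSquare? a = map′
    (λ { (i , p) → Inverse.from enum i , p })
    (λ { (z , p) → Inverse.to enum z ,
           subst (λ w → w * w ≡ a) (sym' (Inverse.strictlyInverseʳ enum z)) p })
    (FinP.any? λ i → (Inverse.from enum i * Inverse.from enum i) ≟ a)
    where
    sym' : ∀ {x y : Carrier} → x ≡ y → y ≡ x
    sym' _≡_.refl = _≡_.refl

  -- admissibility (i) and (ii); (ii) is required of the primitive kernel
  -- (unique up to a constant factor).
  Admissible : Poly2 → Set
  Admissible f =
    (∀ u v → (IsSquare (eval f u v) → IsSquare (eval f v u)) ×
             (IsSquare (eval f v u) → IsSquare (eval f u v))) ×
    (∀ H → IsPrimitiveKernel f H → ¬ ConstTimesSquare H)

  count : ∀ {n} → (Fin n → Bool) → ℕ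
  count {zero}  p = 0
  count {suc n} p = (if p Fin.zero then 1 else 0) +ℕ count (λ i → p (Fin.suc i))

  sumFin : ∀ {n} → (Fin n → ℕ) → ℕ
  sumFin {zero}  g = 0
  sumFin {suc n} g = g Fin.zero +ℕ sumFin (λ i → g (Fin.suc i))

  elt : Fin size → Carrier
  elt = Inverse.from enum

  card : (Carrier → Bool) → ℕ
  card S = count λ i → S (elt i)

  -- adjacency in X_{f,q}: distinct a, b with f(a,b) a square
  -- e(S,T) = #{(s,t) ∈ S × T : s, t adjacent}
  eST : Poly2 → (Carrier → Bool) → (Carrier → Bool) → ℕ
  eST f S T = sumFin λ i → count λ j →
    S (elt i) ∧ T (elt j) ∧ not (does (i Fin.≟ j)) ∧
    does (isSquare? (eval f (elt i) (elt j)))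

module Submission where

-- By Cauchy-Schwarz it suffices to bound, for all but O(q) pairs (t , t′), the
-- correlation of the rows s ↦ ±1 of t and t′, that is Σ_s χ (f(s,t) f(s,t′)),
-- by O(√q). For a fixed pair this is Weil's bound for y² = h(x) with
-- h(x) = f(x,t) f(x,t′), proved by Stepanov's method; it only requires that
-- r² h = h(x₀) s² has no nonzero polynomial solution (r , s) of length < q / 2.
--
-- If such a solution exists, the power series √(h(x₀ + Z) / h(x₀)) is a polynomial
-- of degree ≤ d. After the substitution Z ↦ h(x₀) Z its coefficients are polynomials
-- in t′, so when this happens for too many t′ the coefficients beyond Z^d vanish
-- identically and A(y) B(x) f(x,y) = U(x,y)² for nonzero A and B. Removing irreducible
-- factors in K[x] and K[y] with Gauss's lemma then gives f = F(x) G(y) V² with V²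
-- primitive, against admissibility.

open import Algebra.Bundles using (CommutativeRing; RawRing; CommutativeMonoid)
open import Data.Bool using (Bool; true; false; if_then_else_; _∧_; _∨_; not)
open import Data.Empty using (⊥; ⊥-elim)
open import Data.Fin using (Fin)
open import Data.Fin.Permutation using (Permutation; permutation)
open import Data.Integer using () renaming (∣_∣ to ∣_∣ᶻ; +_ to pos; _-_ to _-ᶻ_)
open import Data.Integer.Tactic.RingSolver using () renaming (solve-∀ to solve-∀ℤ)
open import Data.List using (List; []; _∷_; map; length)
open import Data.List.Relation.Unary.All as All using (All; []; _∷_)
open import Data.List.Relation.Unary.AllPairs as AllPairs using (AllPairs; []; _∷_)
open import Data.Maybe using (Maybe; just; nothing)
open import Data.Nat.Base using (ℕ; zero; suc; _≤_; _<_; z≤n; s≤s; nonZero) renaming (_+_ to _+ℕ_; _*_ to _*ℕ_; _^_ to _^ℕ_; _∸_ to _∸ℕ_)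
open import Data.Nat.Combinatorics using (nCk+nC[k+1]≡[n+1]C[k+1]; k>n⇒nCk≡0; nCn≡1) renaming (_C_ to _choose_)
open import Data.Nat.DivMod using (_%_; _/_; m≡m%n+[m/n]*n; m%n<n)
open import Data.Nat.Primality using (Prime; euclidsLemma)
open import Data.Nat.Tactic.RingSolver using (solve-∀)
open import Data.Product using (Σ; ∃; ∃₂; _×_; _,_; proj₁; proj₂)
open import Data.Sum using (_⊎_; inj₁; inj₂)
open import Defs
open import Function using (_∘_)
open import Function.Bundles using (Inverse)
open import Level using (0ℓ)
open import Relation.Binary.PropositionalEquality using (_≡_; _≢_) renaming (refl to ≡refl; sym to ≡sym; trans to ≡trans; cong to ≡cong; cong₂ to ≡cong₂; subst to ≡subst)
open import Relation.Nullary using (¬_; Dec; yes; no; does)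
open import Relation.Nullary.Decidable using (decidable-stable; dec-true; dec-false)
import Algebra.Properties.AbelianGroup
import Algebra.Properties.CommutativeMonoid.Sum
import Algebra.Properties.CommutativeSemiring.Binomial
import Algebra.Properties.CommutativeSemiring.Exp
import Algebra.Properties.Ring
import Algebra.Properties.Semiring.Mult
import Algebra.Properties.Semiring.Sum
import Algebra.Solver.Ring
import Algebra.Solver.Ring.AlmostCommutativeRing as ACR
import Data.Fin as Fin
import Data.Fin.Properties as Finₚ
import Data.Integer
import Data.Integer.Properties
import Data.List.Properties as Listₚ
import Data.List.Relation.Unary.All.Properties as Allₚ
import Data.List.Relation.Unary.AllPairs.Properties as AllPairsₚ
import Data.Nat.Divisibility as Div
import Data.Nat.Properties as ℕₚ
import Relation.Binary.PropositionalEquality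
import Relation.Binary.Reasoning.Setoid

-- The pairs in T × T enter the second moment with nonnegative weights, so an upper bound for each
-- correlation is enough. One application of Stepanov's method per pair gives it: the number of s
-- with h(s)^((q-1)/2) = 1 is at most q/2 + O(√q).
--
-- Orders of vanishing are measured by substituting x + b Z with b ≠ 0 instead of by derivatives,
-- which lose information in positive characteristic. The slope b = h(x) is the decisive choice: h(x
-- + h(x) Z) = h(x) (1 + Z (...)) has a cofactor without denominators, its coefficient of Z^k has
-- degree at most k deg h in x, and this bound survives every power, in particular the power
-- (q-1)/2.
--
-- The constant may depend on d alone. Hence being exceptional is expressed by the vanishing of d
-- coefficients, each a polynomial in t′ of degree bounded in terms of d, and exceptional t′ are
-- counted for each t separately, so that a factor |T| survives. Reading polynomial identities off
-- from values needs q large compared with d; for the remaining q the trivial bound on correlations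
-- is absorbed by the constant.

-- Normalisation in commutative rings.

-- Integer coefficients are represented as formal differences m - n, so that
-- all homomorphism laws live in the semiring of natural numbers.
module IntegerSolver (R : CommutativeRing 0ℓ 0ℓ) where
  open CommutativeRing R hiding (zero)
  open Algebra.Properties.Ring ring using (-‿distribˡ-*; -‿distribʳ-*; -‿involutive; -0#≈0#)
  open Algebra.Properties.AbelianGroup +-abelianGroup using (⁻¹-∙-comm)
  open Algebra.Properties.Semiring.Mult semiring using (×-homo-+; ×1-homo-*) renaming (_×_ to _×′_)
  open Relation.Binary.Reasoning.Setoid setoid

  differences : RawRing 0ℓ 0ℓ
  differences = record
    { Carrier = ℕ × ℕ ; _≈_ = _≡_
    ; _+_ = λ (a , b) (c , d) → a +ℕ c , b +ℕ d
    ; _*_ = λ (a , b) (c , d) → a *ℕ c +ℕ b *ℕ d , a *ℕ d +ℕ b *ℕ c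
    ; -_ = λ (a , b) → b , a
    ; 0# = 0 , 0 ; 1# = 1 , 0 }

  private
    ι : ℕ → Carrier
    ι n = n ×′ 1#

    value : ℕ × ℕ → Carrier
    value (a , b) = ι a - ι b

    interchange : ∀ a b c d → (a + b) + (c + d) ≈ (a + c) + (b + d)
    interchange a b c d = begin
      (a + b) + (c + d) ≈⟨ +-assoc a b _ ⟩
      a + (b + (c + d)) ≈⟨ +-congˡ (sym (+-assoc b c d)) ⟩
      a + ((b + c) + d) ≈⟨ +-congˡ (+-congʳ (+-comm b c)) ⟩
      a + ((c + b) + d) ≈⟨ +-congˡ (+-assoc c b d) ⟩
      a + (c + (b + d)) ≈⟨ +-assoc a c _ ⟨
      (a + c) + (b + d) ∎

    diff-homo : ∀ a b c d → (a - b) + (c - d) ≈ (a + c) - (b + d)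
    diff-homo a b c d = trans (interchange a (- b) c (- d)) (+-congˡ (⁻¹-∙-comm b d))

    *-homo : ∀ a b c d → (a - b) * (c - d) ≈ (a * c + b * d) - (a * d + b * c)
    *-homo a b c d = begin
      (a - b) * (c - d) ≈⟨ distribʳ _ a (- b) ⟩
      a * (c - d) + - b * (c - d) ≈⟨ +-cong (distribˡ a c (- d)) (distribˡ (- b) c (- d)) ⟩
      (a * c + a * - d) + (- b * c + - b * - d)
        ≈⟨ +-cong (+-congˡ (sym (-‿distribʳ-* a d)))
             (+-cong (sym (-‿distribˡ-* b c))
               (trans (sym (-‿distribˡ-* b (- d))) (trans (-‿cong (sym (-‿distribʳ-* b d))) (-‿involutive _)))) ⟩
      (a * c - a * d) + (- (b * c) + b * d) ≈⟨ +-congˡ (+-comm _ _) ⟩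
      (a * c - a * d) + (b * d - b * c) ≈⟨ diff-homo (a * c) (a * d) (b * d) (b * c) ⟩
      (a * c + b * d) - (a * d + b * c) ∎

    equal-value : ∀ a b c d → a +ℕ d ≡ c +ℕ b → value (a , b) ≈ value (c , d)
    equal-value a b c d e = begin
      ι a - ι b ≈⟨ +-identityʳ _ ⟨
      (ι a - ι b) + 0# ≈⟨ +-congˡ (-‿inverseʳ (ι d)) ⟨
      (ι a - ι b) + (ι d - ι d) ≈⟨ diff-homo _ _ _ _ ⟩
      (ι a + ι d) - (ι b + ι d) ≈⟨ +-cong move (-‿cong (+-comm _ _)) ⟩
      (ι c + ι b) - (ι d + ι b) ≈⟨ diff-homo _ _ _ _ ⟨
      (ι c - ι d) + (ι b - ι b) ≈⟨ +-congˡ (-‿inverseʳ (ι b)) ⟩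
      (ι c - ι d) + 0# ≈⟨ +-identityʳ _ ⟩
      ι c - ι d ∎
      where
      move : ι a + ι d ≈ ι c + ι b
      move = begin
        ι a + ι d ≈⟨ ×-homo-+ 1# a d ⟨
        ι (a +ℕ d) ≡⟨ ≡cong ι e ⟩
        ι (c +ℕ b) ≈⟨ ×-homo-+ 1# c b ⟩
        ι c + ι b ∎

  morphism : differences ACR.-Raw-AlmostCommutative⟶ ACR.fromCommutativeRing R
  morphism = record
    { ⟦_⟧ = value
    ; +-homo = λ (a , b) (c , d) →
        trans (+-cong (×-homo-+ 1# a c) (-‿cong (×-homo-+ 1# b d))) (sym (diff-homo _ _ _ _))
    ; *-homo = λ (a , b) (c , d) →
        trans (+-cong (trans (×-homo-+ 1# (a *ℕ c) _) (+-cong (×1-homo-* a c) (×1-homo-* b d)))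
                      (-‿cong (trans (×-homo-+ 1# (a *ℕ d) _) (+-cong (×1-homo-* a d) (×1-homo-* b c)))))
              (sym (*-homo _ _ _ _))
    ; -‿homo = λ (a , b) → trans (+-comm _ _) (trans (+-congˡ (sym (-‿involutive _))) (⁻¹-∙-comm _ _))
    ; 0-homo = -‿inverseʳ 0#
    ; 1-homo = trans (+-cong (+-identityʳ 1#) -0#≈0#) (+-identityʳ 1#)
    }

  equal? : ∀ x y → Maybe (value x ≈ value y)
  equal? (a , b) (c , d) with (a +ℕ d) ℕₚ.≟ (c +ℕ b)
  ... | yes e = just (equal-value a b c d e)
  ... | no _  = nothing

  open Algebra.Solver.Ring differences (ACR.fromCommutativeRing R) morphism equal? public
    using (solve; _:=_; _:+_; _:*_; :-_; _:-_; con)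

-- Formal power series, with polynomials as series of bounded length.

module PowerSeries (R : CommutativeRing 0ℓ 0ℓ) where
  open CommutativeRing R hiding (zero)
  open IntegerSolver R
  open Algebra.Properties.Ring ring using (-0#≈0#)
  open Relation.Binary.Reasoning.Setoid setoid

  Series : Set
  Series = ℕ → Carrier

  tail : Series → Series
  tail p n = p (suc n)

  infix 4 _≋_
  _≋_ : Series → Series → Set
  p ≋ q = ∀ n → p n ≈ q n

  infixl 6 _⊞_
  infixl 7 _⊡_
  -- The product follows p = p₀ + Z · `tail p` instead of a convolution sum, so that proofs are
  -- inductions on the index with p replaced by its tail.
  _⊞_ _⊡_ : Series → Series → Series
  (p ⊞ q) n = p n + q n
  (p ⊡ q) zero    = p 0 * q 0
  (p ⊡ q) (suc n) = p 0 * q (suc n) + (tail p ⊡ q) n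

  constant : Carrier → Series → Series
  constant c p zero    = c
  constant c p (suc n) = p n

  C : Carrier → Series
  C c = constant c (λ _ → 0#)

  Z : Series
  Z = constant 0# (C 1#)

  ⊡-cong : ∀ {p p′ q q′} → p ≋ p′ → q ≋ q′ → p ⊡ q ≋ p′ ⊡ q′
  ⊡-cong e f zero    = *-cong (e 0) (f 0)
  ⊡-cong e f (suc n) = +-cong (*-cong (e 0) (f (suc n))) (⊡-cong (λ m → e (suc m)) f n)

  -- The same product peeled from the right factor. Commutativity, cancellation and Gauss's lemma
  -- all rest on having both recursions.
  ⊡-last : ∀ p q n → (p ⊡ q) (suc n) ≈ p (suc n) * q 0 + (p ⊡ tail q) n
  ⊡-last p q zero    = +-comm _ _
  ⊡-last p q (suc n) = trans (+-congˡ (⊡-last (tail p) q n))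
    (solve 3 (λ a b c → a :+ (b :+ c) := b :+ (a :+ c)) refl _ _ _)

  ⊡-comm : ∀ p q → p ⊡ q ≋ q ⊡ p
  ⊡-comm p q zero    = *-comm _ _
  ⊡-comm p q (suc n) = trans (+-cong (*-comm _ _) (⊡-comm (tail p) q n)) (sym (⊡-last q p n))

  ⊡-distribʳ : ∀ r p q → (p ⊞ q) ⊡ r ≋ p ⊡ r ⊞ q ⊡ r
  ⊡-distribʳ r p q zero    = distribʳ _ _ _
  ⊡-distribʳ r p q (suc n) = trans (+-cong (distribʳ _ _ _) (⊡-distribʳ r (tail p) (tail q) n))
    (solve 4 (λ a b c d → (a :+ b) :+ (c :+ d) := (a :+ c) :+ (b :+ d)) refl _ _ _ _)

  ⊡-scale : ∀ c p q n → ((λ m → c * p m) ⊡ q) n ≈ c * (p ⊡ q) n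
  ⊡-scale c p q zero    = *-assoc _ _ _
  ⊡-scale c p q (suc n) = trans (+-congˡ (⊡-scale c (tail p) q n))
    (solve 4 (λ a b d e → a :* b :* d :+ a :* e := a :* (b :* d :+ e)) refl _ _ _ _)

  ⊡-assoc : ∀ p q r → (p ⊡ q) ⊡ r ≋ p ⊡ (q ⊡ r)
  ⊡-assoc p q r zero    = *-assoc _ _ _
  ⊡-assoc p q r (suc n) = begin
    p 0 * q 0 * r (suc n) + (((λ m → p 0 * q (suc m)) ⊞ (tail p ⊡ q)) ⊡ r) n
      ≈⟨ +-congˡ (⊡-distribʳ r _ _ n) ⟩
    p 0 * q 0 * r (suc n) + (((λ m → p 0 * q (suc m)) ⊡ r) n + ((tail p ⊡ q) ⊡ r) n)
      ≈⟨ +-congˡ (+-cong (⊡-scale (p 0) (tail q) r n) (⊡-assoc (tail p) q r n)) ⟩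
    p 0 * q 0 * r (suc n) + (p 0 * (tail q ⊡ r) n + (tail p ⊡ (q ⊡ r)) n)
      ≈⟨ solve 5 (λ a b c d e → a :* b :* c :+ (a :* d :+ e) := a :* (b :* c :+ d) :+ e) refl _ _ _ _ _ ⟩
    p 0 * (q 0 * r (suc n) + (tail q ⊡ r) n) + (tail p ⊡ (q ⊡ r)) n ∎

  ⊡-zeroˡ : ∀ p q → p ≋ (λ _ → 0#) → p ⊡ q ≋ (λ _ → 0#)
  ⊡-zeroˡ p q e zero    = trans (*-congʳ (e 0)) (zeroˡ _)
  ⊡-zeroˡ p q e (suc n) =
    trans (+-cong (trans (*-congʳ (e 0)) (zeroˡ _)) (⊡-zeroˡ (tail p) q (λ m → e (suc m)) n)) (+-identityˡ _)

  C-⊡ : ∀ c p n → (C c ⊡ p) n ≈ c * p n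
  C-⊡ c p zero    = refl
  C-⊡ c p (suc n) = trans (+-congˡ (⊡-zeroˡ _ p (λ _ → refl) n)) (+-identityʳ _)

  ⊡-identityˡ : ∀ p → C 1# ⊡ p ≋ p
  ⊡-identityˡ p n = trans (C-⊡ 1# p n) (*-identityˡ _)

  ring-of-series : CommutativeRing 0ℓ 0ℓ
  ring-of-series = record
    { Carrier = Series ; _≈_ = _≋_ ; _+_ = _⊞_ ; _*_ = _⊡_ ; -_ = λ p n → - p n
    ; 0# = λ _ → 0# ; 1# = C 1#
    ; isCommutativeRing = record
      { isRing = record
        { +-isAbelianGroup = record
          { isGroup = record
            { isMonoid = record
              { isSemigroup = record
                { isMagma = record
                  { isEquivalence = record
                    { refl = λ _ → refl ; sym = λ e n → sym (e n) ; trans = λ e f n → trans (e n) (f n) }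
                  ; ∙-cong = λ e f n → +-cong (e n) (f n) }
                ; assoc = λ p q r n → +-assoc _ _ _ }
              ; identity = (λ p n → +-identityˡ _) , (λ p n → +-identityʳ _) }
            ; inverse = (λ p n → -‿inverseˡ _) , (λ p n → -‿inverseʳ _)
            ; ⁻¹-cong = λ e n → -‿cong (e n) }
          ; comm = λ p q n → +-comm _ _ }
        ; *-cong = ⊡-cong
        ; *-assoc = ⊡-assoc
        ; *-identity = ⊡-identityˡ , λ p n → trans (⊡-comm p (C 1#) n) (⊡-identityˡ p n)
        ; distrib = (λ r p q n → trans (⊡-comm r _ n)
                       (trans (⊡-distribʳ r p q n) (+-cong (⊡-comm p r n) (⊡-comm q r n))))
                  , ⊡-distribʳ }
      ; *-comm = ⊡-comm } }

  ⊡-cong-≤ : ∀ n {p p′ q q′} → (∀ i → i ≤ n → p i ≈ p′ i) → (∀ i → i ≤ n → q i ≈ q′ i) →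
    (p ⊡ q) n ≈ (p′ ⊡ q′) n
  ⊡-cong-≤ zero e f = *-cong (e 0 z≤n) (f 0 z≤n)
  ⊡-cong-≤ (suc n) e f = +-cong (*-cong (e 0 z≤n) (f (suc n) ℕₚ.≤-refl))
    (⊡-cong-≤ n (λ i l → e (suc i) (s≤s l)) (λ i l → f i (ℕₚ.m≤n⇒m≤1+n l)))

  infix 4 _≡[_]_
  _≡[_]_ : Series → ℕ → Series → Set
  p ≡[ n ] q = ∀ i → i < n → p i ≈ q i

  trunc-* : ∀ n {p p′ q q′} → p ≡[ n ] p′ → q ≡[ n ] q′ → p ⊡ q ≡[ n ] p′ ⊡ q′
  trunc-* n e f i l = ⊡-cong-≤ i (λ j k → e j (ℕₚ.≤-<-trans k l)) (λ j k → f j (ℕₚ.≤-<-trans k l))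

  C-cong : ∀ {a b} → a ≈ b → C a ≋ C b
  C-cong e zero    = e
  C-cong e (suc n) = refl

  C-+ : ∀ a b → C (a + b) ≋ C a ⊞ C b
  C-+ a b zero    = refl
  C-+ a b (suc n) = sym (+-identityʳ 0#)

  C-* : ∀ a b → C (a * b) ≋ C a ⊡ C b
  C-* a b zero    = refl
  C-* a b (suc n) = sym (trans (C-⊡ a (C b) (suc n)) (zeroʳ a))

  C-0 : C 0# ≋ (λ _ → 0#)
  C-0 zero    = refl
  C-0 (suc n) = refl

  Z-⊡ : ∀ p n → (Z ⊡ p) (suc n) ≈ p n
  Z-⊡ p n = trans (+-cong (zeroˡ _) (⊡-identityˡ p n)) (+-identityˡ _)

  Z-⊡-zero : ∀ p → (Z ⊡ p) 0 ≈ 0#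
  Z-⊡-zero p = zeroˡ _

  -- The bound is on the length: degree at most n is `Bd (suc n)`, and `Bd 0` is left for the zero
  -- series.
  Bd : ℕ → Series → Set
  Bd n p = ∀ i → n ≤ i → p i ≈ 0#

  Bd-cong : ∀ {n p q} → p ≋ q → Bd n p → Bd n q
  Bd-cong e b i l = trans (sym (e i)) (b i l)

  Bd-mono : ∀ {m n p} → m ≤ n → Bd m p → Bd n p
  Bd-mono l b i k = b i (ℕₚ.≤-trans l k)

  Bd-tail : ∀ {n p} → Bd (suc n) p → Bd n (tail p)
  Bd-tail b i l = b (suc i) (s≤s l)

  Bd-zero : ∀ {p} → Bd 0 p → p ≋ (λ _ → 0#)
  Bd-zero b i = b i z≤n

  Bd-C : ∀ {n} c → Bd (suc n) (C c)
  Bd-C c (suc i) l = refl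

  Bd-Z : ∀ {n} → Bd (suc (suc n)) Z
  Bd-Z (suc zero) (s≤s ())
  Bd-Z (suc (suc i)) l = refl

  Bd-+ : ∀ {n p q} → Bd n p → Bd n q → Bd n (p ⊞ q)
  Bd-+ b c i l = trans (+-cong (b i l) (c i l)) (+-identityʳ _)

  Bd-neg : ∀ {n p} → Bd n p → Bd n (λ i → - p i)
  Bd-neg b i l = trans (-‿cong (b i l)) -0#≈0#

  Bd-* : ∀ {m n p q} → Bd m p → Bd (suc n) q → Bd (m +ℕ n) (p ⊡ q)
  Bd-* {zero} b c i l = ⊡-zeroˡ _ _ (Bd-zero b) i
  Bd-* {suc m} {n} {p} {q} b c (suc i) (s≤s l) =
    trans (+-cong (trans (*-congˡ (c (suc i) (s≤s (ℕₚ.≤-trans (ℕₚ.m≤n+m n m) l)))) (zeroʳ _))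
                  (Bd-* {m} {n} (Bd-tail b) c i l))
          (+-identityʳ 0#)

  -- One longer than `Bd-*` gives, to match the lengths in `ev-*`.
  Bd-*′ : ∀ {m n p q} → Bd m p → Bd n q → Bd (m +ℕ n) (p ⊡ q)
  Bd-*′ {m} b c = Bd-* {m} b (Bd-mono (ℕₚ.n≤1+n _) c)

-- Vanishing of a series is not decidable, so equality is only asked to be stable under double
-- negation; both fields then pass from the coefficients to series.
record Domain (R : CommutativeRing 0ℓ 0ℓ) : Set where
  open CommutativeRing R hiding (zero)
  field
    stable : ∀ {x y} → ¬ ¬ (x ≈ y) → x ≈ y
    cancel : ∀ {x y} → ¬ (x ≈ 0#) → x * y ≈ 0# → y ≈ 0#

module SeriesDomain (R : CommutativeRing 0ℓ 0ℓ) (D : Domain R) where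
  open CommutativeRing R hiding (zero)
  open PowerSeries R
  open Domain D
  open Relation.Binary.Reasoning.Setoid setoid

  -- Only coefficients up to n are involved, so the lemma also cancels modulo a power of Z, as
  -- multiplicities require.
  cancel-unit : ∀ n p q → ¬ (p 0 ≈ 0#) → (∀ m → m ≤ n → (p ⊡ q) m ≈ 0#) → q n ≈ 0#
  cancel-unit zero p q u e = cancel u (e 0 z≤n)
  cancel-unit (suc n) p q u e = cancel-unit n p (tail q) u λ m l → begin
    (p ⊡ tail q) m ≈⟨ +-identityˡ _ ⟨
    0# + (p ⊡ tail q) m ≈⟨ +-congʳ (trans (*-congˡ (cancel u (e 0 z≤n))) (zeroʳ _)) ⟨
    p (suc m) * q 0 + (p ⊡ tail q) m ≈⟨ ⊡-last p q m ⟨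
    (p ⊡ q) (suc m) ≈⟨ e (suc m) (s≤s l) ⟩
    0# ∎

  private
    cancel-first : ∀ i p q → (∀ j → j < i → p j ≈ 0#) → ¬ (p i ≈ 0#) → p ⊡ q ≋ (λ _ → 0#) → q ≋ (λ _ → 0#)
    cancel-first zero p q z u e n = cancel-unit n p q u (λ m _ → e m)
    cancel-first (suc i) p q z u e = cancel-first i (tail p) q (λ j l → z (suc j) (s≤s l)) u λ m →
      trans (sym (+-identityˡ _))
        (trans (+-congʳ (sym (trans (*-congʳ (z 0 (s≤s z≤n))) (zeroˡ _)))) (e (suc m)))

  domain-of-series : Domain ring-of-series
  domain-of-series = record
    { stable = λ nn n → stable (λ ne → nn (λ e → ne (e n)))
    ; cancel = λ {p} {q} u e n → stable λ ne → u (λ i → all-zero p q e n ne i i ℕₚ.≤-refl) }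
    where
    -- Once q is known to be nonzero, p cannot have a first nonzero coefficient, because
    -- `cancel-first` would then kill q.
    all-zero : ∀ p q → p ⊡ q ≋ (λ _ → 0#) → ∀ n → ¬ (q n ≈ 0#) → ∀ i j → j ≤ i → p j ≈ 0#
    all-zero p q e n ne zero zero z≤n = stable λ np → ne (cancel-first 0 p q (λ j ()) np e n)
    all-zero p q e n ne (suc i) j l = stable λ np →
      ne (cancel-first j p q (λ k k<j → all-zero p q e n ne i k (ℕₚ.≤-pred (ℕₚ.≤-trans k<j l))) np e n)

-- Evaluation of polynomials and multiplicities of roots.

record Hom (R A : CommutativeRing 0ℓ 0ℓ) : Set where
  private
    module R = CommutativeRing R
    module A = CommutativeRing A
  field
    ⟦_⟧ : R.Carrier → A.Carrier
    ⟦⟧-cong : ∀ {x y} → x R.≈ y → ⟦ x ⟧ A.≈ ⟦ y ⟧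
    ⟦⟧-+ : ∀ x y → ⟦ x R.+ y ⟧ A.≈ ⟦ x ⟧ A.+ ⟦ y ⟧
    ⟦⟧-* : ∀ x y → ⟦ x R.* y ⟧ A.≈ ⟦ x ⟧ A.* ⟦ y ⟧
    ⟦⟧-0 : ⟦ R.0# ⟧ A.≈ A.0#
    ⟦⟧-1 : ⟦ R.1# ⟧ A.≈ A.1#

id-hom : ∀ R → Hom R R
id-hom R = record { ⟦_⟧ = λ x → x ; ⟦⟧-cong = λ e → e ; ⟦⟧-+ = λ _ _ → refl ; ⟦⟧-* = λ _ _ → refl
                  ; ⟦⟧-0 = refl ; ⟦⟧-1 = refl }
  where open CommutativeRing R

C-hom : ∀ R → Hom R (PowerSeries.ring-of-series R)
C-hom R = record { ⟦_⟧ = C ; ⟦⟧-cong = C-cong ; ⟦⟧-+ = C-+ ; ⟦⟧-* = C-* ; ⟦⟧-0 = C-0 ; ⟦⟧-1 = λ _ → refl }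
  where
  open PowerSeries R
  open CommutativeRing R

-- A polynomial is a series together with a bound beyond which its
-- coefficients vanish; evaluation is Horner's scheme of the given length.
module Evaluation (R A : CommutativeRing 0ℓ 0ℓ) (φ : Hom R A) where
  private
    module R = CommutativeRing R
    module S = PowerSeries R
  open CommutativeRing A hiding (zero)
  open IntegerSolver A
  open Hom φ public
  open S using (Series; tail; _≋_; _⊞_; _⊡_; C; Z; Bd; Bd-tail)
  open Relation.Binary.Reasoning.Setoid setoid

  ev : ℕ → Series → Carrier → Carrier
  ev zero    p a = 0#
  ev (suc n) p a = ⟦ p 0 ⟧ + a * ev n (tail p) a

  ev-cong : ∀ n {p q a b} → p ≋ q → a ≈ b → ev n p a ≈ ev n q b
  ev-cong zero    e f = refl
  ev-cong (suc n) e f = +-cong (⟦⟧-cong (e 0)) (*-cong f (ev-cong n (λ i → e (suc i)) f))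

  ev-zero : ∀ n {p} a → (∀ i → p i R.≈ R.0#) → ev n p a ≈ 0#
  ev-zero zero    a e = refl
  ev-zero (suc n) a e =
    trans (+-cong (trans (⟦⟧-cong (e 0)) ⟦⟧-0) (trans (*-congˡ (ev-zero n a (λ i → e (suc i)))) (zeroʳ a))) (+-identityʳ 0#)

  ev-+ : ∀ n p q a → ev n (p ⊞ q) a ≈ ev n p a + ev n q a
  ev-+ zero    p q a = sym (+-identityʳ 0#)
  ev-+ (suc n) p q a = trans (+-cong (⟦⟧-+ _ _) (*-congˡ (ev-+ n _ _ a)))
    (solve 5 (λ a b x c d → (a :+ b) :+ x :* (c :+ d) := (a :+ x :* c) :+ (b :+ x :* d)) refl _ _ _ _ _)

  ev-scale : ∀ n c p a → ev n (λ i → c R.* p i) a ≈ ⟦ c ⟧ * ev n p a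
  ev-scale zero    c p a = sym (zeroʳ _)
  ev-scale (suc n) c p a = trans (+-cong (⟦⟧-* _ _) (*-congˡ (ev-scale n c _ a)))
    (solve 4 (λ c p a e → c :* p :+ a :* (c :* e) := c :* (p :+ a :* e)) refl _ _ _ _)

  ev-stable : ∀ {n m p} a → Bd n p → n ≤ m → ev m p a ≈ ev n p a
  ev-stable {m = m} a b z≤n = ev-zero m a (S.Bd-zero b)
  ev-stable a b (s≤s l) = +-congˡ (*-congˡ (ev-stable a (Bd-tail b) l))

  ev-unique : ∀ {n m p q} a → Bd n p → Bd m q → p ≋ q → ev n p a ≈ ev m q a
  ev-unique {n} {m} a b c e with ℕₚ.≤-total n m
  ... | inj₁ l = trans (ev-cong n e refl) (sym (ev-stable a (S.Bd-cong e b) l))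
  ... | inj₂ l = trans (ev-cong n e refl) (ev-stable a c l)

  ev-C : ∀ n c a → ev (suc n) (C c) a ≈ ⟦ c ⟧
  ev-C n c a = trans (+-congˡ (trans (*-congˡ (ev-zero n a (λ _ → R.refl))) (zeroʳ a))) (+-identityʳ _)

  ev-Z : ∀ n a → ev (suc (suc n)) Z a ≈ a
  ev-Z n a = trans (+-cong ⟦⟧-0 (*-congˡ (trans (ev-C n _ a) ⟦⟧-1))) (trans (+-identityˡ _) (*-identityʳ a))

  ev-* : ∀ {m n p q} a → Bd m p → Bd n q → ev (m +ℕ n) (p ⊡ q) a ≈ ev m p a * ev n q a
  ev-* {zero} {n} {p} {q} a b c = trans (ev-zero n a (S.⊡-zeroˡ p q (S.Bd-zero b))) (sym (zeroˡ _))
  ev-* {suc m} {n} {p} {q} a b c = begin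
    ⟦ p 0 R.* q 0 ⟧ + a * ev (m +ℕ n) ((λ i → p 0 R.* q (suc i)) ⊞ (tail p ⊡ q)) a
      ≈⟨ +-cong (⟦⟧-* _ _) (*-congˡ (trans (ev-+ (m +ℕ n) _ _ a)
           (+-cong (ev-scale (m +ℕ n) _ _ a) (ev-* {m} a (Bd-tail b) c)))) ⟩
    ⟦ p 0 ⟧ * ⟦ q 0 ⟧ + a * (⟦ p 0 ⟧ * ev (m +ℕ n) (tail q) a + ev m (tail p) a * ev n q a)
      ≈⟨ solve 6 (λ p q a x y z → p :* q :+ a :* (p :* x :+ y :* z) := p :* (q :+ a :* x) :+ a :* y :* z) refl _ _ _ _ _ _ ⟩
    ⟦ p 0 ⟧ * ev (suc (m +ℕ n)) q a + a * ev m (tail p) a * ev n q a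
      ≈⟨ +-congʳ (*-congˡ (ev-stable a c (ℕₚ.≤-trans (ℕₚ.m≤n+m n m) (ℕₚ.n≤1+n _)))) ⟩
    ⟦ p 0 ⟧ * ev n q a + a * ev m (tail p) a * ev n q a ≈⟨ distribʳ _ _ _ ⟨
    (⟦ p 0 ⟧ + a * ev m (tail p) a) * ev n q a ∎

  -- The divided difference (p(x + w) - p(x)) / w, written without division so that it makes sense
  -- for w = b Z and depends polynomially on all data.
  difference : ℕ → Series → Carrier → Carrier → Carrier
  difference zero    p x w = 0#
  difference (suc n) p x w = x * difference n (tail p) x w + ev n (tail p) (x + w)

  ev-difference : ∀ n p x w → ev n p (x + w) ≈ ev n p x + w * difference n p x w
  ev-difference zero    p x w = sym (trans (+-identityˡ _) (zeroʳ w))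
  ev-difference (suc n) p x w = begin
    ⟦ p 0 ⟧ + (x + w) * e ≈⟨ solve 4 (λ p x w e → p :+ (x :+ w) :* e := p :+ x :* e :+ w :* e) refl _ _ _ _ ⟩
    ⟦ p 0 ⟧ + x * e + w * e ≈⟨ +-congʳ (+-congˡ (*-congˡ (ev-difference n (tail p) x w))) ⟩
    ⟦ p 0 ⟧ + x * (ev n (tail p) x + w * difference n (tail p) x w) + w * e
      ≈⟨ solve 6 (λ p x w e f d → p :+ x :* (f :+ w :* d) :+ w :* e := (p :+ x :* f) :+ w :* (x :* d :+ e)) refl _ _ _ _ _ _ ⟩
    (⟦ p 0 ⟧ + x * ev n (tail p) x) + w * (x * difference n (tail p) x w + e) ∎
    where e = ev n (tail p) (x + w)

module Quotient (R : CommutativeRing 0ℓ 0ℓ) where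
  open CommutativeRing R hiding (zero)
  open PowerSeries R
  module Id = Evaluation R R (id-hom R)

  -- Synthetic division by X - a: the coefficients are the Horner values at a of the successive
  -- tails.
  quotient : ℕ → Series → Carrier → Series
  quotient zero    p a = λ _ → 0#
  quotient (suc n) p a = constant (Id.ev (suc n) (tail p) a) (quotient n (tail p) a)

  Bd-quotient : ∀ n p a → Bd n (quotient n p a)
  Bd-quotient zero p a i l = refl
  Bd-quotient (suc n) p a (suc i) (s≤s l) = Bd-quotient n (tail p) a i l

  quotient-zero : ∀ n p a → Bd (suc n) p → Id.ev (suc n) p a ≈ 0# → quotient n p a ≋ (λ _ → 0#) → p ≋ (λ _ → 0#)
  quotient-zero zero p a b e f zero = trans (sym (trans (+-congˡ (zeroʳ a)) (+-identityʳ _))) e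
  quotient-zero zero p a b e f (suc i) = b (suc i) (s≤s z≤n)
  quotient-zero (suc n) p a b e f zero = trans (sym (trans (+-congˡ (trans (*-congˡ (f 0)) (zeroʳ a))) (+-identityʳ _))) e
  quotient-zero (suc n) p a b e f (suc i) = quotient-zero n (tail p) a (Bd-tail b) (f 0) (λ j → f (suc j)) i

  module _ (A : CommutativeRing 0ℓ 0ℓ) (φ : Hom R A) where
    private module A = CommutativeRing A
    open Evaluation R A φ
    open IntegerSolver A
    open Relation.Binary.Reasoning.Setoid A.setoid

    -- The point β lies in a second ring because multiplicities evaluate p at the series x + b Z.
    ev-quotient : ∀ n p a β →
      ev (suc n) p β A.≈ ⟦ Id.ev (suc n) p a ⟧ A.+ (β A.- ⟦ a ⟧) A.* ev n (quotient n p a) β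
    ev-quotient zero p a β = A.trans (A.+-cong (A.sym (⟦⟧-cong (trans (+-congˡ (zeroʳ a)) (+-identityʳ _)))) (A.zeroʳ β))
      (A.+-congˡ (A.sym (A.zeroʳ _)))
    ev-quotient (suc n) p a β = begin
      ⟦ p 0 ⟧ A.+ β A.* ev (suc n) (tail p) β ≈⟨ A.+-congˡ (A.*-congˡ (ev-quotient n (tail p) a β)) ⟩
      ⟦ p 0 ⟧ A.+ β A.* (⟦ v ⟧ A.+ (β A.- ⟦ a ⟧) A.* e)
        ≈⟨ solve 5 (λ p b v a e → p :+ b :* (v :+ (b :- a) :* e) := (p :+ a :* v) :+ (b :- a) :* (v :+ b :* e)) A.refl _ _ _ _ _ ⟩
      (⟦ p 0 ⟧ A.+ ⟦ a ⟧ A.* ⟦ v ⟧) A.+ (β A.- ⟦ a ⟧) A.* (⟦ v ⟧ A.+ β A.* e)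
        ≈⟨ A.+-congʳ (A.sym (A.trans (⟦⟧-+ _ _) (A.+-congˡ (⟦⟧-* _ _)))) ⟩
      ⟦ p 0 + a * v ⟧ A.+ (β A.- ⟦ a ⟧) A.* (⟦ v ⟧ A.+ β A.* e) ∎
      where
      v = Id.ev (suc n) (tail p) a
      e = ev n (quotient n (tail p) a) β

module Roots (R : CommutativeRing 0ℓ 0ℓ) (D : Domain R) where
  open CommutativeRing R hiding (zero)
  open PowerSeries R
  open SeriesDomain R D
  open Domain D
  open Quotient R
  private module P = CommutativeRing ring-of-series
  open Evaluation R ring-of-series (C-hom R)
  open Relation.Binary.Reasoning.Setoid setoid

  line : Carrier → Carrier → Series
  line x b = C x ⊞ C b ⊡ Z

  private
    line-0 : ∀ x b → line x b 0 ≈ x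
    line-0 x b = trans (+-congˡ (zeroʳ b)) (+-identityʳ x)

    module PS = IntegerSolver ring-of-series

    line-minus : ∀ x b → line x b P.- C x ≋ Z ⊡ C b
    line-minus x b = PS.solve 3 (λ x b z → (x PS.:+ b PS.:* z) PS.:- x PS.:= z PS.:* b) P.refl (C x) (C b) Z

  ev-line-0 : ∀ n p x b → ev n p (line x b) 0 ≈ Id.ev n p x
  ev-line-0 zero p x b = refl
  ev-line-0 (suc n) p x b = +-congˡ (*-cong (line-0 x b) (ev-line-0 n (tail p) x b))

  -- Multiplicity without derivatives: Z^k divides p(x + b Z). The slope b is left free because
  -- Stepanov's method takes it to be a value of h.
  VanishesAt : ℕ → Series → Carrier × ℕ → Set
  VanishesAt n p (x , k) = ∃ λ b → ¬ (b ≈ 0#) × ev n p (line x b) ≡[ k ] (λ _ → 0#)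

  total : List (Carrier × ℕ) → ℕ
  total [] = 0
  total ((x , k) ∷ xs) = k +ℕ total xs

  Distinct : List (Carrier × ℕ) → Set
  Distinct = AllPairs (λ u v → ¬ (proj₁ u ≈ proj₁ v))

  private
    C-scale-zero : ∀ b p k → ¬ (b ≈ 0#) → C b ⊡ p ≡[ k ] (λ _ → 0#) → p ≡[ k ] (λ _ → 0#)
    C-scale-zero b p k nb e i l = cancel nb (trans (sym (C-⊡ b p i)) (e i l))

  -- Dividing by X - x lowers the order at x by one, since (x + b Z) - x = b Z, and keeps the order
  -- at every other y, since (y + c Z) - x has a nonzero constant term.
  few-zeros : ∀ n p → Bd n p → ∀ xs → Distinct xs → All (VanishesAt n p) xs → n ≤ total xs → p ≋ (λ _ → 0#)
  few-zeros zero p bd xs ds vs l = Bd-zero bd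
  few-zeros (suc n) p bd ((x , zero) ∷ xs) (d ∷ ds) (v ∷ vs) l = few-zeros (suc n) p bd xs ds vs l
  few-zeros (suc n) p bd ((x , suc k) ∷ xs) (d ∷ ds) ((b , nb , v) ∷ vs) l =
    quotient-zero n p x bd root
      (few-zeros n q (Bd-quotient n p x) ((x , k) ∷ xs) (d ∷ ds) ((b , nb , here) ∷ All.zipWith there (d , vs)) (ℕₚ.≤-pred l))
    where
    q = quotient n p x
    root : Id.ev (suc n) p x ≈ 0#
    root = trans (sym (ev-line-0 (suc n) p x b)) (v 0 (s≤s z≤n))
    factor : ∀ β → ev (suc n) p β ≋ (β P.- C x) ⊡ ev n q β
    factor β = P.trans (ev-quotient ring-of-series (C-hom R) n p x β)
      (P.trans (P.+-congʳ (P.trans (C-cong root) C-0)) (P.+-identityˡ _))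
    here : ev n q (line x b) ≡[ k ] (λ _ → 0#)
    here = C-scale-zero b _ k nb λ i l → begin
      (C b ⊡ ev n q (line x b)) i ≈⟨ Z-⊡ _ i ⟨
      (Z ⊡ (C b ⊡ ev n q (line x b))) (suc i) ≈⟨ ⊡-assoc Z (C b) _ (suc i) ⟨
      (Z ⊡ C b ⊡ ev n q (line x b)) (suc i) ≈⟨ ⊡-cong (line-minus x b) (λ _ → refl) (suc i) ⟨
      ((line x b P.- C x) ⊡ ev n q (line x b)) (suc i) ≈⟨ factor (line x b) (suc i) ⟨
      ev (suc n) p (line x b) (suc i) ≈⟨ v (suc i) (s≤s l) ⟩
      0# ∎
    there : ∀ {u} → ¬ (x ≈ proj₁ u) × VanishesAt (suc n) p u → VanishesAt n q u
    there {y , m} (x≠y , c , nc , w) = c , nc , λ i l →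
      cancel-unit i (line y c P.- C x) _
        (λ e → x≠y (sym (trans (sym (line-0 y c)) (minus-zero _ _ e))))
        (λ j j≤i → trans (sym (factor (line y c) j)) (w j (ℕₚ.≤-<-trans j≤i l)))
      where
      minus-zero : ∀ a b → a - b ≈ 0# → a ≈ b
      minus-zero a b e = trans (IntegerSolver.solve R 2 (λ a b → a ≔ (a ⊖ b) ⊕ b) refl a b) (trans (+-congʳ e) (+-identityˡ b))
        where open IntegerSolver R using () renaming (_:=_ to _≔_; _:-_ to _⊖_; _:+_ to _⊕_)

-- Binomial coefficients modulo a prime and the Frobenius map.

absorption : ∀ n k → suc k *ℕ (suc n choose suc k) ≡ suc n *ℕ (n choose k)
absorption zero zero = ≡refl
absorption zero (suc k) = ≡trans (≡cong (suc (suc k) *ℕ_) (k>n⇒nCk≡0 {1} {suc (suc k)} (s≤s (s≤s z≤n))))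
  (≡trans (ℕₚ.*-zeroʳ (suc (suc k))) (≡sym (≡cong (1 *ℕ_) (k>n⇒nCk≡0 {0} {suc k} (s≤s z≤n)))))
absorption (suc n) zero = begin
  1 *ℕ (suc (suc n) choose 1) ≡⟨ ≡cong (1 *ℕ_) (≡sym (nCk+nC[k+1]≡[n+1]C[k+1] (suc n) 0)) ⟩
  1 *ℕ ((suc n choose 0) +ℕ (suc n choose 1)) ≡⟨ ℕₚ.*-distribˡ-+ 1 (suc n choose 0) _ ⟩
  1 *ℕ (suc n choose 0) +ℕ 1 *ℕ (suc n choose 1) ≡⟨ ≡cong₂ _+ℕ_ (ℕₚ.*-identityˡ (suc n choose 0)) (absorption n 0) ⟩
  (suc n choose 0) +ℕ suc n *ℕ (n choose 0) ≡⟨⟩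
  suc (suc n) *ℕ (suc n choose 0) ∎
  where open Relation.Binary.PropositionalEquality.≡-Reasoning
absorption (suc n) (suc k) = begin
  suc (suc k) *ℕ (suc (suc n) choose suc (suc k)) ≡⟨ ≡cong (suc (suc k) *ℕ_) (≡sym (nCk+nC[k+1]≡[n+1]C[k+1] (suc n) (suc k))) ⟩
  suc (suc k) *ℕ (c +ℕ (suc n choose suc (suc k))) ≡⟨ ℕₚ.*-distribˡ-+ (suc (suc k)) c _ ⟩
  (c +ℕ suc k *ℕ c) +ℕ suc (suc k) *ℕ (suc n choose suc (suc k)) ≡⟨ ≡cong₂ (λ a b → (c +ℕ a) +ℕ b) (absorption n k) (absorption n (suc k)) ⟩
  (c +ℕ suc n *ℕ (n choose k)) +ℕ suc n *ℕ (n choose suc k) ≡⟨ ℕₚ.+-assoc c _ _ ⟩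
  c +ℕ (suc n *ℕ (n choose k) +ℕ suc n *ℕ (n choose suc k)) ≡⟨ ≡cong (c +ℕ_) (≡sym (ℕₚ.*-distribˡ-+ (suc n) (n choose k) _)) ⟩
  c +ℕ suc n *ℕ ((n choose k) +ℕ (n choose suc k)) ≡⟨ ≡cong (λ a → c +ℕ suc n *ℕ a) (nCk+nC[k+1]≡[n+1]C[k+1] n k) ⟩
  c +ℕ suc n *ℕ c ∎
  where open Relation.Binary.PropositionalEquality.≡-Reasoning
        c = suc n choose suc k

-- By `absorption` the prime divides k + 1 times the binomial coefficient, and it is too large to
-- divide k + 1.
prime∣C : ∀ {p} → Prime (suc p) → ∀ k → k < p → suc p Div.∣ (suc p choose suc k)
prime∣C {p} pp k k<p with euclidsLemma (suc k) (suc p choose suc k) pp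
                            (Div.divides (p choose k) (≡trans (absorption p k) (ℕₚ.*-comm (suc p) _)))
... | inj₁ d = ⊥-elim (ℕₚ.<⇒≱ (s≤s k<p) (Div.∣⇒≤ d))
... | inj₂ d = d

module Frobenius (A : CommutativeRing 0ℓ 0ℓ) where
  open CommutativeRing A hiding (zero)
  open Algebra.Properties.CommutativeSemiring.Exp commutativeSemiring
  open Algebra.Properties.Semiring.Mult semiring using (×-homo-+; ×-assoc-*; ×-congʳ; ×-homo-1; ×-assocˡ) renaming (_×_ to _×′_)
  open Algebra.Properties.Semiring.Sum semiring using (sum; sum-cong-≋; sum-init-last; sum-replicate-zero)
  module Bin = Algebra.Properties.CommutativeSemiring.Binomial commutativeSemiring
  open Relation.Binary.Reasoning.Setoid setoid

  ×-zero : ∀ {p} → p ×′ 1# ≈ 0# → ∀ m x → p Div.∣ m → m ×′ x ≈ 0#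
  ×-zero {p} char m x (Div.divides d e) = begin
    m ×′ x ≡⟨ ≡cong (_×′ x) (≡trans e (ℕₚ.*-comm d p)) ⟩
    (p *ℕ d) ×′ x ≈⟨ ×-assocˡ x p d ⟨
    p ×′ (d ×′ x) ≈⟨ ×-congʳ p (*-identityˡ _) ⟨
    p ×′ (1# * (d ×′ x)) ≈⟨ ×-assoc-* p 1# _ ⟨
    (p ×′ 1#) * (d ×′ x) ≈⟨ *-congʳ char ⟩
    0# * (d ×′ x) ≈⟨ zeroˡ _ ⟩
    0# ∎

  ^p-+ : ∀ {p} → Prime p → p ×′ 1# ≈ 0# → ∀ x y → (x + y) ^ p ≈ x ^ p + y ^ p
  ^p-+ {zero} () char x y
  ^p-+ {suc p} pp char x y = begin
    (x + y) ^ suc p ≈⟨ Bin.theorem (suc p) x y ⟩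
    t Fin.zero + sum (λ i → t (Fin.suc i)) ≈⟨ +-congˡ (sum-init-last {p} (λ i → t (Fin.suc i))) ⟩
    t Fin.zero + (sum (λ i → t (Fin.suc (Fin.inject₁ i))) + t (Fin.suc (Fin.fromℕ p)))
      ≈⟨ +-cong first (+-cong (trans (sum-cong-≋ middle) (sum-replicate-zero p)) final) ⟩
    y ^ suc p + (0# + x ^ suc p) ≈⟨ +-comm _ _ ⟩
    (0# + x ^ suc p) + y ^ suc p ≈⟨ +-congʳ (+-identityˡ _) ⟩
    x ^ suc p + y ^ suc p ∎
    where
    t = Bin.binomialTerm x y (suc p)
    first : t Fin.zero ≈ y ^ suc p
    first = trans (×-homo-1 _) (*-identityˡ _)
    middle : ∀ i → t (Fin.suc (Fin.inject₁ i)) ≈ 0#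
    middle i = ×-zero char _ _ (prime∣C pp (Fin.toℕ (Fin.inject₁ i))
      (≡subst (_< p) (≡sym (Finₚ.toℕ-inject₁ i)) (Finₚ.toℕ<n i)))
    final : t (Fin.suc (Fin.fromℕ p)) ≈ x ^ suc p
    final = begin
      (suc p choose suc (Fin.toℕ (Fin.fromℕ p))) ×′ (x ^ suc (Fin.toℕ (Fin.fromℕ p)) * y ^ (p ∸ℕ Fin.toℕ (Fin.fromℕ p)))
        ≡⟨ ≡cong (λ k → (suc p choose suc k) ×′ (x ^ suc k * y ^ (p ∸ℕ k))) (Finₚ.toℕ-fromℕ p) ⟩
      (suc p choose suc p) ×′ (x ^ suc p * y ^ (p ∸ℕ p))
        ≡⟨ ≡cong₂ (λ k l → k ×′ (x ^ suc p * y ^ l)) (nCn≡1 (suc p)) (ℕₚ.n∸n≡0 p) ⟩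
      1 ×′ (x ^ suc p * 1#) ≈⟨ trans (×-homo-1 _) (*-identityʳ _) ⟩
      x ^ suc p ∎

  ^q-+ : ∀ {p} → Prime p → p ×′ 1# ≈ 0# → ∀ k x y → (x + y) ^ (p ^ℕ k) ≈ x ^ (p ^ℕ k) + y ^ (p ^ℕ k)
  ^q-+ pp char zero x y = trans (*-identityʳ _) (sym (+-cong (*-identityʳ x) (*-identityʳ y)))
  ^q-+ {p} pp char (suc k) x y = begin
    (x + y) ^ (p *ℕ p ^ℕ k) ≈⟨ ^-assocʳ (x + y) p (p ^ℕ k) ⟨
    ((x + y) ^ p) ^ (p ^ℕ k) ≈⟨ ^-congˡ (p ^ℕ k) (^p-+ pp char x y) ⟩
    (x ^ p + y ^ p) ^ (p ^ℕ k) ≈⟨ ^q-+ pp char k (x ^ p) (y ^ p) ⟩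
    (x ^ p) ^ (p ^ℕ k) + (y ^ p) ^ (p ^ℕ k) ≈⟨ +-cong (^-assocʳ x p (p ^ℕ k)) (^-assocʳ y p (p ^ℕ k)) ⟩
    x ^ (p *ℕ p ^ℕ k) + y ^ (p *ℕ p ^ℕ k) ∎

-- Finite fields of odd order: Fermat's identity and Euler's criterion.

affirm : ∀ {A : Set} (a? : Dec A) → does a? ≡ true → A
affirm (yes a) _ = a

refute : ∀ {A : Set} (a? : Dec A) → does a? ≡ false → ¬ A
refute (no n) _ = n

by-cases : ∀ {A B : Set} → Dec A → (A → B) → (¬ A → B) → B
by-cases (yes a) f g = f a
by-cases (no n)  f g = g n

odd-prime-power : ∀ {p} → Prime p → p ≢ 2 → ∀ k → ∃ λ n → p ^ℕ k ≡ suc (n +ℕ n)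
odd-prime-power {p} pp p≢2 k with (p ^ℕ k) % 2 | m≡m%n+[m/n]*n (p ^ℕ k) 2 | m%n<n (p ^ℕ k) 2
... | 1 | e | _ = (p ^ℕ k) / 2 , ≡trans e (≡cong suc (≡trans (ℕₚ.*-comm ((p ^ℕ k) / 2) 2) (≡cong ((p ^ℕ k) / 2 +ℕ_) (ℕₚ.+-identityʳ _))))
... | 0 | e | _ = ⊥-elim (2∤p (2∣p k (Div.divides ((p ^ℕ k) / 2) e)))
  where
  prime[2] : Prime 2
  prime[2] = Data.Nat.Primality.prime[2]
  2∤p : ¬ (2 Div.∣ p)
  2∤p d with Data.Nat.Primality.prime⇒irreducible pp d
  ... | inj₂ e = p≢2 (≡sym e)
  2∣p : ∀ k → 2 Div.∣ p ^ℕ k → 2 Div.∣ p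
  2∣p zero d with Div.∣⇒≤ d
  ... | s≤s ()
  2∣p (suc k) d with euclidsLemma p (p ^ℕ k) prime[2] d
  ... | inj₁ d′ = d′
  ... | inj₂ d′ = 2∣p k d′
... | suc (suc _) | _ | s≤s (s≤s ())

module FiniteFieldFacts (K : FiniteField) where
  open FiniteField K public
  open Relation.Binary.PropositionalEquality.≡-Reasoning

  KR : CommutativeRing 0ℓ 0ℓ
  KR = record { isCommutativeRing = isCommutativeRing }

  module F = CommutativeRing KR
  open F public using (_-_)
  open Algebra.Properties.CommutativeSemiring.Exp F.commutativeSemiring public
    using (_^_; ^-homo-*; ^-assocʳ; ^-distrib-*; ^-congˡ)

  cancelˡ : ∀ {x y} → x ≢ 0# → x * y ≡ 0# → y ≡ 0#
  cancelˡ {x} {y} x≢0 e = let x⁻¹ , inv = inverse x x≢0 in begin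
    y ≡⟨ F.*-identityˡ y ⟨
    1# * y ≡⟨ ≡cong (_* y) (≡trans (≡sym inv) (F.*-comm x x⁻¹)) ⟩
    x⁻¹ * x * y ≡⟨ F.*-assoc _ _ _ ⟩
    x⁻¹ * (x * y) ≡⟨ ≡cong (x⁻¹ *_) e ⟩
    x⁻¹ * 0# ≡⟨ F.zeroʳ _ ⟩
    0# ∎

  domain : Domain KR
  domain = record { stable = λ {x} {y} → decidable-stable (x ≟ y) ; cancel = cancelˡ }

  open PowerSeries KR public hiding (ring-of-series)
  PR : CommutativeRing 0ℓ 0ℓ
  PR = PowerSeries.ring-of-series KR
  open Quotient KR public
  open Roots KR domain public
  module Ser = Evaluation KR PR (C-hom KR)
  open IntegerSolver KR

  index : Carrier → Fin size
  index = Inverse.to enum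

  elt-index : ∀ x → elt K (index x) ≡ x
  elt-index = Inverse.strictlyInverseʳ enum

  elt-injective : ∀ {i j} → elt K i ≡ elt K j → i ≡ j
  elt-injective {i} {j} e = ≡trans (≡sym (Inverse.strictlyInverseˡ enum i))
    (≡trans (≡cong index e) (Inverse.strictlyInverseˡ enum j))

  infix 8 _⁻¹⟨_⟩
  _⁻¹⟨_⟩ : ∀ x → x ≢ 0# → Carrier
  x ⁻¹⟨ n ⟩ = proj₁ (inverse x n)

  inverse-unique : ∀ {x y} → x - y ≡ 0# → x ≡ y
  inverse-unique {x} {y} e = ≡trans (solve 2 (λ x y → x := (x :- y) :+ y) ≡refl x y) (≡trans (≡cong (_+ y) e) (F.+-identityˡ y))

  cancel-≡ : ∀ {x y z} → x ≢ 0# → x * y ≡ x * z → y ≡ z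
  cancel-≡ {x} {y} {z} n e = inverse-unique (cancelˡ n (begin
    x * (y - z) ≡⟨ solve 3 (λ x y z → x :* (y :- z) := x :* y :- x :* z) ≡refl x y z ⟩
    x * y - x * z ≡⟨ ≡cong (_- (x * z)) e ⟩
    x * z - x * z ≡⟨ F.-‿inverseʳ _ ⟩
    0# ∎))

  *-nonzero : ∀ {x y} → x ≢ 0# → y ≢ 0# → x * y ≢ 0#
  *-nonzero nx ny e = ny (cancelˡ nx e)

  select : ∀ {m} → (Fin m → Bool) → List (Fin m)
  select {zero} b = []
  select {suc m} b = if b Fin.zero then Fin.zero ∷ map Fin.suc (select (b ∘ Fin.suc)) else map Fin.suc (select (b ∘ Fin.suc))

  length-select : ∀ {m} (b : Fin m → Bool) → length (select b) ≡ count K b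
  length-select {zero} b = ≡refl
  length-select {suc m} b with b Fin.zero
  ... | true  = ≡cong suc (≡trans (Listₚ.length-map Fin.suc (select (b ∘ Fin.suc))) (length-select (b ∘ Fin.suc)))
  ... | false = ≡trans (Listₚ.length-map Fin.suc (select (b ∘ Fin.suc))) (length-select (b ∘ Fin.suc))

  select-sound : ∀ {m} (b : Fin m → Bool) → All (λ i → b i ≡ true) (select b)
  select-sound {zero} b = []
  select-sound {suc m} b with b Fin.zero in e
  ... | true  = e ∷ Allₚ.map⁺ (select-sound (b ∘ Fin.suc))
  ... | false = Allₚ.map⁺ (select-sound (b ∘ Fin.suc))

  select-distinct : ∀ {m} (b : Fin m → Bool) → AllPairs _≢_ (select b)
  select-distinct {zero} b = []
  select-distinct {suc m} b with b Fin.zero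
  ... | true  = Allₚ.map⁺ (All.universal (λ i ()) _) ∷ AllPairsₚ.map⁺ (AllPairs.map (λ n e → n (Finₚ.suc-injective e)) (select-distinct (b ∘ Fin.suc)))
  ... | false = AllPairsₚ.map⁺ (AllPairs.map (λ n e → n (Finₚ.suc-injective e)) (select-distinct (b ∘ Fin.suc)))

  few-roots : ∀ n p → Bd n p → (b : Fin size → Bool) → ∀ ℓ →
    (∀ i → b i ≡ true → VanishesAt n p (elt K i , ℓ)) → n ≤ count K b *ℕ ℓ → p ≋ (λ _ → 0#)
  few-roots n p bd b ℓ v l = few-zeros n p bd (map pt (select b))
    (AllPairsₚ.map⁺ (AllPairs.map (λ n e → n (elt-injective e)) (select-distinct b)))
    (Allₚ.map⁺ (All.map (λ {i} → v i) (select-sound b)))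
    (≡subst (n ≤_) (≡trans (≡cong (_*ℕ ℓ) (≡sym (length-select b))) (≡sym (total-map (select b)))) l)
    where
    pt = λ i → elt K i , ℓ
    total-map : ∀ is → total (map pt is) ≡ length is *ℕ ℓ
    total-map [] = ≡refl
    total-map (i ∷ is) = ≡cong (ℓ +ℕ_) (total-map is)

  simple-zero : ∀ n p x → Id.ev n p x ≡ 0# → VanishesAt n p (x , 1)
  simple-zero n p x e = 1# , (λ e → 0≢1 (≡sym e)) , λ { zero (s≤s z≤n) → ≡trans (ev-line-0 n p x 1#) e }

  count-all : ∀ m → count K {m} (λ _ → true) ≡ m
  count-all zero = ≡refl
  count-all (suc m) = ≡cong suc (count-all m)

  vanishing-everywhere : ∀ n p → Bd n p → n ≤ size → (∀ x → Id.ev n p x ≡ 0#) → p ≋ (λ _ → 0#)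
  vanishing-everywhere n p bd l e = few-roots n p bd (λ _ → true) 1 (λ i _ → simple-zero n p _ (e _))
    (≡subst (n ≤_) (≡sym (≡trans (ℕₚ.*-identityʳ _) (count-all size))) l)

  private
    module Sum = Algebra.Properties.Semiring.Sum F.semiring
    module Prod = Algebra.Properties.CommutativeMonoid.Sum F.*-commutativeMonoid
  open Algebra.Properties.Semiring.Mult F.semiring public using (×1-homo-*) renaming (_×_ to _×′_)

  reindex : (f g : Carrier → Carrier) → (∀ x → f (g x) ≡ x) → (∀ x → g (f x) ≡ x) → Permutation size size
  reindex f g fg gf = permutation (λ i → index (f (elt K i))) (λ i → index (g (elt K i))) (inv f g fg) (inv g f gf)
    where
    inv : ∀ f g → (∀ x → f (g x) ≡ x) → ∀ i → index (f (elt K (index (g (elt K i))))) ≡ i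
    inv f g fg i = ≡trans (≡cong (index ∘ f) (elt-index _)) (≡trans (≡cong index (fg _)) (Inverse.strictlyInverseˡ enum i))

  -- Translation by 1 permutes the field, so it leaves the sum of all elements unchanged.
  size×1 : size ×′ 1# ≡ 0#
  size×1 = begin
    size ×′ 1# ≡⟨ solve 2 (λ a b → b := (a :+ b) :- a) ≡refl s _ ⟩
    (s + size ×′ 1#) - s ≡⟨ ≡cong (_- s) (≡sym shifted) ⟩
    s - s ≡⟨ F.-‿inverseʳ s ⟩
    0# ∎
    where
    s = Sum.sum (elt K)
    shifted : s ≡ s + size ×′ 1#
    shifted = begin
      s ≡⟨ Sum.sum-permute (elt K) (reindex (_+ 1#) (_- 1#)
             (λ x → solve 2 (λ x y → (x :- y) :+ y := x) ≡refl x 1#) (λ x → solve 2 (λ x y → (x :+ y) :- y := x) ≡refl x 1#)) ⟩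
      Sum.sum (λ i → elt K (index (elt K i + 1#))) ≡⟨ Sum.sum-cong-≋ (λ i → elt-index (elt K i + 1#)) ⟩
      Sum.sum (λ i → elt K i + 1#) ≡⟨ Sum.∑-distrib-+ (elt K) (λ _ → 1#) ⟩
      s + Sum.sum {size} (λ _ → 1#) ≡⟨ ≡cong (s +_) (Sum.sum-replicate size {1#}) ⟩
      s + size ×′ 1# ∎

  private
    -- Replacing 0 by 1 makes the product over the whole field nonzero, so products can be indexed
    -- by all of `Fin size`.
    φ : Carrier → Carrier
    φ x = if does (x ≟ 0#) then 1# else x

    φ≢0 : ∀ x → φ x ≢ 0#
    φ≢0 x with x ≟ 0#
    ... | yes _ = λ e → 0≢1 (≡sym e)
    ... | no n  = n

    ∏≢0 : ∀ {m} (f : Fin m → Carrier) → (∀ i → f i ≢ 0#) → Prod.sum f ≢ 0#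
    ∏≢0 {zero} f n e = 0≢1 (≡sym e)
    ∏≢0 {suc m} f n = *-nonzero (n Fin.zero) (∏≢0 (f ∘ Fin.suc) (n ∘ Fin.suc))

    δ : ∀ {m} → Fin m → Carrier → Fin m → Carrier
    δ j a i = if does (i Fin.≟ j) then a else 1#

    ∏δ : ∀ {m} (j : Fin m) a → Prod.sum (δ j a) ≡ a
    ∏δ {suc m} Fin.zero a = ≡trans (≡cong (a *_) (≡trans (Prod.sum-replicate m {1#}) (one-pow m))) (F.*-identityʳ a)
      where
      one-pow : ∀ m → 1# ^ m ≡ 1#
      one-pow zero = ≡refl
      one-pow (suc m) = ≡trans (F.*-identityˡ _) (one-pow m)
    ∏δ {suc m} (Fin.suc j) a = ≡trans (F.*-identityˡ _) (∏δ j a)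

  -- For x ≠ 0 the map y ↦ x y permutes the field, and x · φ y = φ (x y) except at y = 0, where a
  -- factor x is left over. The product over all y therefore gives x^size = x and not x^(size - 1) =
  -- 1.
  x^size≡x : ∀ x → x ^ size ≡ x
  x^size≡x x with x ≟ 0#
  ... | yes ≡refl = zero-pow size (index 0#)
    where
    zero-pow : ∀ m → Fin m → 0# ^ m ≡ 0#
    zero-pow (suc m) _ = F.zeroˡ _
  ... | no x≢0 = cancel-≡ (∏≢0 (φ ∘ elt K) (λ i → φ≢0 _)) (begin
    Φ * x ^ size ≡⟨ F.*-comm _ _ ⟩
    x ^ size * Φ ≡⟨ ≡cong (_* Φ) (Prod.sum-replicate size {x}) ⟨
    Prod.sum {size} (λ _ → x) * Φ ≡⟨ Prod.∑-distrib-+ {size} (λ _ → x) (φ ∘ elt K) ⟨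
    Prod.sum (λ i → x * φ (elt K i)) ≡⟨ Prod.sum-cong-≋ pointwise ⟩
    Prod.sum (λ i → δ (index 0#) x i * φ (x * elt K i)) ≡⟨ Prod.∑-distrib-+ (δ (index 0#) x) (λ i → φ (x * elt K i)) ⟩
    Prod.sum (δ (index 0#) x) * Prod.sum (λ i → φ (x * elt K i)) ≡⟨ ≡cong₂ _*_ (∏δ (index 0#) x) (≡sym scaled) ⟩
    x * Φ ≡⟨ F.*-comm _ _ ⟩
    Φ * x ∎)
    where
    Φ = Prod.sum (φ ∘ elt K)
    x⁻¹ = x ⁻¹⟨ x≢0 ⟩
    x*x⁻¹ : x * x⁻¹ ≡ 1#
    x*x⁻¹ = proj₂ (inverse x x≢0)
    scaled : Φ ≡ Prod.sum (λ i → φ (x * elt K i))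
    scaled = ≡trans (Prod.sum-permute (φ ∘ elt K) (reindex (x *_) (x⁻¹ *_)
        (λ y → ≡trans (≡sym (F.*-assoc _ _ _)) (≡trans (≡cong (_* y) x*x⁻¹) (F.*-identityˡ y)))
        (λ y → ≡trans (≡sym (F.*-assoc _ _ _)) (≡trans (≡cong (_* y) (≡trans (F.*-comm _ _) x*x⁻¹)) (F.*-identityˡ y)))))
      (Prod.sum-cong-≋ (λ i → ≡cong φ (elt-index (x * elt K i))))
    pointwise : ∀ i → x * φ (elt K i) ≡ δ (index 0#) x i * φ (x * elt K i)
    pointwise i with i Fin.≟ index 0#
    ... | yes ≡refl rewrite elt-index 0# | F.zeroʳ x | dec-true (0# ≟ 0#) ≡refl = ≡refl
    ... | no i≢ rewrite dec-false (elt K i ≟ 0#) (λ e → i≢ (elt-injective (≡trans e (≡sym (elt-index 0#)))))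
                      | dec-false ((x * elt K i) ≟ 0#) (*-nonzero x≢0 (λ e → i≢ (elt-injective (≡trans e (≡sym (elt-index 0#))))))
                = ≡sym (F.*-identityˡ _)

module OddField (K : FiniteField) (odd : OddPrimePower (FiniteField.size K)) where
  open FiniteFieldFacts K public
  open IntegerSolver KR
  open Relation.Binary.PropositionalEquality.≡-Reasoning
  open Algebra.Properties.Ring F.ring using (-0#≈0#; -1*x≈-x)
  module P = CommutativeRing PR
  module PE = Algebra.Properties.CommutativeSemiring.Exp P.commutativeSemiring
  private
    module PM = Algebra.Properties.Semiring.Mult P.semiring
    p k : ℕ
    p = proj₁ odd
    k = proj₁ (proj₂ odd)
    prime-p : Prime p
    prime-p = proj₁ (proj₂ (proj₂ odd))
    size≡ : size ≡ p ^ℕ k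
    size≡ = proj₂ (proj₂ (proj₂ (proj₂ (proj₂ odd))))
    half,e = odd-prime-power prime-p (proj₁ (proj₂ (proj₂ (proj₂ odd)))) k

    p^×1 : ∀ k → (p ^ℕ k) ×′ 1# ≡ (p ×′ 1#) ^ k
    p^×1 zero = F.+-identityʳ 1#
    p^×1 (suc k) = ≡trans (×1-homo-* p (p ^ℕ k)) (≡cong ((p ×′ 1#) *_) (p^×1 k))

    nilpotent : ∀ k {x} → x ^ k ≡ 0# → x ≡ 0#
    nilpotent zero e = ⊥-elim (0≢1 (≡sym e))
    nilpotent (suc k) {x} e = decidable-stable (x ≟ 0#) (λ n → n (nilpotent k (cancelˡ n e)))

    -- Since size = p^k, the vanishing of size × 1 says that p × 1 is nilpotent.
    p×1 : p ×′ 1# ≡ 0#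
    p×1 = nilpotent k (≡trans (≡sym (p^×1 k)) (≡trans (≡cong (_×′ 1#) (≡sym size≡)) size×1))

    p×C1 : ∀ m → m PM.× C 1# ≋ C (m ×′ 1#)
    p×C1 zero i = ≡sym (C-0 i)
    p×C1 (suc m) = P.trans (P.+-congˡ (p×C1 m)) (P.sym (C-+ 1# (m ×′ 1#)))

  half : ℕ
  half = proj₁ half,e

  size-odd : size ≡ suc (half +ℕ half)
  size-odd = ≡trans size≡ (proj₂ half,e)

  2≢0 : 1# + 1# ≢ 0#
  2≢0 e = 0≢1 (begin
    0# ≡⟨ size×1 ⟨
    size ×′ 1# ≡⟨ ≡cong (_×′ 1#) size-odd ⟩
    1# + (half +ℕ half) ×′ 1# ≡⟨ ≡cong (1# +_) (even half) ⟩
    1# + 0# ≡⟨ F.+-identityʳ 1# ⟩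
    1# ∎)
    where
    even : ∀ m → (m +ℕ m) ×′ 1# ≡ 0#
    even zero = ≡refl
    even (suc m) = begin
      1# + (m +ℕ suc m) ×′ 1# ≡⟨ ≡cong (λ l → 1# + l ×′ 1#) (ℕₚ.+-suc m m) ⟩
      1# + (1# + (m +ℕ m) ×′ 1#) ≡⟨ F.+-assoc _ _ _ ⟨
      (1# + 1#) + (m +ℕ m) ×′ 1# ≡⟨ ≡cong₂ _+_ e (even m) ⟩
      0# + 0# ≡⟨ F.+-identityʳ 0# ⟩
      0# ∎

  C-^ : ∀ c m → C c PE.^ m ≋ C (c ^ m)
  C-^ c zero = P.refl
  C-^ c (suc m) = P.trans (P.*-congˡ (C-^ c m)) (P.sym (C-* c (c ^ m)))

  Z^-⊡-low : ∀ m p → Z PE.^ m ⊡ p ≡[ m ] (λ _ → 0#)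
  Z^-⊡-low (suc m) p zero l = ≡trans (P.*-assoc Z (Z PE.^ m) p 0) (Z-⊡-zero (Z PE.^ m ⊡ p))
  Z^-⊡-low (suc m) p (suc i) (s≤s l) = ≡trans (P.*-assoc Z (Z PE.^ m) p (suc i)) (≡trans (Z-⊡ _ i) (Z^-⊡-low m p i l))

  frobenius : ∀ a b → (a ⊞ b) PE.^ size ≋ a PE.^ size ⊞ b PE.^ size
  frobenius a b = ≡subst (λ q → (a ⊞ b) PE.^ q ≋ a PE.^ q ⊞ b PE.^ q) (≡sym size≡)
    (Frobenius.^q-+ PR prime-p (P.trans (p×C1 p) (P.trans (C-cong p×1) C-0)) k a b)

  -- Frobenius fixes constants of the field and sends Z w to a multiple of Z^q, so a q-th power is
  -- constant up to order q. This is what makes Y and h^q constant near a point.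
  frobenius-line : ∀ c w → (C c ⊞ Z ⊡ w) PE.^ size ≡[ size ] C c
  frobenius-line c w i l = begin
    ((C c ⊞ Z ⊡ w) PE.^ size) i ≡⟨ frobenius (C c) (Z ⊡ w) i ⟩
    (C c PE.^ size) i + ((Z ⊡ w) PE.^ size) i
      ≡⟨ ≡cong₂ _+_ (≡trans (C-^ c size i) (C-cong (x^size≡x c) i)) (≡trans (PE.^-distrib-* Z w size i) (Z^-⊡-low size _ i l)) ⟩
    C c i + 0# ≡⟨ F.+-identityʳ _ ⟩
    C c i ∎

  x^2half : ∀ {x} → x ≢ 0# → x ^ (half +ℕ half) ≡ 1#
  x^2half {x} n = cancel-≡ n (≡trans (≡trans (≡cong (x ^_) (≡sym size-odd)) (x^size≡x x)) (≡sym (F.*-identityʳ x)))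

  x^half : ∀ {x} → x ≢ 0# → x ^ half ≢ 1# → x ^ half ≡ - 1#
  x^half {x} n e = inverse-unique (≡trans (solve 2 (λ y o → y :- (:- o) := y :+ o) ≡refl y 1#)
    (cancelˡ (λ z → e (inverse-unique z)) (begin
      (y - 1#) * (y + 1#) ≡⟨ solve 2 (λ y o → (y :- o) :* (y :+ o) := y :* y :- o :* o) ≡refl y 1# ⟩
      y * y - 1# * 1# ≡⟨ ≡cong₂ _-_ (≡trans (≡sym (^-homo-* x half half)) (x^2half n)) (F.*-identityˡ 1#) ⟩
      1# - 1# ≡⟨ F.-‿inverseʳ _ ⟩
      0# ∎)))
    where y = x ^ half

  square-criterion : ∀ {x} → x ≢ 0# → IsSquare K x → x ^ half ≡ 1#
  square-criterion {x} n (z , ≡refl) = ≡trans (^-distrib-* z z half) (≡trans (≡sym (^-homo-* z half half)) (x^2half nz))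
    where
    nz : z ≢ 0#
    nz e = n (≡trans (≡cong (_* z) e) (F.zeroˡ z))

  private
    -- The polynomial q(X²).
    spread : Series → Series
    spread q zero = q 0
    spread q (suc zero) = 0#
    spread q (suc (suc i)) = spread (tail q) i

    Bd-spread : ∀ n q → Bd n q → Bd (n +ℕ n) (spread q)
    Bd-spread n q b zero l with n
    ... | zero = b 0 z≤n
    Bd-spread n q b (suc zero) l = ≡refl
    Bd-spread zero q b (suc (suc i)) l = Bd-spread zero (tail q) (λ j _ → b (suc j) z≤n) i z≤n
    Bd-spread (suc n) q b (suc (suc i)) (s≤s l) =
      Bd-spread n (tail q) (Bd-tail b) i (ℕₚ.≤-pred (≡subst (_≤ suc i) (ℕₚ.+-suc n n) l))

    spread-zero : ∀ q → spread q ≋ (λ _ → 0#) → q ≋ (λ _ → 0#)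
    spread-zero q e zero = e 0
    spread-zero q e (suc i) = spread-zero (tail q) (λ j → e (suc (suc j))) i

    ev-spread : ∀ n q z → Id.ev (n +ℕ n) (spread q) z ≡ Id.ev n q (z * z)
    ev-spread zero q z = ≡refl
    ev-spread (suc n) q z = begin
      q 0 + z * Id.ev (n +ℕ suc n) (tail (spread q)) z ≡⟨ ≡cong (λ m → q 0 + z * Id.ev m (tail (spread q)) z) (ℕₚ.+-suc n n) ⟩
      q 0 + z * (0# + z * Id.ev (n +ℕ n) (spread (tail q)) z) ≡⟨ ≡cong (λ v → q 0 + z * (0# + z * v)) (ev-spread n (tail q) z) ⟩
      q 0 + z * (0# + z * e) ≡⟨ ≡cong (λ v → q 0 + z * v) (F.+-identityˡ _) ⟩
      q 0 + z * (z * e) ≡⟨ ≡cong (q 0 +_) (F.*-assoc z z e) ⟨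
      q 0 + z * z * e ∎
      where e = Id.ev n (tail q) (z * z)

    monomial : ℕ → Series
    monomial zero = C 1#
    monomial (suc m) = constant 0# (monomial m)

    Bd-monomial : ∀ m → Bd (suc m) (monomial m)
    Bd-monomial zero = Bd-C 1#
    Bd-monomial (suc m) (suc i) (s≤s l) = Bd-monomial m i l

    ev-monomial : ∀ m x → Id.ev (suc m) (monomial m) x ≡ x ^ m
    ev-monomial zero x = ≡trans (≡cong (1# +_) (F.zeroʳ x)) (F.+-identityʳ 1#)
    ev-monomial (suc m) x = ≡trans (F.+-identityˡ _) (≡cong (x *_) (ev-monomial m x))

    monomial-≢0 : ∀ m → monomial m m ≡ 1#
    monomial-≢0 zero = ≡refl
    monomial-≢0 (suc m) = monomial-≢0 m

  -- If x were a nonsquare root of X ^ half - 1, the quotient q by X - x would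
  -- vanish at every nonzero square, and z * q (z * z) would have size many roots.
  nonsquare-criterion : ∀ {x} → ¬ IsSquare K x → x ^ half ≡ - 1#
  nonsquare-criterion {x} ns = x^half x≢0 not-one
    where
    x≢0 : x ≢ 0#
    x≢0 ≡refl = ns (0# , F.zeroˡ 0#)
    not-one : x ^ half ≢ 1#
    not-one e with half in he
    -- Here half = 0 would mean a field with one element.
    ... | zero = ⊥-elim (few-elements (≡trans size-odd (≡cong (λ h → suc (h +ℕ h)) he)))
      where
      few-elements : size ≢ 1
      few-elements s = 0≢1 (≡trans (≡sym (elt-index 0#)) (≡trans (≡cong (elt K) (unique s (index 0#) (index 1#))) (elt-index 1#)))
        where
        unique : ∀ {n} → n ≡ 1 → (i j : Fin n) → i ≡ j
        unique ≡refl Fin.zero Fin.zero = ≡refl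
    ... | suc h = 0≢1 (≡trans (≡sym (f≋0 (suc h))) (≡trans (≡cong₂ _+_ (monomial-≢0 h) -0#≈0#) (F.+-identityʳ 1#)))
      where
      f : Series
      f = monomial (suc h) ⊞ (λ i → - C 1# i)
      q : Series
      q = quotient (suc h) f x
      Bd-f : Bd (suc (suc h)) f
      Bd-f = Bd-+ (Bd-monomial (suc h)) (Bd-neg {p = C 1#} (Bd-C 1#))
      ev-f : ∀ z → Id.ev (suc (suc h)) f z ≡ z ^ suc h - 1#
      ev-f z = ≡trans (Id.ev-+ (suc (suc h)) (monomial (suc h)) (λ i → - C 1# i) z) (≡cong₂ _+_ (ev-monomial (suc h) z)
        (≡trans (Id.ev-cong (suc (suc h)) {q = λ i → (- 1#) * C 1# i} (λ i → ≡sym (-1*x≈-x (C 1# i))) ≡refl)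
          (≡trans (Id.ev-scale (suc (suc h)) (- 1#) (C 1#) z) (≡trans (≡cong ((- 1#) *_) (Id.ev-C (suc h) 1# z)) (F.*-identityʳ _)))))
      root : Id.ev (suc (suc h)) f x ≡ 0#
      root = ≡trans (ev-f x) (≡trans (≡cong (_- 1#) e) (F.-‿inverseʳ 1#))
      q-square : ∀ z → z ≢ 0# → Id.ev (suc h) q (z * z) ≡ 0#
      q-square z nz = cancelˡ {z * z - x} (λ d → ns (z , inverse-unique d)) (begin
        (z * z - x) * Id.ev (suc h) q (z * z) ≡⟨ F.+-identityˡ _ ⟨
        0# + (z * z - x) * Id.ev (suc h) q (z * z) ≡⟨ ≡cong (_+ (z * z - x) * Id.ev (suc h) q (z * z)) root ⟨
        Id.ev (suc (suc h)) f x + (z * z - x) * Id.ev (suc h) q (z * z) ≡⟨ ev-quotient KR (id-hom KR) (suc h) f x (z * z) ⟨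
        Id.ev (suc (suc h)) f (z * z) ≡⟨ ev-f (z * z) ⟩
        (z * z) ^ suc h - 1# ≡⟨ ≡cong (_- 1#) (≡trans (≡cong ((z * z) ^_) (≡sym he)) (square-criterion (*-nonzero nz nz) (z , ≡refl))) ⟩
        1# - 1# ≡⟨ F.-‿inverseʳ 1# ⟩
        0# ∎)
      m = suc h +ℕ suc h
      g : Series
      g = constant 0# (spread q)
      g≋0 : g ≋ (λ _ → 0#)
      g≋0 = vanishing-everywhere (suc m) g
        (λ { (suc i) (s≤s l) → Bd-spread (suc h) q (Bd-quotient (suc h) f x) i l })
        (ℕₚ.≤-reflexive (≡sym (≡trans size-odd (≡cong (λ h → suc (h +ℕ h)) he))))
        λ z → ≡trans (F.+-identityˡ _) (≡trans (≡cong (z *_) (ev-spread (suc h) q z)) (at z))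
        where
        at : ∀ z → z * Id.ev (suc h) q (z * z) ≡ 0#
        at z with z ≟ 0#
        ... | yes ≡refl = F.zeroˡ _
        ... | no nz = ≡trans (≡cong (z *_) (q-square z nz)) (F.zeroʳ z)
      f≋0 : f ≋ (λ _ → 0#)
      f≋0 = quotient-zero (suc h) f x Bd-f root (spread-zero q (λ i → g≋0 (suc i)))

-- Polynomial dependence on a point or parameter, and Siegel's lemma.

module PolynomialFunctions (K : FiniteField) where
  open FiniteFieldFacts K
  open IntegerSolver KR
  open Relation.Binary.PropositionalEquality.≡-Reasoning
  private module P = CommutativeRing PR

  Pol : ℕ → (Carrier → Carrier) → Set
  Pol D φ = Σ Series λ p → Bd (suc D) p × ∀ x → Id.ev (suc D) p x ≡ φ x

  Pol-cong : ∀ {D φ ψ} → (∀ x → φ x ≡ ψ x) → Pol D φ → Pol D ψ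
  Pol-cong e (p , b , f) = p , b , λ x → ≡trans (f x) (e x)

  Pol-mono : ∀ {D E φ} → D ≤ E → Pol D φ → Pol E φ
  Pol-mono l (p , b , f) = p , Bd-mono (s≤s l) b , λ x → ≡trans (Id.ev-stable x b (s≤s l)) (f x)

  Pol-const : ∀ {D} c → Pol D (λ _ → c)
  Pol-const {D} c = C c , Bd-C c , λ x → Id.ev-C D c x

  Pol-id : ∀ {D} → Pol (suc D) (λ x → x)
  Pol-id {D} = Z , Bd-Z , λ x → Id.ev-Z D x

  Pol-+ : ∀ {D φ ψ} → Pol D φ → Pol D ψ → Pol D (λ x → φ x + ψ x)
  Pol-+ {D} (p , b , f) (q , c , g) = p ⊞ q , Bd-+ b c , λ x → ≡trans (Id.ev-+ (suc D) p q x) (≡cong₂ _+_ (f x) (g x))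

  Pol-* : ∀ {D E φ ψ} → Pol D φ → Pol E ψ → Pol (D +ℕ E) (λ x → φ x * ψ x)
  Pol-* {D} {E} (p , b , f) (q , c , g) = p ⊡ q , Bd-* {suc D} b c , λ x →
    ≡trans (Id.ev-unique x (Bd-* {suc D} b c) (Bd-*′ {suc D} b c) (λ _ → ≡refl))
           (≡trans (Id.ev-* {suc D} x b c) (≡cong₂ _*_ (f x) (g x)))

  Pol-zero : ∀ {D φ} → Pol D φ → (b : Fin size → Bool) → (∀ i → b i ≡ true → φ (elt K i) ≡ 0#) →
    D < count K b → ∀ x → φ x ≡ 0#
  Pol-zero {D} (p , bd , f) b z l x = ≡trans (≡sym (f x)) (Id.ev-zero (suc D) x
    (few-roots (suc D) p bd b 1 (λ i e → simple-zero (suc D) p _ (≡trans (f _) (z i e)))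
      (≡subst (D <_) (≡sym (ℕₚ.*-identityʳ _)) l)))

  -- The degree allowed for the coefficient of Z^k grows by μ with each power of Z. This grading is
  -- compatible with products, the offsets e adding up, so series with offset 0 are closed under
  -- multiplication.
  PolS : ℕ → ℕ → (Carrier → Series) → Set
  PolS μ e Θ = ∀ k → Pol (e +ℕ k *ℕ μ) (λ x → Θ x k)

  PolS-mono : ∀ {μ e e′ Θ} → e ≤ e′ → PolS μ e Θ → PolS μ e′ Θ
  PolS-mono l p k = Pol-mono (ℕₚ.+-monoˡ-≤ _ l) (p k)

  PolS-C : ∀ {μ e φ} → Pol e φ → PolS μ e (λ x → C (φ x))
  PolS-C p zero    = Pol-mono (ℕₚ.≤-reflexive (≡sym (ℕₚ.+-identityʳ _))) p
  PolS-C p (suc k) = Pol-const 0#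

  PolS-+ : ∀ {μ e Θ Ψ} → PolS μ e Θ → PolS μ e Ψ → PolS μ e (λ x → Θ x ⊞ Ψ x)
  PolS-+ p q k = Pol-+ (p k) (q k)

  private
    tail-degree : ∀ e μ k → e +ℕ suc k *ℕ μ ≡ (e +ℕ μ) +ℕ k *ℕ μ
    tail-degree = solve-∀
    degree-0 : ∀ e e′ μ → (e +ℕ 0 *ℕ μ) +ℕ (e′ +ℕ 0 *ℕ μ) ≡ (e +ℕ e′) +ℕ 0 *ℕ μ
    degree-0 = solve-∀
    degree-head : ∀ e e′ μ k → (e +ℕ 0 *ℕ μ) +ℕ (e′ +ℕ k *ℕ μ) ≡ (e +ℕ e′) +ℕ k *ℕ μ
    degree-head = solve-∀
    degree-tail : ∀ e e′ μ k → (e +ℕ μ +ℕ e′) +ℕ k *ℕ μ ≡ (e +ℕ e′) +ℕ suc k *ℕ μ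
    degree-tail = solve-∀

  PolS-tail : ∀ {μ e Θ} → PolS μ e Θ → PolS μ (e +ℕ μ) (λ x → tail (Θ x))
  PolS-tail p k = Pol-mono (ℕₚ.≤-reflexive (tail-degree _ _ k)) (p (suc k))

  PolS-* : ∀ {μ e e′ Θ Ψ} → PolS μ e Θ → PolS μ e′ Ψ → PolS μ (e +ℕ e′) (λ x → Θ x ⊡ Ψ x)
  PolS-* {μ} {e} {e′} p q zero = Pol-mono (ℕₚ.≤-reflexive (degree-0 e e′ μ)) (Pol-* (p 0) (q 0))
  PolS-* {μ} {e} {e′} p q (suc k) = Pol-+
    (Pol-mono (ℕₚ.≤-reflexive (degree-head e e′ μ (suc k))) (Pol-* (p 0) (q (suc k))))
    (Pol-mono (ℕₚ.≤-reflexive (degree-tail e e′ μ k)) (PolS-* {μ} {e +ℕ μ} {e′} (PolS-tail p) q k))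

  PolS-Z : ∀ {μ e e′ Θ} → e ≤ e′ +ℕ μ → PolS μ e Θ → PolS μ e′ (λ x → Z ⊡ Θ x)
  PolS-Z {Θ = Θ} l p zero = Pol-cong (λ x → ≡sym (Z-⊡-zero (Θ x))) (Pol-const 0#)
  PolS-Z {μ} {e} {e′} {Θ} l p (suc k) = Pol-cong (λ x → ≡sym (Z-⊡ (Θ x) k))
    (Pol-mono (ℕₚ.≤-trans (ℕₚ.+-monoˡ-≤ (k *ℕ μ) l) (ℕₚ.≤-reflexive (≡sym (tail-degree e′ μ k)))) (p k))

  PolS-line : ∀ {μ β} {x b : Carrier → Carrier} → Pol β x → Pol μ b → PolS μ β (λ τ → line (x τ) (b τ))
  PolS-line {μ} {β} {x} {b} px pb = PolS-+ (PolS-C px) (λ k → Pol-mono (ℕₚ.m≤n+m _ β) (linear k))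
    where
    linear : ∀ k → Pol (k *ℕ μ) (λ τ → (C (b τ) ⊡ Z) k)
    linear zero = Pol-cong (λ τ → ≡sym (F.zeroʳ (b τ))) (Pol-const 0#)
    linear (suc zero) = Pol-mono (ℕₚ.≤-reflexive (≡sym (ℕₚ.+-identityʳ μ)))
      (Pol-cong (λ τ → ≡sym (≡trans (C-⊡ (b τ) Z 1) (F.*-identityʳ _))) pb)
    linear (suc (suc k)) = Pol-cong (λ τ → ≡sym (≡trans (C-⊡ (b τ) Z (suc (suc k))) (F.zeroʳ _))) (Pol-const 0#)

  -- For b = h(x) this is h(x + b Z) / b: in h(x + b Z) = b + b Z d, with d the divided difference,
  -- the factor b can be taken out without dividing.
  expansion : ℕ → Series → Carrier → Carrier → Series
  expansion n h x b = C 1# ⊞ Z ⊡ Ser.difference n h (C x) (C b ⊡ Z)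

  ev-C-C : ∀ n h x → Ser.ev n h (C x) ≋ C (Id.ev n h x)
  ev-C-C zero h x = P.sym C-0
  ev-C-C (suc n) h x = P.trans (P.+-congˡ {C (h 0)} (P.*-congˡ {C x} (ev-C-C n (tail h) x)))
    (P.sym (P.trans (C-+ (h 0) _) (P.+-congˡ {C (h 0)} (C-* x _))))

  ev-expansion : ∀ n h x → Ser.ev n h (line x (Id.ev n h x)) ≋ C (Id.ev n h x) ⊡ expansion n h x (Id.ev n h x)
  ev-expansion n h x = P.trans (Ser.ev-difference n h (C x) (C b ⊡ Z)) (P.trans (P.+-congʳ (ev-C-C n h x))
    (P.trans (P.+-cong (P.sym (P.*-identityʳ (C b))) (P.*-assoc (C b) Z d)) (P.sym (P.distribˡ (C b) (C 1#) (Z ⊡ d)))))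
    where
    b = Id.ev n h x
    d = Ser.difference n h (C x) (C b ⊡ Z)

  -- Used twice: in Stepanov's method h is fixed and the point x varies (α = 0, β = 1); for pairs of
  -- rows the point is fixed and h varies with t (β = 0).
  module Family {α β μ : ℕ} {x b : Carrier → Carrier} (px : Pol β x) (pb : Pol μ b) where

    PolS-ev : ∀ n {h : Carrier → Series} → (∀ i → Pol α (λ τ → h τ i)) →
      PolS μ (α +ℕ n *ℕ β) (λ τ → Ser.ev n (h τ) (line (x τ) (b τ)))
    PolS-ev zero ph k = Pol-const 0#
    PolS-ev (suc n) {h} ph = PolS-+ (PolS-mono (ℕₚ.m≤m+n α _) (PolS-C (ph 0)))
      (PolS-mono (ℕₚ.≤-reflexive (lemma α β (n *ℕ β)))
        (PolS-* {μ} {β} {α +ℕ n *ℕ β} (PolS-line px pb) (PolS-ev n (λ i → ph (suc i)))))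
      where
      lemma : ∀ α β γ → β +ℕ (α +ℕ γ) ≡ α +ℕ (β +ℕ γ)
      lemma = solve-∀

    PolS-difference : ∀ n {h : Carrier → Series} → (∀ i → Pol α (λ τ → h τ i)) →
      PolS μ (α +ℕ n *ℕ β) (λ τ → Ser.difference (suc n) (h τ) (C (x τ)) (C (b τ) ⊡ Z))
    PolS-difference zero {h} ph k = Pol-cong (λ τ → ≡sym (≡trans (F.+-identityʳ _) (P.zeroʳ (C (x τ)) k))) (Pol-const 0#)
    PolS-difference (suc n) {h} ph = PolS-+
      (PolS-mono (ℕₚ.≤-reflexive (lemma α β (n *ℕ β)))
        (PolS-* {μ} {β} {α +ℕ n *ℕ β} (PolS-C px) (PolS-difference n (λ i → ph (suc i)))))
      (PolS-ev (suc n) (λ i → ph (suc i)))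
      where
      lemma : ∀ α β γ → β +ℕ (α +ℕ γ) ≡ α +ℕ (β +ℕ γ)
      lemma = solve-∀

    -- The factor Z in front of the divided difference is worth μ in the grading, which absorbs its
    -- offset α + m β and leaves offset 0.
    PolS-expansion : ∀ m {h : Carrier → Series} → (∀ i → Pol α (λ τ → h τ i)) → α +ℕ m *ℕ β ≤ μ →
      PolS μ 0 (λ τ → expansion (suc m) (h τ) (x τ) (b τ))
    PolS-expansion m ph l = PolS-+ (PolS-C (Pol-const 1#)) (PolS-Z l (PolS-difference m ph))

  module LinearFamily (N : ℕ) where
    Parameters : Set
    Parameters = Fin N → Carrier

    infixl 6 _⊟_
    _⊟_ : Parameters → Parameters → Parameters
    (u ⊟ v) i = u i - v i

    -- Linearity in the parameters is recorded as compatibility with differences, which is the form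
    -- in which the pigeonhole argument of `siegel` consumes it.
    LPol : ℕ → (Parameters → Carrier → Carrier) → Set
    LPol D φ = Σ (Parameters → Series) λ L → (∀ u → Bd (suc D) (L u)) × (∀ u v → L (u ⊟ v) ≋ L u P.- L v) ×
      (∀ u x → Id.ev (suc D) (L u) x ≡ φ u x)

    LPol-cong : ∀ {D φ ψ} → (∀ u x → φ u x ≡ ψ u x) → LPol D φ → LPol D ψ
    LPol-cong e (L , b , a , f) = L , b , a , λ u x → ≡trans (f u x) (e u x)

    LPol-mono : ∀ {D E φ} → D ≤ E → LPol D φ → LPol E φ
    LPol-mono l (L , b , a , f) = L , (λ u → Bd-mono (s≤s l) (b u)) , a ,
      λ u x → ≡trans (Id.ev-stable x (b u) (s≤s l)) (f u x)

    LPol-0 : ∀ {D} → LPol D (λ _ _ → 0#)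
    LPol-0 {D} = (λ _ _ → 0#) , (λ _ _ _ → ≡refl) , (λ _ _ _ → ≡sym (F.-‿inverseʳ 0#)) , λ u x → Id.ev-zero (suc D) x (λ _ → ≡refl)

    LPol-coordinate : ∀ {D} i → LPol D (λ u _ → u i)
    LPol-coordinate {D} i = (λ u → C (u i)) , (λ u → Bd-C (u i)) ,
      (λ { u v zero → ≡refl ; u v (suc _) → ≡sym (F.-‿inverseʳ 0#) }) , λ u x → Id.ev-C D (u i) x

    LPol-+ : ∀ {D φ ψ} → LPol D φ → LPol D ψ → LPol D (λ u x → φ u x + ψ u x)
    LPol-+ {D} (L , b , a , f) (M , c , d , g) = (λ u → L u ⊞ M u) , (λ u → Bd-+ (b u) (c u)) ,
      (λ u v i → ≡trans (≡cong₂ _+_ (a u v i) (d u v i))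
        (solve 4 (λ x y z w → (x :- y) :+ (z :- w) := (x :+ z) :- (y :+ w)) ≡refl (L u i) (L v i) (M u i) (M v i))) ,
      λ u x → ≡trans (Id.ev-+ (suc D) (L u) (M u) x) (≡cong₂ _+_ (f u x) (g u x))

    LPol-* : ∀ {D E φ ψ} → LPol D φ → Pol E ψ → LPol (D +ℕ E) (λ u x → φ u x * ψ x)
    LPol-* {D} {E} (L , b , a , f) (q , c , g) = (λ u → L u ⊡ q) , (λ u → Bd-* {suc D} (b u) c) ,
      (λ u v → P.trans (P.*-congʳ (a u v))
        (PS.solve 3 (λ x y z → (x PS.:- y) PS.:* z PS.:= x PS.:* z PS.:- y PS.:* z) P.refl (L u) (L v) q)) ,
      λ u x → ≡trans (Id.ev-unique x (Bd-* {suc D} (b u) c) (Bd-*′ {suc D} (b u) c) (λ _ → ≡refl))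
           (≡trans (Id.ev-* {suc D} x (b u) c) (≡cong₂ _*_ (f u x) (g x)))
      where module PS = IntegerSolver PR

    LPolS : ℕ → ℕ → (Parameters → Carrier → Series) → Set
    LPolS μ e Θ = ∀ k → LPol (e +ℕ k *ℕ μ) (λ u x → Θ u x k)

    LPolS-mono : ∀ {μ e e′ Θ} → e ≤ e′ → LPolS μ e Θ → LPolS μ e′ Θ
    LPolS-mono l p k = LPol-mono (ℕₚ.+-monoˡ-≤ _ l) (p k)

    LPolS-C : ∀ {μ e φ} → LPol e φ → LPolS μ e (λ u x → C (φ u x))
    LPolS-C p zero    = LPol-mono (ℕₚ.≤-reflexive (≡sym (ℕₚ.+-identityʳ _))) p
    LPolS-C p (suc k) = LPol-0

    LPolS-+ : ∀ {μ e Θ Ψ} → LPolS μ e Θ → LPolS μ e Ψ → LPolS μ e (λ u x → Θ u x ⊞ Ψ u x)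
    LPolS-+ p q k = LPol-+ (p k) (q k)

    LPolS-* : ∀ {μ e e′ Θ Ψ} → LPolS μ e Θ → PolS μ e′ Ψ → LPolS μ (e +ℕ e′) (λ u x → Θ u x ⊡ Ψ x)
    LPolS-* {μ} {e} {e′} p q zero = LPol-mono (ℕₚ.≤-reflexive (degree-0 e e′ μ)) (LPol-* (p 0) (q 0))
    LPolS-* {μ} {e} {e′} p q (suc k) = LPol-+
      (LPol-mono (ℕₚ.≤-reflexive (degree-head e e′ μ (suc k))) (LPol-* (p 0) (q (suc k))))
      (LPol-mono (ℕₚ.≤-reflexive (degree-tail e e′ μ k))
        (LPolS-* {μ} {e +ℕ μ} {e′} (λ j → LPol-mono (ℕₚ.≤-reflexive (tail-degree e μ j)) (p (suc j))) q k))

    2≤size : 2 ≤ size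
    2≤size with 2 ℕₚ.≤? size
    ... | yes l = l
    ... | no n = ⊥-elim (0≢1 (≡trans (≡sym (elt-index 0#)) (≡trans (≡cong (elt K) (unique n (index 0#) (index 1#))) (elt-index 1#))))
      where
      unique : ∀ {n} → ¬ (2 ≤ n) → (i j : Fin n) → i ≡ j
      unique {suc zero} _ Fin.zero Fin.zero = ≡refl
      unique {suc (suc n)} l = ⊥-elim (l (s≤s (s≤s z≤n)))

    -- Fewer linear conditions than parameters: two of the size ^ N parameter
    -- vectors satisfy the same conditions, and their difference is a solution.
    siegel : ∀ ℓ D (Φ : ℕ → Parameters → Carrier → Carrier) → (∀ k → k < ℓ → LPol D (Φ k)) → ℓ *ℕ suc D < N →
      ∃ λ u → (∃ λ i → u i ≢ 0#) × ∀ k → k < ℓ → ∀ x → Φ k u x ≡ 0#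
    siegel ℓ D Φ lin l = u₁ ⊟ u₂ , (proj₁ differ , nonzero) , zeros
      where
      L : Fin ℓ → Parameters → Series
      L k = proj₁ (lin (Fin.toℕ k) (Finₚ.toℕ<n k))
      param : Fin (size ^ℕ N) → Parameters
      param j i = elt K (Fin.finToFun j i)
      cond : Parameters → Fin ℓ → Fin (suc D) → Fin size
      cond u k d = index (L k u (Fin.toℕ d))
      code : Fin (size ^ℕ N) → Fin (size ^ℕ (ℓ *ℕ suc D))
      code j = Fin.funToFin (λ c → cond (param j) (proj₁ (Fin.remQuot {ℓ} (suc D) c)) (proj₂ (Fin.remQuot {ℓ} (suc D) c)))
      collision : ∃₂ λ i j → i Fin.< j × code i ≡ code j
      collision = Finₚ.pigeonhole (ℕₚ.^-monoʳ-< size 2≤size l) code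
      j₁ = proj₁ collision
      j₂ = proj₁ (proj₂ collision)
      u₁ = param j₁
      u₂ = param j₂
      differ : ∃ λ i → Fin.finToFun j₁ i ≢ Fin.finToFun j₂ i
      differ = Finₚ.¬∀⟶∃¬ N _ (λ i → Fin.finToFun {size} {N} j₁ i Fin.≟ Fin.finToFun j₂ i) λ same →
        Finₚ.<⇒≢ (proj₁ (proj₂ (proj₂ collision)))
          (≡trans (≡sym (Finₚ.funToFin-finToFin {N} {size} j₁)) (≡trans (funToFin-cong same) (Finₚ.funToFin-finToFin {N} {size} j₂)))
        where
        funToFin-cong : ∀ {m n} {f g : Fin m → Fin n} → (∀ i → f i ≡ g i) → Fin.funToFin f ≡ Fin.funToFin g
        funToFin-cong {zero} e = ≡refl
        funToFin-cong {suc m} e = ≡cong₂ Fin.combine (e Fin.zero) (funToFin-cong (λ i → e (Fin.suc i)))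
      nonzero : (u₁ ⊟ u₂) (proj₁ differ) ≢ 0#
      nonzero e = proj₂ differ (elt-injective (inverse-unique e))
      same-cond : ∀ k d → cond u₁ k d ≡ cond u₂ k d
      same-cond k d = ≡subst (λ c → cond u₁ (proj₁ c) (proj₂ c) ≡ cond u₂ (proj₁ c) (proj₂ c)) (Finₚ.remQuot-combine k d)
        (≡trans (≡sym (Finₚ.finToFun-funToFin _ (Fin.combine k d)))
          (≡trans (≡cong (λ c → Fin.finToFun c (Fin.combine k d)) (proj₂ (proj₂ (proj₂ collision))))
            (Finₚ.finToFun-funToFin _ (Fin.combine k d))))
      zeros : ∀ k → k < ℓ → ∀ x → Φ k (u₁ ⊟ u₂) x ≡ 0#
      zeros k k<ℓ x = ≡trans (≡sym (proj₂ (proj₂ (proj₂ (lin k k<ℓ))) (u₁ ⊟ u₂) x)) (Id.ev-zero (suc D) x coefficient)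
        where
        L′ = proj₁ (lin k k<ℓ)
        L≡ : ∀ {k′} (e : k′ ≡ k) (l : k′ < ℓ) u i → proj₁ (lin k′ l) u i ≡ L′ u i
        L≡ ≡refl l u i = ≡cong (λ l → proj₁ (lin k l) u i) (ℕₚ.<-irrelevant l k<ℓ)
        agree : ∀ d → L′ u₁ (Fin.toℕ {suc D} d) ≡ L′ u₂ (Fin.toℕ d)
        agree d = ≡trans (≡sym (at u₁)) (≡trans (≡trans (≡sym (elt-index _)) (≡trans (≡cong (elt K) (same-cond (Fin.fromℕ< k<ℓ) d)) (elt-index _))) (at u₂))
          where
          at : ∀ u → L (Fin.fromℕ< k<ℓ) u (Fin.toℕ d) ≡ L′ u (Fin.toℕ d)
          at u = L≡ (Finₚ.toℕ-fromℕ< k<ℓ) _ u (Fin.toℕ d)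
        coefficient : L′ (u₁ ⊟ u₂) ≋ (λ _ → 0#)
        coefficient i with i ℕₚ.<? suc D
        ... | no i≮ = proj₁ (proj₂ (lin k k<ℓ)) _ i (ℕₚ.≮⇒≥ i≮)
        ... | yes i< = ≡trans (proj₁ (proj₂ (proj₂ (lin k k<ℓ))) u₁ u₂ i)
          (≡trans (≡cong (_- L′ u₂ i) (≡subst (λ j → L′ u₁ j ≡ L′ u₂ j) (Finₚ.toℕ-fromℕ< i<) (agree (Fin.fromℕ< i<)))) (F.-‿inverseʳ _))

-- Ring identities.

module Identities (R : CommutativeRing 0ℓ 0ℓ) where
  open CommutativeRing R hiding (zero)
  open IntegerSolver R

  -- For h = 1/2 this is the error after a Newton step in which 1/s is replaced by 1. When E and s
  -- have constant term 1, the second factor on the right has constant term 0, so the order of the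
  -- error rises by one.
  newton : ∀ E s h → h + h ≈ 1# →
    E - (s + h * (E - s * s)) * (s + h * (E - s * s)) ≈ (E - s * s) * ((1# - s) - h * h * (E - s * s))
  newton E s h e = trans
    (solve 3 (λ E s h → E :- (s :+ h :* (E :- s :* s)) :* (s :+ h :* (E :- s :* s)) :=
      (E :- s :* s) :* ((con (1 , 0) :- (h :+ h) :* s) :- h :* h :* (E :- s :* s))) refl E s h)
    (*-congˡ (+-congʳ (+-cong one (-‿cong (trans (*-congʳ e) (*-identityˡ s))))))
    where
    one : (1# + 0#) - 0# ≈ 1#
    one = trans (+-congˡ -0#≈0#) (trans (+-identityʳ _) (+-identityʳ 1#))
      where open Algebra.Properties.Ring ring using (-0#≈0#)

  -- With g = h^((q-1)/2) the last term contains h g² = h^q, which is congruent to a constant b up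
  -- to order q. A congruence r + s g ≡ 0 thus turns into r² h ≡ b s², in which g no longer occurs.
  stepanov-factor : ∀ r s g h b → r * r * h + (- b) * (s * s) ≈
    ((r - s * g) * h) * (r + s * g) + (s * s) * (h * (g * g) - b)
  stepanov-factor = solve 5 (λ r s g h b → r :* r :* h :+ (:- b) :* (s :* s) :=
    ((r :- s :* g) :* h) :* (r :+ s :* g) :+ (s :* s) :* (h :* (g :* g) :- b)) refl

  neg-* : ∀ p q → (- p) * q ≈ - (p * q)
  neg-* = solve 2 (λ p q → (:- p) :* q := :- (p :* q)) refl

  *-distrib-minus : ∀ p q r → p * (q - r) ≈ p * q - p * r
  *-distrib-minus = solve 3 (λ p q r → p :* (q :- r) := p :* q :- p :* r) refl

  regroup-division : ∀ b q r t → (b * q + r) + b * t ≈ b * (t + q) + r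
  regroup-division = solve 4 (λ b q r t → (b :* q :+ r) :+ b :* t := b :* (t :+ q) :+ r) refl

  swap : ∀ c p w → c * (p * w) ≈ p * (c * w)
  swap = solve 3 (λ c p w → c :* (p :* w) := p :* (c :* w)) refl

  minus-plusˡ : ∀ r a → r ≈ (a + r) - a
  minus-plusˡ = solve 2 (λ r a → r := (a :+ r) :- a) refl

  distribute : ∀ p u a v → (p - u * a) * v ≈ p * v - (u * v) * a
  distribute = solve 4 (λ p u a v → (p :- u :* a) :* v := p :* v :- (u :* v) :* a) refl

  collect : ∀ p v w a → p * v - (p * w) * a ≈ p * (v - w * a)
  collect = solve 4 (λ p v w a → p :* v :- (p :* w) :* a := p :* (v :- w :* a)) refl

  distributeʳ : ∀ u p a v → (u - p * a) * v ≈ u * v - p * (a * v)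
  distributeʳ = solve 4 (λ u p a v → (u :- p :* a) :* v := u :* v :- p :* (a :* v)) refl

  cancel-φ : ∀ o p φ u → (o * (p * φ)) * (u * u) ≈ p * ((o * φ) * (u * u))
  cancel-φ = solve 4 (λ o p φ u → (o :* (p :* φ)) :* (u :* u) := p :* ((o :* φ) :* (u :* u))) refl

  cancel-u : ∀ o φ p u → (o * φ) * ((p * u) * (p * u)) ≈ p * ((o * (φ * p)) * (u * u))
  cancel-u = solve 4 (λ o φ p u → (o :* φ) :* ((p :* u) :* (p :* u)) := p :* ((o :* (φ :* p)) :* (u :* u))) refl

  absorb-square′ : ∀ o φ p u → (o * φ) * ((p * u) * (p * u)) ≈ ((o * (p * p)) * φ) * (u * u)
  absorb-square′ = solve 4 (λ o φ p u → (o :* φ) :* ((p :* u) :* (p :* u)) := ((o :* (p :* p)) :* φ) :* (u :* u)) refl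

  rotate-factors : ∀ a b f → a * (b * f) ≈ (b * a) * f
  rotate-factors = solve 3 (λ a b f → a :* (b :* f) := (b :* a) :* f) refl

  neg-square : ∀ x → (- x) * (- x) ≈ x * x
  neg-square = solve 1 (λ x → (:- x) :* (:- x) := x :* x) refl

  absorb-constant : ∀ c o φ w → c * ((o * φ) * w) ≈ (o * (c * φ)) * w
  absorb-constant = solve 4 (λ c o φ w → c :* ((o :* φ) :* w) := (o :* (c :* φ)) :* w) refl

  absorb-square : ∀ o φ p u → (o * φ) * ((p * u) * (p * u)) ≈ (o * (φ * (p * p))) * (u * u)
  absorb-square = solve 4 (λ o φ p u → (o :* φ) :* ((p :* u) :* (p :* u)) := (o :* (φ :* (p :* p))) :* (u :* u)) refl

  difference-of-squares : ∀ a b → (a - b) * (a + b) ≈ a * a - b * b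
  difference-of-squares = solve 2 (λ a b → (a :- b) :* (a :+ b) := a :* a :- b :* b) refl

  rotate : ∀ b r E → b * (r * r * E) ≈ r * r * (b * E)
  rotate = solve 3 (λ b r E → b :* (r :* r :* E) := r :* r :* (b :* E)) refl

  square-of-product : ∀ r s → (r * s) * (r * s) ≈ r * r * (s * s)
  square-of-product = solve 2 (λ r s → (r :* s) :* (r :* s) := r :* r :* (s :* s)) refl

  minus-plus : ∀ a b → a ≈ (a + b) - b
  minus-plus = solve 2 (λ a b → a := (a :+ b) :- b) refl

  plus-minus : ∀ a b → a ≈ (a - b) + b
  plus-minus = solve 2 (λ a b → a := (a :- b) :+ b) refl

  conjugate : ∀ s r u σ → (s - r * u) * σ ≈ s * σ - u * (r * σ)
  conjugate = solve 4 (λ s r u σ → (s :- r :* u) :* σ := s :* σ :- u :* (r :* σ)) refl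

  fourfold : ∀ z r v σ → (z * (r * v)) * σ ≈ z * (r * v * σ)
  fourfold = solve 4 (λ z r v σ → (z :* (r :* v)) :* σ := z :* (r :* v :* σ)) refl

  factor-low : ∀ r u z v → r * (u + z * v) - r * u ≈ z * (r * v)
  factor-low = solve 4 (λ r u z v → r :* (u :+ z :* v) :- r :* u := z :* (r :* v)) refl

-- Stepanov's method and its parameters.

module SeriesFacts (K : FiniteField) (odd : OddPrimePower (FiniteField.size K)) where
  open OddField K odd public
  open PolynomialFunctions K public
  open SeriesDomain KR domain public
  module I = Identities PR
  module R = Relation.Binary.Reasoning.Setoid P.setoid

  Zero : Series → Set
  Zero p = p ≋ (λ _ → 0#)

  trunc-ideal : ∀ n p {q} → q ≡[ n ] (λ _ → 0#) → p ⊡ q ≡[ n ] (λ _ → 0#)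
  trunc-ideal n p {q} e i l = ≡trans (trunc-* n {p} {p} {q} (λ _ _ → ≡refl) e i l) (P.zeroʳ p i)

  Z^-⊡-high : ∀ m p i → (Z PE.^ m ⊡ p) (m +ℕ i) ≡ p i
  Z^-⊡-high zero p i = ⊡-identityˡ p i
  Z^-⊡-high (suc m) p i = ≡trans (P.*-assoc Z (Z PE.^ m) p (suc (m +ℕ i))) (≡trans (Z-⊡ _ (m +ℕ i)) (Z^-⊡-high m p i))

  Bd-^ : ∀ {a p} → Bd (suc a) p → ∀ k → Bd (suc (k *ℕ a)) (p PE.^ k)
  Bd-^ b zero = Bd-C 1#
  Bd-^ {a} b (suc k) = Bd-* {suc a} {k *ℕ a} b (Bd-^ b k)

  -- Hides the length given to Horner's scheme, so that values of sums, products and powers compose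
  -- without comparing lengths at each step.
  Val : Series → Series → Series → Set
  Val β p v = ∃ λ n → Bd n p × Ser.ev n p β ≋ v

  Val-ev : ∀ {β p v n} → Val β p v → Bd n p → Ser.ev n p β ≋ v
  Val-ev {β} (m , b , e) c = P.trans (Ser.ev-unique β c b (λ _ → ≡refl)) e

  Val-cong : ∀ {β p v w} → v ≋ w → Val β p v → Val β p w
  Val-cong e (n , b , f) = n , b , P.trans f e

  Val-C : ∀ {β} c → Val β (C c) (C c)
  Val-C {β} c = 1 , Bd-C c , Ser.ev-C 0 c β

  Val-Z : ∀ {β} → Val β Z β
  Val-Z {β} = 2 , Bd-Z , Ser.ev-Z 0 β

  Val-+ : ∀ {β p q v w} → Val β p v → Val β q w → Val β (p ⊞ q) (v ⊞ w)
  Val-+ {β} {p} {q} (m , b , e) (n , c , f) = m +ℕ n , Bd-+ b′ c′ ,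
    P.trans (Ser.ev-+ (m +ℕ n) p q β) (P.+-cong (P.trans (Ser.ev-unique β b′ b (λ _ → ≡refl)) e) (P.trans (Ser.ev-unique β c′ c (λ _ → ≡refl)) f))
    where
    b′ : Bd (m +ℕ n) p
    b′ = Bd-mono (ℕₚ.m≤m+n m n) b
    c′ : Bd (m +ℕ n) q
    c′ = Bd-mono (ℕₚ.m≤n+m n m) c

  Val-* : ∀ {β p q v w} → Val β p v → Val β q w → Val β (p ⊡ q) (v ⊡ w)
  Val-* {β} (m , b , e) (n , c , f) = m +ℕ n , Bd-*′ {m} b c , P.trans (Ser.ev-* {m} β b c) (P.*-cong e f)

  Val-^ : ∀ {β p v} → Val β p v → ∀ k → Val β (p PE.^ k) (v PE.^ k)
  Val-^ a zero = Val-C 1#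
  Val-^ a (suc k) = Val-* a (Val-^ a k)

  vanishing-polynomial : ∀ n p x → Bd n p → Ser.ev n p (line x 1#) ≡[ n ] (λ _ → 0#) → Zero p
  vanishing-polynomial n p x b v = few-zeros n p b ((x , n) ∷ []) ([] ∷ []) ((1# , (λ e → 0≢1 (≡sym e)) , v) ∷ [])
    (ℕₚ.≤-reflexive (≡sym (ℕₚ.+-identityʳ n)))

  poly : ∀ {c} → (Fin c → Carrier) → Series
  poly {zero} w = λ _ → 0#
  poly {suc c} w = constant (w Fin.zero) (poly (w ∘ Fin.suc))

  Bd-poly : ∀ {c} (w : Fin c → Carrier) → Bd c (poly w)
  Bd-poly {zero} w i l = ≡refl
  Bd-poly {suc c} w (suc i) (s≤s l) = Bd-poly (w ∘ Fin.suc) i l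

  poly-toℕ : ∀ {c} (w : Fin c → Carrier) i → poly w (Fin.toℕ i) ≡ w i
  poly-toℕ w Fin.zero = ≡refl
  poly-toℕ w (Fin.suc i) = poly-toℕ (w ∘ Fin.suc) i

  -- The exponent does not enter the degree bound. It will be (q-1)/2, and any dependence on it
  -- would ruin the count of linear conditions.
  PolS-^ : ∀ {μ Θ} → PolS μ 0 Θ → ∀ k → PolS μ 0 (λ x → Θ x PE.^ k)
  PolS-^ p zero = PolS-C (Pol-const 1#)
  PolS-^ p (suc k) = PolS-* {_} {0} {0} p (PolS-^ p k)

  -- h is not a constant multiple of the square of a rational function with
  -- numerator and denominator of length at most c.
  NonSquare : ℕ → Series → Carrier → Set
  NonSquare c h b = ∀ r s → Bd c r → Bd c s → r ⊡ r ⊡ h ≋ C b ⊡ (s ⊡ s) → Zero r × Zero s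

-- Stepanov's method. The auxiliary polynomial is a combination of the
-- (r j + s j g) Y ^ j with g = h ^ ((q-1)/2) and Y = X ^ q - x₀. Near a point x
-- with g x = a the factor Y is constant up to order q, and
-- g (x + h x Z) = a E ^ ((q-1)/2) for E = h (x + h x Z) / h x.
module Stepanov (K : FiniteField) (odd : OddPrimePower (FiniteField.size K)) where
  open SeriesFacts K odd

  module _ (m : ℕ) (h : Series) (Bd-h : Bd (suc m) h) (x₀ : Carrier) (c : ℕ) where
    private
      H : Carrier → Carrier
      H = Id.ev (suc m) h

      g Y : Series
      g = h PE.^ half
      Y = Z PE.^ size ⊞ C (- x₀)

    horner : (J : ℕ) → (Fin J → Series) → Series → Series
    horner zero ρ y = λ _ → 0#
    horner (suc J) ρ y = ρ Fin.zero ⊞ horner J (ρ ∘ Fin.suc) y ⊡ y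

    auxiliary : (J : ℕ) → (r s : Fin J → Series) → Series
    auxiliary J r s = horner J (λ j → r j ⊞ s j ⊡ g) Y

    private
      Bd-Y : Bd (suc size) Y
      Bd-Y = Bd-+ (≡subst (λ q → Bd (suc q) (Z PE.^ size)) (ℕₚ.*-identityʳ size) (Bd-^ Bd-Z size)) (Bd-C _)

      width : ℕ
      width = c +ℕ half *ℕ m

      Bd-term : ∀ {r s} → Bd c r → Bd c s → Bd width (r ⊞ s ⊡ g)
      Bd-term b d = Bd-+ (Bd-mono (ℕₚ.m≤m+n c _) b) (Bd-* {c} d (Bd-^ Bd-h half))

      Bd-horner : ∀ J {ρ} → (∀ j → Bd width (ρ j)) → Bd (width +ℕ J *ℕ size) (horner J ρ Y)
      Bd-horner zero b i l = ≡refl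
      Bd-horner (suc J) {ρ} b = Bd-+ (Bd-mono (ℕₚ.m≤m+n width _) (b Fin.zero))
        (Bd-mono (ℕₚ.≤-reflexive (lemma width size (J *ℕ size)))
          (Bd-* {width +ℕ J *ℕ size} {size} (Bd-horner J (λ j → b (Fin.suc j))) Bd-Y))
        where
        lemma : ∀ w q t → w +ℕ t +ℕ q ≡ w +ℕ (q +ℕ t)
        lemma = solve-∀

      Val-horner : ∀ {β y} J {ρ v : Fin J → Series} → Val β Y y → (∀ j → Val β (ρ j) (v j)) → Val β (horner J ρ Y) (horner J v y)
      Val-horner zero a b = 0 , (λ i l → ≡refl) , P.refl
      Val-horner (suc J) a b = Val-+ (b Fin.zero) (Val-* (Val-horner J a (λ j → b (Fin.suc j))) a)

      Val-Y : ∀ β → Val β Y (β PE.^ size ⊞ C (- x₀))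
      Val-Y β = Val-+ (Val-^ Val-Z size) (Val-C _)

      line-frobenius : ∀ x b → line x b PE.^ size ⊞ C (- x₀) ≡[ size ] C (x - x₀)
      line-frobenius x b i l = ≡trans (≡cong (_+ C (- x₀) i)
        (≡trans (PE.^-congˡ size (P.+-congˡ {C x} (P.*-comm (C b) Z)) i) (frobenius-line x (C b) i l)))
        (≡sym (C-+ x (- x₀) i))

      Y≢0 : ¬ Zero Y
      Y≢0 e = 0≢1 (≡trans (≡sym (e size)) (≡trans (≡cong₂ _+_ top (C-high size-pos)) (F.+-identityʳ 1#)))
        where
        size-pos : ∃ λ n → size ≡ suc n
        size-pos = half +ℕ half , size-odd
        C-high : (∃ λ n → size ≡ suc n) → C (- x₀) size ≡ 0#
        C-high (n , e) = ≡cong (C (- x₀)) e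
        top : (Z PE.^ size) size ≡ 1#
        top = ≡trans (≡sym (P.*-identityʳ (Z PE.^ size) size))
          (≡trans (≡cong (Z PE.^ size ⊡ C 1#) (≡sym (ℕₚ.+-identityʳ size))) (Z^-⊡-high size (C 1#) 0))

    -- At x₀ the factor Y vanishes to order q, so a vanishing combination forces r₀ + s₀ g ≡ 0
    -- there. By `stepanov-factor`, r₀² h - h(x₀) s₀² vanishes to order q; its length is at most 2 c
    -- + m ≤ q, so it is zero and `NonSquare` applies. The remaining terms carry a factor Y, which
    -- is cancelled before the next round.
    independence : NonSquare c h (H x₀) → c +ℕ c +ℕ m ≤ size →
      ∀ J r s → (∀ j → Bd c (r j)) → (∀ j → Bd c (s j)) → Zero (auxiliary J r s) → ∀ j → Zero (r j) × Zero (s j)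
    independence ns small zero r s br bs e ()
    independence ns small (suc J) r s br bs e = λ
      { Fin.zero → first ; (Fin.suc j) → independence ns small J (r ∘ Fin.suc) (s ∘ Fin.suc) (br ∘ Fin.suc) (bs ∘ Fin.suc) rest j }
      where
      r₀ = r Fin.zero
      s₀ = s Fin.zero
      β = line x₀ 1#
      b = H x₀
      R S Hβ G : Series
      R = Ser.ev c r₀ β
      S = Ser.ev c s₀ β
      Hβ = Ser.ev (suc m) h β
      G = Hβ PE.^ half
      Val-r : Val β r₀ R
      Val-r = c , br Fin.zero , P.refl
      Val-s : Val β s₀ S
      Val-s = c , bs Fin.zero , P.refl
      Val-h : Val β h Hβ
      Val-h = suc m , Bd-h , P.refl
      others : Series
      others = horner J (λ j → r (Fin.suc j) ⊞ s (Fin.suc j) ⊡ g) Y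
      Bd-others : Bd (width +ℕ J *ℕ size) others
      Bd-others = Bd-horner J (λ j → Bd-term (br (Fin.suc j)) (bs (Fin.suc j)))
      T : Series
      T = Ser.ev (width +ℕ J *ℕ size) others β
      total-value : Val β (auxiliary (suc J) r s) ((R ⊞ S ⊡ G) ⊞ T ⊡ (β PE.^ size ⊞ C (- x₀)))
      total-value = Val-+ (Val-+ Val-r (Val-* Val-s (Val-^ Val-h half)))
        (Val-* (width +ℕ J *ℕ size , Bd-others , P.refl) (Val-Y β))
      Y-low : β PE.^ size ⊞ C (- x₀) ≡[ size ] (λ _ → 0#)
      Y-low i l = ≡trans (line-frobenius x₀ 1# i l) (≡trans (C-cong (F.-‿inverseʳ x₀) i) (C-0 i))
      low : R ⊞ S ⊡ G ≡[ size ] (λ _ → 0#)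
      low i l = begin
        (R ⊞ S ⊡ G) i ≡⟨ F.+-identityʳ _ ⟨
        (R ⊞ S ⊡ G) i + 0# ≡⟨ ≡cong ((R ⊞ S ⊡ G) i +_) (trunc-ideal size T Y-low i l) ⟨
        (R ⊞ S ⊡ G) i + (T ⊡ (β PE.^ size ⊞ C (- x₀))) i
          ≡⟨ Val-ev {n = width +ℕ suc J *ℕ size} total-value (Bd-horner (suc J) (λ j → Bd-term (br j) (bs j))) i ⟨
        Ser.ev (width +ℕ suc J *ℕ size) (auxiliary (suc J) r s) β i ≡⟨ Ser.ev-zero (width +ℕ suc J *ℕ size) β e i ⟩
        0# ∎
        where open Relation.Binary.PropositionalEquality.≡-Reasoning
      H^size : Hβ PE.^ size P.- C b ≡[ size ] (λ _ → 0#)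
      H^size i l = ≡trans (≡cong (_- C b i) (≡trans (PE.^-congˡ size shape i) (frobenius-line b _ i l))) (F.-‿inverseʳ _)
        where
        shape : Hβ ≋ C b ⊞ Z ⊡ Ser.difference (suc m) h (C x₀) (C 1# ⊡ Z)
        shape = P.trans (Ser.ev-difference (suc m) h (C x₀) (C 1# ⊡ Z))
          (P.+-cong (ev-C-C (suc m) h x₀) (P.*-congʳ {Ser.difference (suc m) h (C x₀) (C 1# ⊡ Z)} (P.*-identityˡ Z)))
      difference-value : Val β (r₀ ⊡ r₀ ⊡ h ⊞ C (- b) ⊡ (s₀ ⊡ s₀)) (R ⊡ R ⊡ Hβ ⊞ C (- b) ⊡ (S ⊡ S))
      difference-value = Val-+ (Val-* (Val-* Val-r Val-r) Val-h) (Val-* (Val-C (- b)) (Val-* Val-s Val-s))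
      C-neg : ∀ x → C (- x) ≋ P.- C x
      C-neg x zero = ≡refl
      C-neg x (suc i) = ≡sym -0#≈0#
        where open Algebra.Properties.Ring F.ring using (-0#≈0#)
      factored : R ⊡ R ⊡ Hβ ⊞ C (- b) ⊡ (S ⊡ S) ≋ ((R P.- S ⊡ G) ⊡ Hβ) ⊡ (R ⊞ S ⊡ G) ⊞ (S ⊡ S) ⊡ (Hβ PE.^ size P.- C b)
      factored = R.begin
        R ⊡ R ⊡ Hβ ⊞ C (- b) ⊡ (S ⊡ S) R.≈⟨ P.+-congˡ {R ⊡ R ⊡ Hβ} (P.*-congʳ {S ⊡ S} (C-neg b)) ⟩
        R ⊡ R ⊡ Hβ ⊞ (P.- C b) ⊡ (S ⊡ S)
          R.≈⟨ I.stepanov-factor R S G Hβ (C b) ⟩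
        ((R P.- S ⊡ G) ⊡ Hβ) ⊡ (R ⊞ S ⊡ G) ⊞ (S ⊡ S) ⊡ (Hβ ⊡ (G ⊡ G) P.- C b)
          R.≈⟨ P.+-congˡ {((R P.- S ⊡ G) ⊡ Hβ) ⊡ (R ⊞ S ⊡ G)} (P.*-congˡ {S ⊡ S} (P.+-congʳ { P.- C b} (P.*-congˡ {Hβ} (P.sym (PE.^-homo-* Hβ half half))))) ⟩
        ((R P.- S ⊡ G) ⊡ Hβ) ⊡ (R ⊞ S ⊡ G) ⊞ (S ⊡ S) ⊡ (Hβ PE.^ suc (half +ℕ half) P.- C b)
          R.≡⟨ ≡cong (λ q → ((R P.- S ⊡ G) ⊡ Hβ) ⊡ (R ⊞ S ⊡ G) ⊞ (S ⊡ S) ⊡ (Hβ PE.^ q P.- C b)) (≡sym size-odd) ⟩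
        ((R P.- S ⊡ G) ⊡ Hβ) ⊡ (R ⊞ S ⊡ G) ⊞ (S ⊡ S) ⊡ (Hβ PE.^ size P.- C b) R.∎
      Bd-difference : Bd size (r₀ ⊡ r₀ ⊡ h ⊞ C (- b) ⊡ (s₀ ⊡ s₀))
      Bd-difference = Bd-+
        (Bd-mono small (Bd-* {c +ℕ c} (Bd-*′ {c} (br Fin.zero) (br Fin.zero)) Bd-h))
        (Bd-mono (ℕₚ.≤-trans (ℕₚ.m≤m+n (c +ℕ c) m) small)
          (Bd-cong (P.*-comm (s₀ ⊡ s₀) (C (- b))) (≡subst (λ n → Bd n ((s₀ ⊡ s₀) ⊡ C (- b))) (ℕₚ.+-identityʳ _)
            (Bd-* {c +ℕ c} {0} (Bd-*′ {c} (bs Fin.zero) (bs Fin.zero)) (Bd-C (- b))))))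
      first : Zero r₀ × Zero s₀
      first = ns r₀ s₀ (br Fin.zero) (bs Fin.zero) λ i → inverse-unique
        (≡trans (≡cong ((r₀ ⊡ r₀ ⊡ h) i +_) (≡sym (≡trans (P.*-congʳ {s₀ ⊡ s₀} (C-neg b) i) (I.neg-* (C b) (s₀ ⊡ s₀) i))))
          (vanishing-polynomial size _ x₀ Bd-difference
            (λ j l → ≡trans (Val-ev difference-value Bd-difference j) (≡trans (factored j)
              (≡trans (≡cong₂ _+_ (trunc-ideal size ((R P.- S ⊡ G) ⊡ Hβ) low j l) (trunc-ideal size (S ⊡ S) H^size j l)) (F.+-identityʳ 0#)))) i))
      rest : Zero others
      rest = Domain.cancel domain-of-series Y≢0 λ i → begin
        (Y ⊡ others) i ≡⟨ P.*-comm Y others i ⟩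
        (others ⊡ Y) i ≡⟨ F.+-identityˡ _ ⟨
        0# + (others ⊡ Y) i ≡⟨ ≡cong (_+ (others ⊡ Y) i) (≡trans (≡cong₂ _+_ (proj₁ first i) (⊡-zeroˡ s₀ g (proj₂ first) i)) (F.+-identityʳ 0#)) ⟨
        (r₀ ⊞ s₀ ⊡ g) i + (others ⊡ Y) i ≡⟨ e i ⟩
        0# ∎
        where open Relation.Binary.PropositionalEquality.≡-Reasoning

    module _ (a : Carrier) (J : ℕ) where
      open LinearFamily (J *ℕ (2 *ℕ c))
      private
        position : Fin J → Fin 2 → Fin c → Fin (J *ℕ (2 *ℕ c))
        position j e i = Fin.combine j (Fin.combine e i)

        r s : Parameters → Fin J → Series
        r u j = poly (λ i → u (position j Fin.zero i))
        s u j = poly (λ i → u (position j (Fin.suc Fin.zero) i))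

        direction : Carrier → Series
        direction x = line x (H x)

        G : Carrier → Series
        G x = C a ⊡ expansion (suc m) h x (H x) PE.^ half

        -- The expansion of the auxiliary polynomial at x in the direction h(x), with g replaced by
        -- a E^half and Y by x - x₀. The replacement for g is justified only where h(x) ≠ 0 and
        -- h(x)^half = a, but its coefficients are polynomials in x and can be made to vanish for
        -- every x at once.
        local : (Fin J → Series) → (Fin J → Series) → Carrier → Series
        local r s x = horner J (λ j → Ser.ev c (r j) (direction x) ⊞ Ser.ev c (s j) (direction x) ⊡ G x) (C (x - x₀))

        Pol-H : Pol m H
        Pol-H = h , Bd-h , λ _ → ≡refl

        open Family {0} {1} {m} Pol-id Pol-H

        PolS-G : PolS m 0 G
        PolS-G = PolS-* {m} {0} {0} (PolS-C (Pol-const a))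
          (PolS-^ (PolS-expansion m (λ i → Pol-const (h i)) (ℕₚ.≤-reflexive (ℕₚ.*-identityʳ m))) half)

        LPolS-ev : ∀ {d} (ι : Fin d → Fin (J *ℕ (2 *ℕ c))) → LPolS m d (λ u x → Ser.ev d (poly (λ i → u (ι i))) (direction x))
        LPolS-ev {zero} ι k = LPol-0
        LPolS-ev {suc d} ι = LPolS-+ (LPolS-mono {e = 0} z≤n (LPolS-C (LPol-coordinate (ι Fin.zero))))
          (λ k → LPol-cong (λ u x → P.*-comm _ (direction x) k)
            (LPolS-mono {e = d +ℕ 1} (ℕₚ.≤-reflexive (ℕₚ.+-comm d 1)) (LPolS-* {m} {d} {1} (LPolS-ev (ι ∘ Fin.suc)) (PolS-line Pol-id Pol-H)) k))

        LPolS-horner : ∀ j {ρ : Parameters → Carrier → Fin j → Series} → (∀ i → LPolS m c (λ u x → ρ u x i)) →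
          LPolS m (c +ℕ j) (λ u x → horner j (ρ u x) (C (x - x₀)))
        LPolS-horner zero b k = LPol-0
        LPolS-horner (suc j) {ρ} b = LPolS-+ (LPolS-mono (ℕₚ.m≤m+n c _) (b Fin.zero))
          (≡subst (λ e → LPolS m e (λ u x → horner j (ρ u x ∘ Fin.suc) (C (x - x₀)) ⊡ C (x - x₀)))
            (≡trans (ℕₚ.+-assoc c j 1) (≡cong (c +ℕ_) (ℕₚ.+-comm j 1)))
            (LPolS-* {m} {c +ℕ j} {1} (LPolS-horner j (λ i → b (Fin.suc i))) (PolS-C (Pol-+ Pol-id (Pol-const (- x₀))))))

        -- The offset c comes from evaluating r and s on the line through x, and J from the powers
        -- of x - x₀; the factor `G` has offset 0.
        LPolS-local : LPolS m (c +ℕ J) (λ u → local (r u) (s u))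
        LPolS-local = LPolS-horner J λ j → LPolS-+ (LPolS-ev (position j Fin.zero))
          (LPolS-mono {e = c +ℕ 0} (ℕₚ.≤-reflexive (ℕₚ.+-identityʳ c)) (LPolS-* {m} {c} {0} (LPolS-ev (position j (Fin.suc Fin.zero))) PolS-G))

        horner-trunc : ∀ n j {ρ ρ′ : Fin j → Series} {y y′} → (∀ i → ρ i ≋ ρ′ i) → y ≡[ n ] y′ → horner j ρ y ≡[ n ] horner j ρ′ y′
        horner-trunc n zero e f i l = ≡refl
        horner-trunc n (suc j) {ρ} {ρ′} {y} {y′} e f i l = ≡cong₂ _+_ (e Fin.zero i) (trunc-* n {_} {horner j (ρ′ ∘ Fin.suc) y′} {y} {y′}
          (horner-trunc n j (e ∘ Fin.suc) f) f i l)

        vanishes : ∀ r s → (∀ j → Bd c (r j)) → (∀ j → Bd c (s j)) → ∀ ℓ → ℓ ≤ size → ∀ x → H x ≢ 0# → H x ^ half ≡ a →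
          (∀ k → k < ℓ → local r s x k ≡ 0#) → VanishesAt (width +ℕ J *ℕ size) (auxiliary J r s) (x , ℓ)
        vanishes r s br bs ℓ ℓ≤ x Hx≢0 Hx^half z = H x , Hx≢0 , λ k k<ℓ →
          ≡trans (Val-ev (Val-horner J (Val-Y (direction x)) term) (Bd-horner J (λ j → Bd-term (br j) (bs j))) k)
            (≡trans (horner-trunc size J (λ j i → ≡refl) (line-frobenius x (H x)) k (ℕₚ.<-≤-trans k<ℓ ℓ≤)) (z k k<ℓ))
          where
          E = expansion (suc m) h x (H x)
          term : ∀ j → Val (direction x) (r j ⊞ s j ⊡ g) (Ser.ev c (r j) (direction x) ⊞ Ser.ev c (s j) (direction x) ⊡ G x)
          term j = Val-+ (c , br j , P.refl) (Val-* (c , bs j , P.refl)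
            (Val-cong {v = (C (H x) ⊡ E) PE.^ half} (P.trans (PE.^-distrib-* (C (H x)) E half)
                (P.*-congʳ {E PE.^ half} (P.trans (C-^ (H x) half) (C-cong Hx^half))))
              (Val-^ (Val-cong (ev-expansion (suc m) h x) (suc m , Bd-h , P.refl)) half)))

        trivial : ∀ u → (∀ j → Zero (r u j) × Zero (s u j)) → ∀ α → u α ≡ 0#
        trivial u z α = ≡trans (≡cong u (≡trans (≡sym (Finₚ.combine-remQuot {J} (2 *ℕ c) α))
            (≡cong (Fin.combine j) (≡sym (Finₚ.combine-remQuot {2} c β)))))
          (at (proj₁ (Fin.remQuot {2} c β)) (proj₂ (Fin.remQuot {2} c β)))
          where
          j = proj₁ (Fin.remQuot {J} (2 *ℕ c) α)
          β = proj₂ (Fin.remQuot {J} (2 *ℕ c) α)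
          at : ∀ e i → u (position j e i) ≡ 0#
          at Fin.zero i = ≡trans (≡sym (poly-toℕ (λ i → u (position j Fin.zero i)) i)) (proj₁ (z j) (Fin.toℕ i))
          at (Fin.suc Fin.zero) i = ≡trans (≡sym (poly-toℕ (λ i → u (position j (Fin.suc Fin.zero) i)) i)) (proj₂ (z j) (Fin.toℕ i))

      -- There are ℓ conditions, each a polynomial in x of degree at most c + J + ℓ m, and 2 c J
      -- unknown coefficients. A nontrivial solution gives a polynomial that is nonzero by
      -- `independence` and has zeros of order ℓ on the whole set `b`, which its length must
      -- accommodate.
      stepanov : NonSquare c h (H x₀) → c +ℕ c +ℕ m ≤ size →
        ∀ ℓ → ℓ ≤ size → ℓ *ℕ suc (c +ℕ J +ℕ ℓ *ℕ m) < J *ℕ (2 *ℕ c) →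
        (b : Fin size → Bool) → (∀ i → b i ≡ true → H (elt K i) ≢ 0# × H (elt K i) ^ half ≡ a) →
        count K b *ℕ ℓ < c +ℕ half *ℕ m +ℕ J *ℕ size
      stepanov ns small ℓ ℓ≤ few b good = ℕₚ.≰⇒> λ many → contradict many
        (siegel ℓ (c +ℕ J +ℕ ℓ *ℕ m) (λ k u x → local (r u) (s u) x k)
          (λ k k<ℓ → LPol-mono (ℕₚ.+-monoʳ-≤ (c +ℕ J) (ℕₚ.*-monoˡ-≤ m (ℕₚ.<⇒≤ k<ℓ))) (LPolS-local k)) few)
        where
        contradict : width +ℕ J *ℕ size ≤ count K b *ℕ ℓ →
          ¬ (∃ λ u → (∃ λ i → u i ≢ 0#) × ∀ k → k < ℓ → ∀ x → local (r u) (s u) x k ≡ 0#)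
        contradict many (u , (i , ui≢0) , solves) = ui≢0 (trivial u (independence ns small J (r u) (s u) Bd-r Bd-s
          (few-roots (width +ℕ J *ℕ size) (auxiliary J (r u) (s u)) (Bd-horner J (λ j → Bd-term (Bd-r j) (Bd-s j))) b ℓ
            (λ i e → vanishes (r u) (s u) Bd-r Bd-s ℓ ℓ≤ (elt K i) (proj₁ (good i e)) (proj₂ (good i e))
              (λ k k<ℓ → solves k k<ℓ (elt K i))) many)) i)
          where
          Bd-r : ∀ j → Bd c (r u j)
          Bd-r j = Bd-poly _
          Bd-s : ∀ j → Bd c (s u j)
          Bd-s j = Bd-poly _

integer-sqrt : ∀ q → ∃ λ r → r *ℕ r ≤ q × q < suc r *ℕ suc r
integer-sqrt zero = 0 , z≤n , s≤s z≤n
integer-sqrt (suc q) with integer-sqrt q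
... | r , l , u with suc r *ℕ suc r ℕₚ.≤? suc q
... | no n  = r , ℕₚ.m≤n⇒m≤1+n l , ℕₚ.≰⇒> n
... | yes y = suc r , y , ℕₚ.<-≤-trans (s≤s u) (≡subst (λ t → suc (suc r *ℕ suc r) ≤ t) (≡sym (lemma r)) (ℕₚ.m≤m+n _ _))
  where
  lemma : ∀ r → suc (suc r) *ℕ suc (suc r) ≡ suc (suc r *ℕ suc r) +ℕ suc (suc (r +ℕ r))
  lemma = solve-∀

-- Parameters of Stepanov's method for q = 2 (c + d) + 1 and r² ≤ q < (r+1)²:
-- zeros of order 2r, and J = r + excess d powers of X ^ q.
module Parameters where
  open ℕₚ.≤-Reasoning

  -- Put M = 1 + 4 d. There are 2 r c + 2 M r² + O(r) conditions and 2 r c + 16 M c unknowns when J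
  -- = r + 8 M. The terms 2 r c cancel, and 16 M c is close to 8 M q ≥ 8 M r², four times the main
  -- term to be beaten, which leaves room for the lower order terms.
  excess : ℕ → ℕ
  excess d = 8 *ℕ (1 +ℕ 4 *ℕ d)

  -- Everything in the length of the auxiliary polynomial beyond the main term r q is at most κ q.
  κ : ℕ → ℕ
  κ d = excess d +ℕ (d +ℕ d) +ℕ 1

  private
    left : ∀ c d r → let M = 1 +ℕ 4 *ℕ d in
      2 *ℕ r *ℕ suc (c +ℕ (r +ℕ 8 *ℕ M) +ℕ 2 *ℕ r *ℕ (d +ℕ d)) ≡ 2 *ℕ r *ℕ c +ℕ (2 *ℕ (r *ℕ r) *ℕ M +ℕ 2 *ℕ r +ℕ 16 *ℕ M *ℕ r)
    left = solve-∀

    right : ∀ c d r → let M = 1 +ℕ 4 *ℕ d in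
      8 *ℕ M *ℕ suc ((c +ℕ d) +ℕ (c +ℕ d)) +ℕ 2 *ℕ r *ℕ c ≡ (r +ℕ 8 *ℕ M) *ℕ (2 *ℕ c) +ℕ 8 *ℕ M *ℕ suc (d +ℕ d)
    right = solve-∀

    rearrange : ∀ x y z → suc (x +ℕ y) +ℕ z ≡ suc (y +ℕ z) +ℕ x
    rearrange = solve-∀

  private
    margin : ∀ M d r → 1 ≤ M → 16 ≤ r → 2 *ℕ suc (d +ℕ d) ≤ r →
      2 *ℕ (r *ℕ r) *ℕ M +ℕ 2 *ℕ r +ℕ 16 *ℕ M *ℕ r +ℕ 8 *ℕ M *ℕ suc (d +ℕ d) < 8 *ℕ M *ℕ (r *ℕ r)
    margin M d r M≥1 r≥16 r≥ = begin-strict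
      2 *ℕ (r *ℕ r) *ℕ M +ℕ 2 *ℕ r +ℕ 16 *ℕ M *ℕ r +ℕ 8 *ℕ M *ℕ suc (d +ℕ d) ≡⟨ collect M r (suc (d +ℕ d)) ⟩
      2 *ℕ (r *ℕ P) +ℕ (2 *ℕ r +ℕ (16 *ℕ P +ℕ 4 *ℕ (M *ℕ (2 *ℕ suc (d +ℕ d)))))
        ≤⟨ ℕₚ.+-monoʳ-≤ (2 *ℕ (r *ℕ P)) (ℕₚ.+-mono-≤ (ℕₚ.*-monoʳ-≤ 2 r≤P) (ℕₚ.+-monoʳ-≤ (16 *ℕ P) (ℕₚ.*-monoʳ-≤ 4 (ℕₚ.*-monoʳ-≤ M r≥)))) ⟩
      2 *ℕ (r *ℕ P) +ℕ (2 *ℕ P +ℕ (16 *ℕ P +ℕ 4 *ℕ P)) <⟨ ℕₚ.+-monoʳ-< (2 *ℕ (r *ℕ P)) (gap P (ℕₚ.≤-trans (ℕₚ.≤-trans (s≤s z≤n) r≥16) r≤P)) ⟩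
      2 *ℕ (r *ℕ P) +ℕ 2 *ℕ (16 *ℕ P) ≤⟨ ℕₚ.+-monoʳ-≤ (2 *ℕ (r *ℕ P)) (ℕₚ.*-monoʳ-≤ 2 (ℕₚ.*-monoˡ-≤ P r≥16)) ⟩
      2 *ℕ (r *ℕ P) +ℕ 2 *ℕ (r *ℕ P) ≤⟨ ℕₚ.m≤m+n _ _ ⟩
      2 *ℕ (r *ℕ P) +ℕ 2 *ℕ (r *ℕ P) +ℕ 4 *ℕ (r *ℕ P) ≡⟨ expand M r ⟩
      8 *ℕ M *ℕ (r *ℕ r) ∎
      where
      P = M *ℕ r
      r≤P : r ≤ P
      r≤P = ≡subst (_≤ P) (ℕₚ.*-identityˡ r) (ℕₚ.*-monoˡ-≤ r M≥1)
      collect : ∀ M r D → 2 *ℕ (r *ℕ r) *ℕ M +ℕ 2 *ℕ r +ℕ 16 *ℕ M *ℕ r +ℕ 8 *ℕ M *ℕ D ≡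
        2 *ℕ (r *ℕ (M *ℕ r)) +ℕ (2 *ℕ r +ℕ (16 *ℕ (M *ℕ r) +ℕ 4 *ℕ (M *ℕ (2 *ℕ D))))
      collect = solve-∀
      expand : ∀ M r → 2 *ℕ (r *ℕ (M *ℕ r)) +ℕ 2 *ℕ (r *ℕ (M *ℕ r)) +ℕ 4 *ℕ (r *ℕ (M *ℕ r)) ≡ 8 *ℕ M *ℕ (r *ℕ r)
      expand = solve-∀
      gap : ∀ P → 1 ≤ P → 2 *ℕ P +ℕ (16 *ℕ P +ℕ 4 *ℕ P) < 2 *ℕ (16 *ℕ P)
      gap P P≥1 = ≡subst (2 *ℕ P +ℕ (16 *ℕ P +ℕ 4 *ℕ P) <_) (sum P) (ℕₚ.m<m+n _ (ℕₚ.≤-trans P≥1 (ℕₚ.m≤m+n P (9 *ℕ P))))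
        where
        sum : ∀ P → 2 *ℕ P +ℕ (16 *ℕ P +ℕ 4 *ℕ P) +ℕ 10 *ℕ P ≡ 2 *ℕ (16 *ℕ P)
        sum = solve-∀

  few-conditions : ∀ d c r → 16 +ℕ 4 *ℕ d ≤ r → r *ℕ r ≤ suc ((c +ℕ d) +ℕ (c +ℕ d)) →
    2 *ℕ r *ℕ suc (c +ℕ (r +ℕ excess d) +ℕ 2 *ℕ r *ℕ (d +ℕ d)) < (r +ℕ excess d) *ℕ (2 *ℕ c)
  few-conditions d c r large square = ℕₚ.+-cancelʳ-< (8 *ℕ M *ℕ suc (d +ℕ d)) _ _ (begin
    suc (2 *ℕ r *ℕ suc (c +ℕ (r +ℕ excess d) +ℕ 2 *ℕ r *ℕ (d +ℕ d)) +ℕ 8 *ℕ M *ℕ suc (d +ℕ d))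
      ≡⟨ ≡cong (λ t → suc (t +ℕ 8 *ℕ M *ℕ suc (d +ℕ d))) (left c d r) ⟩
    suc (2 *ℕ r *ℕ c +ℕ (2 *ℕ (r *ℕ r) *ℕ M +ℕ 2 *ℕ r +ℕ 16 *ℕ M *ℕ r)) +ℕ 8 *ℕ M *ℕ suc (d +ℕ d)
      ≡⟨ rearrange (2 *ℕ r *ℕ c) _ _ ⟩
    suc ((2 *ℕ (r *ℕ r) *ℕ M +ℕ 2 *ℕ r +ℕ 16 *ℕ M *ℕ r) +ℕ 8 *ℕ M *ℕ suc (d +ℕ d)) +ℕ 2 *ℕ r *ℕ c
      ≤⟨ ℕₚ.+-monoˡ-≤ (2 *ℕ r *ℕ c) (margin M d r (s≤s z≤n) (ℕₚ.≤-trans (ℕₚ.m≤m+n 16 _) large) (ℕₚ.≤-trans (ℕₚ.≤-trans (ℕₚ.≤-reflexive (small d)) (ℕₚ.+-monoˡ-≤ (4 *ℕ d) {2} {16} (s≤s (s≤s z≤n)))) large)) ⟩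
    8 *ℕ M *ℕ (r *ℕ r) +ℕ 2 *ℕ r *ℕ c ≤⟨ ℕₚ.+-monoˡ-≤ (2 *ℕ r *ℕ c) (ℕₚ.*-monoʳ-≤ (8 *ℕ M) square) ⟩
    8 *ℕ M *ℕ suc ((c +ℕ d) +ℕ (c +ℕ d)) +ℕ 2 *ℕ r *ℕ c ≡⟨ right c d r ⟩
    (r +ℕ excess d) *ℕ (2 *ℕ c) +ℕ 8 *ℕ M *ℕ suc (d +ℕ d) ∎)
    where
    M = 1 +ℕ 4 *ℕ d
    small : ∀ d → 2 *ℕ suc (d +ℕ d) ≡ 2 +ℕ 4 *ℕ d
    small = solve-∀

  private
    total : ∀ c d n r t → c +ℕ n *ℕ (d +ℕ d) +ℕ (r +ℕ t) *ℕ suc (n +ℕ n) +ℕ (n +ℕ n *ℕ (d +ℕ d) +ℕ (d +ℕ d) +ℕ (n +ℕ 1))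
      ≡ c +ℕ (r *ℕ suc (n +ℕ n) +ℕ (t +ℕ (d +ℕ d) +ℕ 1) *ℕ suc (n +ℕ n))
    total = solve-∀

    regroup : ∀ r q k → r *ℕ q +ℕ k *ℕ (4 *ℕ (r *ℕ r)) ≡ r *ℕ (q +ℕ 4 *ℕ k *ℕ r)
    regroup = solve-∀

    double : ∀ r N → r *ℕ (2 *ℕ N) ≡ N *ℕ (2 *ℕ r)
    double = solve-∀

    bound4 : ∀ r q → 1 ≤ r → q < suc r *ℕ suc r → q ≤ 4 *ℕ (r *ℕ r)
    bound4 (suc r) q l u = ℕₚ.≤-trans (ℕₚ.<⇒≤ u) (≡subst (suc (suc r) *ℕ suc (suc r) ≤_) (lemma r) (ℕₚ.m≤m+n _ _))
      where
      lemma : ∀ r → suc (suc r) *ℕ suc (suc r) +ℕ (3 *ℕ (r *ℕ r) +ℕ 4 *ℕ r) ≡ 4 *ℕ (suc r *ℕ suc r)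
      lemma = solve-∀

  -- N zeros of order 2 r fit into length at most r q + κ q. Dividing by r and using q ≤ 4 r² turns
  -- the second term into 4 κ r, an error of size √q.
  half-bound : ∀ d c r N → 1 ≤ r → suc ((c +ℕ d) +ℕ (c +ℕ d)) < suc r *ℕ suc r →
    N *ℕ (2 *ℕ r) < c +ℕ (c +ℕ d) *ℕ (d +ℕ d) +ℕ (r +ℕ excess d) *ℕ suc ((c +ℕ d) +ℕ (c +ℕ d)) →
    2 *ℕ N ≤ suc ((c +ℕ d) +ℕ (c +ℕ d)) +ℕ 4 *ℕ κ d *ℕ r
  half-bound d c r@(suc _) N r≥1 q< N< = ℕₚ.*-cancelˡ-≤ r (begin
    r *ℕ (2 *ℕ N) ≡⟨ double r N ⟩
    N *ℕ (2 *ℕ r) ≤⟨ ℕₚ.<⇒≤ N< ⟩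
    c +ℕ n *ℕ (d +ℕ d) +ℕ (r +ℕ excess d) *ℕ q
      ≤⟨ ℕₚ.+-cancelˡ-≤ c _ _ (begin
           c +ℕ (c +ℕ n *ℕ (d +ℕ d) +ℕ (r +ℕ excess d) *ℕ q) ≡⟨ ℕₚ.+-comm c _ ⟩
           (c +ℕ n *ℕ (d +ℕ d) +ℕ (r +ℕ excess d) *ℕ q) +ℕ c ≤⟨ ℕₚ.+-monoʳ-≤ _ c≤ ⟩
           (c +ℕ n *ℕ (d +ℕ d) +ℕ (r +ℕ excess d) *ℕ q) +ℕ (n +ℕ n *ℕ (d +ℕ d) +ℕ (d +ℕ d) +ℕ (n +ℕ 1)) ≡⟨ total c d n r (excess d) ⟩
           c +ℕ (r *ℕ q +ℕ κ d *ℕ q) ∎) ⟩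
    r *ℕ q +ℕ κ d *ℕ q ≤⟨ ℕₚ.+-monoʳ-≤ (r *ℕ q) (ℕₚ.*-monoʳ-≤ (κ d) (bound4 r q r≥1 q<)) ⟩
    r *ℕ q +ℕ κ d *ℕ (4 *ℕ (r *ℕ r)) ≡⟨ regroup r q (κ d) ⟩
    r *ℕ (q +ℕ 4 *ℕ κ d *ℕ r) ∎)
    where
    n = c +ℕ d
    q = suc (n +ℕ n)
    c≤ : c ≤ n +ℕ n *ℕ (d +ℕ d) +ℕ (d +ℕ d) +ℕ (n +ℕ 1)
    c≤ = begin
      c ≤⟨ ℕₚ.m≤m+n c d ⟩
      n ≤⟨ ℕₚ.m≤m+n n _ ⟩
      n +ℕ n *ℕ (d +ℕ d) ≤⟨ ℕₚ.m≤m+n _ _ ⟩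
      n +ℕ n *ℕ (d +ℕ d) +ℕ (d +ℕ d) ≤⟨ ℕₚ.m≤m+n _ _ ⟩
      n +ℕ n *ℕ (d +ℕ d) +ℕ (d +ℕ d) +ℕ (n +ℕ 1) ∎

module HalfCount (K : FiniteField) (odd : OddPrimePower (FiniteField.size K)) where
  open SeriesFacts K odd
  open Parameters

  -- The length c = (q-1)/2 - d is the largest that `independence` permits for h of degree 2 d,
  -- since 2 c + 2 d = q - 1.
  half-count : ∀ d h → Bd (suc (d +ℕ d)) h → ∀ x₀ c → half ≡ c +ℕ d → NonSquare c h (Id.ev (suc (d +ℕ d)) h x₀) →
    ∀ r → 16 +ℕ 4 *ℕ d ≤ r → r *ℕ r ≤ size → size < suc r *ℕ suc r →
    ∀ a (b : Fin size → Bool) →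
    (∀ i → b i ≡ true → Id.ev (suc (d +ℕ d)) h (elt K i) ≢ 0# × Id.ev (suc (d +ℕ d)) h (elt K i) ^ half ≡ a) →
    2 *ℕ count K b ≤ size +ℕ 4 *ℕ κ d *ℕ r
  half-count d h Bd-h x₀ c half≡ ns r large r²≤ <r² a b good =
    ≡subst (λ q → 2 *ℕ count K b ≤ q +ℕ 4 *ℕ κ d *ℕ r) (≡sym size≡)
      (half-bound d c r (count K b) (ℕₚ.≤-trans (s≤s z≤n) large) (≡subst (_< suc r *ℕ suc r) size≡ <r²)
        (≡subst (λ n → count K b *ℕ (2 *ℕ r) < c +ℕ n *ℕ (d +ℕ d) +ℕ (r +ℕ excess d) *ℕ suc (n +ℕ n)) half≡
          (≡subst (λ q → count K b *ℕ (2 *ℕ r) < c +ℕ half *ℕ (d +ℕ d) +ℕ (r +ℕ excess d) *ℕ q) size-odd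
            (Stepanov.stepanov K odd (d +ℕ d) h Bd-h x₀ c a (r +ℕ excess d) ns
              (≡subst (c +ℕ c +ℕ (d +ℕ d) ≤_) (≡sym size≡) (ℕₚ.≤-trans (ℕₚ.≤-reflexive (lemma c d)) (ℕₚ.n≤1+n _)))
              (2 *ℕ r) (ℕₚ.≤-trans (ℕₚ.*-monoˡ-≤ r (ℕₚ.≤-trans (s≤s (s≤s z≤n)) large)) r²≤)
              (few-conditions d c r large (≡subst (r *ℕ r ≤_) size≡ r²≤)) b good))))
    where
    size≡ : size ≡ suc ((c +ℕ d) +ℕ (c +ℕ d))
    size≡ = ≡trans size-odd (≡cong (λ n → suc (n +ℕ n)) half≡)
    lemma : ∀ c d → c +ℕ c +ℕ (d +ℕ d) ≡ (c +ℕ d) +ℕ (c +ℕ d)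
    lemma = solve-∀

-- Square roots of power series, and when they are rational.

module SquareRoot (K : FiniteField) (odd : OddPrimePower (FiniteField.size K)) where
  open SeriesFacts K odd

  ½ : Carrier
  ½ = proj₁ (inverse (1# + 1#) 2≢0)

  ½+½ : ½ + ½ ≡ 1#
  ½+½ = ≡trans (≡sym (≡trans (F.distribʳ ½ 1# 1#) (≡cong₂ _+_ (F.*-identityˡ ½) (F.*-identityˡ ½)))) (proj₂ (inverse (1# + 1#) 2≢0))

  -- Newton's iteration with 1/s replaced by 1 gains one coefficient per step instead of doubling
  -- their number. In return it divides only by 2, so the coefficients remain polynomial in any
  -- parameter of E.
  approximation : Series → ℕ → Series
  approximation E zero = C 1#
  approximation E (suc k) = approximation E k ⊞ C ½ ⊡ (E P.- approximation E k ⊡ approximation E k)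

  -- The diagonal is the limit, because coefficient i no longer changes after step i.
  sqrt : Series → Series
  sqrt E i = approximation E i i

  raise-order : ∀ k {p q} → p ≡[ k ] (λ _ → 0#) → q 0 ≡ 0# → p ⊡ q ≡[ suc k ] (λ _ → 0#)
  raise-order k {p} {q} e z i l = ≡trans (⊡-comm p q i) (shifted i l)
    where
    shifted : ∀ i → i < suc k → (q ⊡ p) i ≡ 0#
    shifted zero l = ≡trans (≡cong (_* p 0) z) (F.zeroˡ _)
    shifted (suc i) (s≤s l) = ≡trans (≡cong₂ _+_ (≡trans (≡cong (_* p (suc i)) z) (F.zeroˡ _)) (trunc-ideal k (tail q) e i l)) (F.+-identityʳ 0#)

  module _ (E : Series) (E0 : E 0 ≡ 1#) where
    private
      s : ℕ → Series
      s = approximation E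

      error : ℕ → Series
      error k = E P.- s k ⊡ s k

      C½ : C ½ ⊞ C ½ ≋ C 1#
      C½ = P.trans (P.sym (C-+ ½ ½)) (C-cong ½+½)

      approximates : ∀ k → error k ≡[ suc k ] (λ _ → 0#) × s k 0 ≡ 1#
      approximates zero = (λ { zero _ → ≡trans (≡cong₂ _-_ E0 (F.*-identityˡ 1#)) (F.-‿inverseʳ 1#) ; (suc _) (s≤s ()) }) , ≡refl
      approximates (suc k) = (λ i l → ≡trans (I.newton E (s k) (C ½) C½ i) (raise-order (suc k) {q = ψ} (proj₁ IH) ψ0 i l)) ,
        ≡trans (≡cong₂ _+_ (proj₂ IH) (≡trans (≡cong (½ *_) err0) (F.zeroʳ ½))) (F.+-identityʳ 1#)
        where
        IH = approximates k
        err0 : error k 0 ≡ 0#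
        err0 = proj₁ IH 0 (s≤s z≤n)
        ψ : Series
        ψ = (C 1# P.- s k) P.- C ½ ⊡ C ½ ⊡ error k
        ψ0 : ψ 0 ≡ 0#
        ψ0 = ≡trans (≡cong₂ _-_ (≡trans (≡cong (λ y → 1# - y) (proj₂ IH)) (F.-‿inverseʳ 1#)) (≡trans (≡cong (½ * ½ *_) err0) (F.zeroʳ _)))
          (F.-‿inverseʳ 0#)

      stabilises : ∀ k j i → i ≤ k → s (k +ℕ j) i ≡ s k i
      stabilises k zero i l = ≡cong (λ k → s k i) (ℕₚ.+-identityʳ k)
      stabilises k (suc j) i l = ≡trans (≡cong (λ k → s k i) (ℕₚ.+-suc k j))
        (≡trans (≡cong (s (k +ℕ j) i +_) (trunc-ideal (suc (k +ℕ j)) (C ½) (proj₁ (approximates (k +ℕ j))) i (s≤s (ℕₚ.≤-trans l (ℕₚ.m≤m+n k j)))))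
          (≡trans (F.+-identityʳ _) (stabilises k j i l)))

      sqrt-approx : ∀ k → sqrt E ≡[ suc k ] s k
      sqrt-approx k i (s≤s l) with ℕₚ.m≤n⇒∃[o]m+o≡n l
      ... | j , ≡refl = ≡sym (stabilises i j i ℕₚ.≤-refl)

    sqrt-square : sqrt E ⊡ sqrt E ≋ E
    sqrt-square i = ≡trans (trunc-* (suc i) (sqrt-approx i) (sqrt-approx i) i ℕₚ.≤-refl)
      (≡sym (inverse-unique (proj₁ (approximates i) i ℕₚ.≤-refl)))

  PolS-sqrt : ∀ {μ Θ} → PolS μ 0 Θ → PolS μ 0 (λ x → sqrt (Θ x))
  PolS-sqrt {μ} {Θ} p i = approx i i
    where
    Pol-minus : ∀ {D φ} → Pol D φ → Pol D (λ x → - φ x)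
    Pol-minus {φ = φ} a = Pol-cong (λ x → -1*x≈-x (φ x)) (Pol-* {0} (Pol-const (- 1#)) a)
      where open Algebra.Properties.Ring F.ring using (-1*x≈-x)
    approx : ∀ k → PolS μ 0 (λ x → approximation (Θ x) k)
    approx zero = PolS-C (Pol-const 1#)
    approx (suc k) = PolS-+ (approx k) (PolS-* {μ} {0} {0} (PolS-C (Pol-const ½))
      (PolS-+ p (λ i → Pol-minus (PolS-* {μ} {0} {0} (approx k) (approx k) i))))

  low : ℕ → Series → Series
  low zero p i = 0#
  low (suc n) p = constant (p 0) (low n (tail p))

  Bd-low : ∀ n p → Bd n (low n p)
  Bd-low zero p i l = ≡refl
  Bd-low (suc n) p (suc i) (s≤s l) = Bd-low n (tail p) i l

  low-agrees : ∀ n p → low n p ≡[ n ] p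
  low-agrees (suc n) p zero l = ≡refl
  low-agrees (suc n) p (suc i) (s≤s l) = low-agrees n (tail p) i l

  low-high : ∀ n p → p ≋ low n p ⊞ Z PE.^ n ⊡ (λ i → p (n +ℕ i))
  low-high n p i with n ℕₚ.≤? i
  ... | no n≰i = ≡trans (≡sym (low-agrees n p i (ℕₚ.≰⇒> n≰i))) (≡sym (≡trans (≡cong (low n p i +_) (Z^-⊡-low n (λ i → p (n +ℕ i)) i (ℕₚ.≰⇒> n≰i))) (F.+-identityʳ _)))
  ... | yes n≤i with ℕₚ.m≤n⇒∃[o]m+o≡n n≤i
  ... | j , ≡refl = ≡sym (≡trans (≡cong₂ _+_ (Bd-low n p (n +ℕ j) (ℕₚ.m≤m+n n j)) (Z^-⊡-high n (λ i → p (n +ℕ i)) j)) (F.+-identityˡ _))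

  shift-bound : ∀ n m p → Bd (m +ℕ n) (Z PE.^ n ⊡ p) → Bd m p
  shift-bound n m p b i l = ≡trans (≡sym (Z^-⊡-high n p i)) (b (n +ℕ i) (≡subst (m +ℕ n ≤_) (ℕₚ.+-comm i n) (ℕₚ.+-monoˡ-≤ n l)))

  *-nonzero-series : ∀ {p q} → ¬ Zero p → ¬ Zero q → ¬ Zero (p ⊡ q)
  *-nonzero-series np nq z = nq (Domain.cancel domain-of-series np z)

  -- Descent on the denominator: if σ = s / r with u the polynomial part of σ
  -- of degree ≤ d, then (s - r u) / Z^(d+1) is a smaller denominator of σ.
  module _ {d : ℕ} {σ E : Series} (square : σ ⊡ σ ≋ E) (Bd-E : Bd (suc (d +ℕ d)) E) where
    private
      u v : Series
      u = low (suc d) σ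
      v i = σ (suc d +ℕ i)
      Zᵈ : Series
      Zᵈ = Z PE.^ suc d

    rational-sqrt : ∀ k r s → Bd (suc k) r → Bd (suc (k +ℕ d)) s → ¬ Zero r → r ⊡ σ ≋ s → ∀ i → v i ≡ 0#
    rational-sqrt k r s br bs nr e i = decidable-stable (v i ≟ 0#) λ nv → smaller k br bs (*-nonzero-series nr (λ z → nv (z i))) nv
      where
      r′ s′ : Series
      r′ = r ⊡ v
      s′ = r ⊡ v ⊡ σ
      denominator : Zᵈ ⊡ r′ ≋ s P.- r ⊡ u
      denominator = P.sym (P.trans (P.+-congʳ { P.- (r ⊡ u)} (P.trans (P.sym e) (P.*-congˡ {r} (low-high (suc d) σ)))) (I.factor-low r u Zᵈ v))
      numerator : Zᵈ ⊡ s′ ≋ r ⊡ E P.- u ⊡ s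
      numerator = R.begin
        Zᵈ ⊡ s′ R.≈⟨ I.fourfold Zᵈ r v σ ⟨
        (Zᵈ ⊡ r′) ⊡ σ R.≈⟨ P.*-congʳ {σ} denominator ⟩
        (s P.- r ⊡ u) ⊡ σ R.≈⟨ I.conjugate s r u σ ⟩
        s ⊡ σ P.- u ⊡ (r ⊡ σ) R.≈⟨ P.+-cong (P.trans (P.*-congʳ {σ} (P.sym e)) (P.trans (P.*-assoc r σ σ) (P.*-congˡ {r} square)))
                                        (P.-‿cong (P.*-congˡ {u} e)) ⟩
        r ⊡ E P.- u ⊡ s R.∎
      smaller : ∀ k → Bd (suc k) r → Bd (suc (k +ℕ d)) s → ¬ Zero r′ → ¬ (v i ≡ 0#) → ⊥
      smaller k br bs nr′ nv = next k Bd-r′ Bd-s′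
        where
        -- Both s and r u have length at most k + d + 1, and removing Z^(d+1) leaves length k: one
        -- less than the bound for r.
        Bd-r′ : Bd k r′
        Bd-r′ = shift-bound (suc d) k r′ (Bd-cong (P.sym denominator)
          (Bd-+ (Bd-mono (ℕₚ.≤-reflexive (≡sym (ℕₚ.+-suc k d))) bs)
                (Bd-neg (Bd-mono (ℕₚ.≤-reflexive (≡sym (ℕₚ.+-suc k d))) (Bd-* {suc k} {d} br (Bd-low (suc d) σ))))))
        Bd-s′ : Bd (k +ℕ d) s′
        Bd-s′ = shift-bound (suc d) (k +ℕ d) s′ (Bd-cong (P.sym numerator)
          (Bd-+ (Bd-mono (ℕₚ.≤-reflexive (lemma₁ k d)) (Bd-* {suc k} {d +ℕ d} br Bd-E))
                (Bd-neg (Bd-mono (ℕₚ.≤-reflexive (lemma₂ k d)) (Bd-* {suc d} {k +ℕ d} (Bd-low (suc d) σ) bs)))))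
          where
          lemma₁ : ∀ k d → suc k +ℕ (d +ℕ d) ≡ k +ℕ d +ℕ suc d
          lemma₁ = solve-∀
          lemma₂ : ∀ k d → suc d +ℕ (k +ℕ d) ≡ k +ℕ d +ℕ suc d
          lemma₂ = solve-∀
        next : ∀ k → Bd k r′ → Bd (k +ℕ d) s′ → ⊥
        next zero b b′ = nr′ (Bd-zero b)
        next (suc k) b b′ = nv (rational-sqrt k r′ s′ b b′ nr′ P.refl i)

  Bd-ev-line : ∀ n p x b → Bd n (Ser.ev n p (line x b))
  Bd-ev-line zero p x b i l = ≡refl
  Bd-ev-line (suc n) p x b = Bd-+ (Bd-C (p 0)) (Bd-cong (P.*-comm _ (line x b))
    (Bd-mono (ℕₚ.≤-reflexive (ℕₚ.+-comm n 1)) (Bd-* {n} {1} (Bd-ev-line n (tail p) x b)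
      (Bd-+ (Bd-C x) (λ i l → ≡trans (C-⊡ b Z i) (≡trans (≡cong (b *_) (Bd-Z i l)) (F.zeroʳ b)))))))

  -- On the line x₀ + b Z a relation r² h = b s² becomes R² E = S² = R² σ², so R σ = ± S. If R were
  -- nonzero, `rational-sqrt` would make σ a polynomial of degree at most d, against the given
  -- nonzero coefficient.
  nonsquare-from-sqrt : ∀ {d} c h x₀ → Bd (suc (d +ℕ d)) h → let b = Id.ev (suc (d +ℕ d)) h x₀ in b ≢ 0# →
    ∀ i → sqrt (expansion (suc (d +ℕ d)) h x₀ b) (suc d +ℕ i) ≢ 0# → NonSquare c h b
  nonsquare-from-sqrt {d} c h x₀ Bd-h b≢0 i ne r s br bs e = r-zero , s-zero
    where
    b = Id.ev (suc (d +ℕ d)) h x₀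
    E σ β : Series
    E = expansion (suc (d +ℕ d)) h x₀ b
    σ = sqrt E
    β = line x₀ b
    cancelC : ∀ {p q} → C b ⊡ p ≋ C b ⊡ q → p ≋ q
    cancelC {p} {q} e j = cancel-≡ b≢0 (≡trans (≡sym (C-⊡ b p j)) (≡trans (e j) (C-⊡ b q j)))
    E0 : E 0 ≡ 1#
    E0 = ≡trans (≡cong (1# +_) (Z-⊡-zero (Ser.difference (suc (d +ℕ d)) h (C x₀) (C b ⊡ Z)))) (F.+-identityʳ 1#)
    square : σ ⊡ σ ≋ E
    square = sqrt-square E E0
    Bd-E : Bd (suc (d +ℕ d)) E
    Bd-E j l = cancelˡ b≢0 (≡trans (≡sym (C-⊡ b E j)) (≡trans (≡sym (ev-expansion (suc (d +ℕ d)) h x₀ j)) (Bd-ev-line (suc (d +ℕ d)) h x₀ b j l)))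
    R S : Series
    R = Ser.ev c r β
    S = Ser.ev c s β
    R²E : R ⊡ R ⊡ E ≋ S ⊡ S
    R²E = cancelC (R.begin
      C b ⊡ (R ⊡ R ⊡ E) R.≈⟨ I.rotate (C b) R E ⟩
      R ⊡ R ⊡ (C b ⊡ E) R.≈⟨ Val-ev (Val-* (Val-* Val-r Val-r) (Val-cong (ev-expansion (suc (d +ℕ d)) h x₀) (suc (d +ℕ d) , Bd-h , P.refl))) length-bound ⟨
      Ser.ev (c +ℕ c +ℕ suc (d +ℕ d)) (r ⊡ r ⊡ h) β R.≈⟨ Ser.ev-cong (c +ℕ c +ℕ suc (d +ℕ d)) e P.refl ⟩
      Ser.ev (c +ℕ c +ℕ suc (d +ℕ d)) (C b ⊡ (s ⊡ s)) β R.≈⟨ Val-ev (Val-* (Val-C b) (Val-* Val-s Val-s)) (Bd-cong e length-bound) ⟩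
      C b ⊡ (S ⊡ S) R.∎)
      where
      Val-r : Val β r R
      Val-r = c , br , P.refl
      Val-s : Val β s S
      Val-s = c , bs , P.refl
      length-bound : Bd (c +ℕ c +ℕ suc (d +ℕ d)) (r ⊡ r ⊡ h)
      length-bound = Bd-*′ {c +ℕ c} (Bd-*′ {c} br br) Bd-h
    no-root : ¬ Zero R → ∀ T → Bd c T → ¬ (R ⊡ σ ≋ T)
    no-root nR T bT eq = ne (rational-sqrt {d} square Bd-E c R T (Bd-mono (ℕₚ.n≤1+n c) (Bd-ev-line c r x₀ b))
      (Bd-mono (ℕₚ.≤-trans (ℕₚ.m≤m+n c d) (ℕₚ.n≤1+n _)) bT) nR eq i)
    product : (R ⊡ σ P.- S) ⊡ (R ⊡ σ ⊞ S) ≋ (λ _ → 0#)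
    product = P.trans (I.difference-of-squares (R ⊡ σ) S) (P.trans (P.+-congʳ { P.- (S ⊡ S)}
      (P.trans (I.square-of-product R σ) (P.trans (P.*-congˡ {R ⊡ R} square) R²E))) (P.-‿inverseʳ (S ⊡ S)))
    R-zero : ¬ ¬ Zero R
    R-zero nR = no-root nR S (Bd-ev-line c s x₀ b)
      (λ j → inverse-unique (Domain.stable domain-of-series (λ n → no-root nR (P.- S) (Bd-neg (Bd-ev-line c s x₀ b))
        (P.trans (I.minus-plus (R ⊡ σ) S) (P.trans (P.+-congʳ { P.- S} (Domain.cancel domain-of-series n product)) (P.+-identityˡ (P.- S))))) j))
    r-zero : Zero r
    r-zero = Domain.stable domain-of-series λ nr → R-zero λ z → nr
      (few-zeros c r br ((x₀ , c) ∷ []) ([] ∷ []) ((b , b≢0 , λ j _ → z j) ∷ []) (ℕₚ.≤-reflexive (≡sym (ℕₚ.+-identityʳ c))))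
    s-zero : Zero s
    s-zero = Domain.stable domain-of-series λ ns → *-nonzero-series ns ns
      (cancelC (P.trans (P.sym e) (P.trans (P.*-congʳ {h} (⊡-zeroˡ r r r-zero)) (P.trans (P.zeroˡ h) (P.sym (P.zeroʳ (C b)))))))

-- Slices f(x, t) and exceptional pairs of rows.

module SumTo (K : FiniteField) where
  open FiniteFieldFacts K
  open IntegerSolver KR

  sumTo-head : ∀ n g → sumTo K (suc n) g ≡ g 0 + sumTo K n (g ∘ suc)
  sumTo-head zero g = ≡refl
  sumTo-head (suc n) g = ≡trans (≡cong (_+ g (suc (suc n))) (sumTo-head n g)) (F.+-assoc _ _ _)

  sumTo-cong : ∀ n {g h : ℕ → Carrier} → (∀ i → g i ≡ h i) → sumTo K n g ≡ sumTo K n h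
  sumTo-cong zero e = e 0
  sumTo-cong (suc n) e = ≡cong₂ _+_ (sumTo-cong n e) (e (suc n))

  sumTo-scale : ∀ n c g → sumTo K n (λ i → c * g i) ≡ c * sumTo K n g
  sumTo-scale zero c g = ≡refl
  sumTo-scale (suc n) c g = ≡trans (≡cong (_+ c * g (suc n)) (sumTo-scale n c g)) (≡sym (F.distribˡ c _ _))

  sumTo-+ : ∀ n g h → sumTo K n (λ i → g i + h i) ≡ sumTo K n g + sumTo K n h
  sumTo-+ zero g h = ≡refl
  sumTo-+ (suc n) g h = ≡trans (≡cong (_+ (g (suc n) + h (suc n))) (sumTo-+ n g h))
    (solve 4 (λ a b c d → (a :+ b) :+ (c :+ d) := (a :+ c) :+ (b :+ d)) ≡refl _ _ _ _)

  sumTo-comm : ∀ m n (g : ℕ → ℕ → Carrier) → sumTo K m (λ a → sumTo K n (λ b → g a b)) ≡ sumTo K n (λ b → sumTo K m (λ a → g a b))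
  sumTo-comm zero n g = ≡refl
  sumTo-comm (suc m) n g = ≡trans (≡cong (_+ sumTo K n (g (suc m))) (sumTo-comm m n g)) (≡sym (sumTo-+ n _ _))

module Slices (K : FiniteField) (odd : OddPrimePower (FiniteField.size K))
              (f : Poly2 K) (d : ℕ) (degree : HasDegree K f d) where
  open SquareRoot K odd public
  open SeriesFacts K odd public
  open SumTo K
  open IntegerSolver KR
  open Relation.Binary.PropositionalEquality.≡-Reasoning

  Bd-coef : ∀ i → Bd (suc d) (coef f i)
  Bd-coef i j l = proj₂ degree i j (ℕₚ.≤-trans l (ℕₚ.m≤n+m j i))

  slice : Carrier → Series
  slice t i = Id.ev (suc d) (coef f i) t

  Bd-slice : ∀ t → Bd (suc d) (slice t)
  Bd-slice t i l = Id.ev-zero (suc d) t (λ j → proj₂ degree i j (ℕₚ.≤-trans l (ℕₚ.m≤m+n i j)))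

  value : Carrier → Carrier → Carrier
  value x t = Id.ev (suc d) (slice t) x

  private
    sumTo-ev : ∀ n p x → sumTo K n (λ i → p i * pow K x i) ≡ Id.ev (suc n) p x
    sumTo-ev zero p x = ≡trans (F.*-identityʳ (p 0)) (≡sym (≡trans (≡cong (p 0 +_) (F.zeroʳ x)) (F.+-identityʳ (p 0))))
    sumTo-ev (suc n) p x = begin
      sumTo K (suc n) (λ i → p i * pow K x i) ≡⟨ sumTo-head n (λ i → p i * pow K x i) ⟩
      p 0 * 1# + sumTo K n (λ i → p (suc i) * (x * pow K x i))
        ≡⟨ ≡cong₂ _+_ (F.*-identityʳ (p 0)) (sumTo-cong n (λ i → solve 3 (λ a x y → a :* (x :* y) := x :* (a :* y)) ≡refl (p (suc i)) x (pow K x i))) ⟩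
      p 0 + sumTo K n (λ i → x * (p (suc i) * pow K x i)) ≡⟨ ≡cong (p 0 +_) (sumTo-scale n x (λ i → p (suc i) * pow K x i)) ⟩
      p 0 + x * sumTo K n (λ i → p (suc i) * pow K x i) ≡⟨ ≡cong (λ v → p 0 + x * v) (sumTo-ev n (tail p) x) ⟩
      p 0 + x * Id.ev (suc n) (tail p) x ∎

    d≤bound : d ≤ bound f
    d≤bound with proj₁ degree
    ... | i , j , i+j≡d , nz = ℕₚ.≮⇒≥ λ l → nz (vanish f i j (≡subst (bound f <_) (≡sym i+j≡d) l))

  eval-value : ∀ x t → eval K f x t ≡ value x t
  eval-value x t = begin
    eval K f x t ≡⟨ sumTo-cong (bound f) (λ i → begin
      sumTo K (bound f) (λ j → coef f i j * pow K x i * pow K t j)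
        ≡⟨ sumTo-cong (bound f) (λ j → solve 3 (λ a x y → a :* x :* y := x :* (a :* y)) ≡refl (coef f i j) (pow K x i) (pow K t j)) ⟩
      sumTo K (bound f) (λ j → pow K x i * (coef f i j * pow K t j)) ≡⟨ sumTo-scale (bound f) (pow K x i) (λ j → coef f i j * pow K t j) ⟩
      pow K x i * sumTo K (bound f) (λ j → coef f i j * pow K t j)
        ≡⟨ ≡cong (pow K x i *_) (≡trans (sumTo-ev (bound f) (coef f i) t) (Id.ev-stable t (Bd-coef i) (s≤s d≤bound))) ⟩
      pow K x i * slice t i ≡⟨ F.*-comm _ _ ⟩
      slice t i * pow K x i ∎) ⟩
    sumTo K (bound f) (λ i → slice t i * pow K x i) ≡⟨ sumTo-ev (bound f) (slice t) x ⟩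
    Id.ev (suc (bound f)) (slice t) x ≡⟨ Id.ev-stable x (Bd-slice t) (s≤s d≤bound) ⟩
    value x t ∎

  find-nonzero : (g : Carrier → Carrier) → ¬ (∀ x → g x ≡ 0#) → ∃ λ x → g x ≢ 0#
  find-nonzero g n with Finₚ.¬∀⟶∃¬ size (λ i → g (elt K i) ≡ 0#) (λ i → g (elt K i) ≟ 0#)
                         (λ z → n (λ x → ≡subst (λ y → g y ≡ 0#) (elt-index x) (z (index x))))
  ... | i , ne = elt K i , ne

  nonzero-value : d < size → ∃ λ x → ∃ λ t → value x t ≢ 0#
  nonzero-value d<q with proj₁ degree
  ... | i , j , _ , nz with find-nonzero (λ t → slice t i) (λ z → nz (vanishing-everywhere (suc d) (coef f i) (Bd-coef i) d<q z j))
  ... | t , ne with find-nonzero (λ x → value x t) (λ z → ne (vanishing-everywhere (suc d) (slice t) (Bd-slice t) d<q z i))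
  ... | x , ne′ = x , t , ne′

  Pol-slice : ∀ i → Pol d (λ t → slice t i)
  Pol-slice i = coef f i , Bd-coef i , λ t → ≡refl

  Pol-ev : ∀ {D} n {p : Carrier → Series} x → (∀ i → Pol D (λ t → p t i)) → Pol D (λ t → Id.ev n (p t) x)
  Pol-ev zero x a = Pol-const 0#
  Pol-ev (suc n) x a = Pol-+ (a 0) (Pol-* {0} (Pol-const x) (Pol-ev n x (λ i → a (suc i))))

  Pol-value : ∀ x → Pol d (value x)
  Pol-value x = Pol-ev (suc d) x Pol-slice

  -- b ^ n p (y / b) for a polynomial p of degree at most n.
  homogenised : ℕ → Series → Carrier → Carrier → Carrier
  homogenised zero p y b = p 0
  homogenised (suc n) p y b = p 0 * b ^ suc n + y * homogenised n (tail p) y b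

  homogenised-ev : ∀ n p z b → homogenised n p (b * z) b ≡ b ^ n * Id.ev (suc n) p z
  homogenised-ev zero p z b = ≡sym (≡trans (F.*-identityˡ _) (≡trans (≡cong (p 0 +_) (F.zeroʳ z)) (F.+-identityʳ _)))
  homogenised-ev (suc n) p z b = ≡trans (≡cong (λ v → p 0 * (b * b ^ n) + b * z * v) (homogenised-ev n (tail p) z b))
    (solve 5 (λ a b c z e → a :* (b :* c) :+ b :* z :* (c :* e) := b :* c :* (a :+ z :* e)) ≡refl (p 0) b (b ^ n) z _)

  ev-ev-line : ∀ n p x b z → Id.ev n (Ser.ev n p (line x b)) z ≡ Id.ev n p (x + b * z)
  ev-ev-line zero p x b z = ≡refl
  ev-ev-line (suc n) p x b z = begin
    Id.ev (suc n) (C (p 0) ⊞ line x b ⊡ q) z ≡⟨ Id.ev-+ (suc n) (C (p 0)) (line x b ⊡ q) z ⟩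
    Id.ev (suc n) (C (p 0)) z + Id.ev (suc n) (line x b ⊡ q) z
      ≡⟨ ≡cong₂ _+_ (Id.ev-C n (p 0) z) (≡trans (Id.ev-unique z Bd-product (Bd-*′ {2} Bd-line (Bd-ev-line n (tail p) x b)) (λ _ → ≡refl))
           (≡trans (Id.ev-* {2} z Bd-line (Bd-ev-line n (tail p) x b)) (≡cong₂ _*_ ev-line-z (ev-ev-line n (tail p) x b z)))) ⟩
    p 0 + (x + b * z) * Id.ev n (tail p) (x + b * z) ∎
    where
    q = Ser.ev n (tail p) (line x b)
    Bd-line : Bd 2 (line x b)
    Bd-line = Bd-+ (Bd-C x) (λ i l → ≡trans (C-⊡ b Z i) (≡trans (≡cong (b *_) (Bd-Z i l)) (F.zeroʳ b)))
    Bd-product : Bd (suc n) (line x b ⊡ q)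
    Bd-product = Bd-cong (P.*-comm q (line x b)) (≡subst (λ m → Bd m (q ⊡ line x b)) (ℕₚ.+-comm n 1) (Bd-* {n} {1} (Bd-ev-line n (tail p) x b) Bd-line))
    ev-line-z : Id.ev 2 (line x b) z ≡ x + b * z
    ev-line-z = ≡trans (Id.ev-+ 2 (C x) (C b ⊡ Z) z) (≡cong₂ _+_ (Id.ev-C 1 x z)
      (≡trans (Id.ev-cong 2 (C-⊡ b Z) ≡refl) (≡trans (Id.ev-scale 2 b Z z) (≡cong (b *_) (Id.ev-Z 0 z)))))

  ev-low : ∀ n p z → Id.ev n (low n p) z ≡ Id.ev n p z
  ev-low zero p z = ≡refl
  ev-low (suc n) p z = ≡cong (λ v → p 0 + z * v) (ev-low n (tail p) z)

  module Pairs (x₀ t₀ : Carrier) where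
    h : Carrier → Series
    h t = slice t₀ ⊡ slice t

    Bd-h : ∀ t → Bd (suc (d +ℕ d)) (h t)
    Bd-h t = Bd-* {suc d} {d} (Bd-slice t₀) (Bd-slice t)

    ev-h : ∀ x t → Id.ev (suc (d +ℕ d)) (h t) x ≡ value x t₀ * value x t
    ev-h x t = ≡trans (Id.ev-unique x (Bd-h t) (Bd-*′ {suc d} (Bd-slice t₀) (Bd-slice t)) (λ _ → ≡refl))
      (Id.ev-* {suc d} x (Bd-slice t₀) (Bd-slice t))

    b : Carrier → Carrier
    b t = Id.ev (suc (d +ℕ d)) (h t) x₀

    Pol-h : ∀ i → Pol d (λ t → h t i)
    Pol-h i = Pol-mono (ℕₚ.≤-reflexive (≡trans (≡cong (d +ℕ_) (ℕₚ.*-zeroʳ i)) (ℕₚ.+-identityʳ d)))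
      (PolS-* {0} {0} {d} {λ _ → slice t₀} {slice} (λ k → Pol-const (slice t₀ k)) (λ k → Pol-mono (ℕₚ.m≤m+n d _) (Pol-slice k)) i)

    Pol-b : Pol d b
    Pol-b = Pol-ev (suc (d +ℕ d)) x₀ Pol-h

    E σ : Carrier → Series
    E t = expansion (suc (d +ℕ d)) (h t) x₀ (b t)
    σ t = sqrt (E t)

    PolS-σ : PolS d 0 σ
    PolS-σ = PolS-sqrt (Family.PolS-expansion {d} {0} {d} (Pol-const x₀) Pol-b (d +ℕ d) Pol-h
      (ℕₚ.≤-reflexive (≡trans (≡cong (d +ℕ_) (ℕₚ.*-zeroʳ (d +ℕ d))) (ℕₚ.+-identityʳ d))))

    -- Testing only the coefficients of Z^(d+1), ..., Z^(2d) keeps the condition decidable. For b(t)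
    -- ≠ 0 it suffices: E has length at most 2 d + 1, so if these coefficients vanish, the
    -- truncation of σ at degree d squares to E.
    polynomial-root? : ∀ t → Dec (∀ (j : Fin d) → σ t (suc d +ℕ Fin.toℕ j) ≡ 0#)
    polynomial-root? t = Finₚ.all? (λ j → σ t (suc d +ℕ Fin.toℕ j) ≟ 0#)

    bad : Fin size → Bool
    bad i = does (polynomial-root? (elt K i))

    nonsquare : ∀ c i → bad i ≡ false → b (elt K i) ≢ 0# → NonSquare c (h (elt K i)) (b (elt K i))
    nonsquare c i e b≢0 = from-witness
      (Finₚ.¬∀⟶∃¬ d (λ j → σ (elt K i) (suc d +ℕ Fin.toℕ j) ≡ 0#) (λ j → σ (elt K i) (suc d +ℕ Fin.toℕ j) ≟ 0#)
        (refute (polynomial-root? (elt K i)) e))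
      where
      from-witness : (∃ λ j → σ (elt K i) (suc d +ℕ Fin.toℕ {d} j) ≢ 0#) → NonSquare c (h (elt K i)) (b (elt K i))
      from-witness (j , ne) = nonsquare-from-sqrt {d} c (h (elt K i)) x₀ (Bd-h (elt K i)) b≢0 (Fin.toℕ j) ne

    -- The coefficient of Z^k in σ has degree at most k d in t, and k ≤ 2 d here, so more than 2 d²
    -- zeros make it vanish identically.
    all-bad : (d +ℕ d) *ℕ d < count K bad → ∀ t j → j < d → σ t (suc d +ℕ j) ≡ 0#
    all-bad many t j j<d = Pol-zero (Pol-mono (ℕₚ.*-monoˡ-≤ d (≡subst (_≤ d +ℕ d) (ℕₚ.+-suc d j) (ℕₚ.+-monoʳ-≤ d j<d))) (PolS-σ (suc d +ℕ j)))
      bad root many t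
      where
      root : ∀ i → bad i ≡ true → σ (elt K i) (suc d +ℕ j) ≡ 0#
      root i e = ≡subst (λ k → σ (elt K i) (suc d +ℕ k) ≡ 0#) (Finₚ.toℕ-fromℕ< j<d) (affirm (polynomial-root? (elt K i)) e (Fin.fromℕ< j<d))

    -- In the exceptional case h(x) = b p(z)² with z = (x - x₀) / b. Multiplying by b^(2d+1) clears
    -- the denominators of p(z)² and completes the odd factor b to a square, namely the square of
    -- b^(d+1) p(z).
    weight : Carrier → Carrier
    weight t = b t * (b t ^ d * b t ^ d)

    root : Carrier → Carrier → Carrier
    root x t = b t * homogenised d (σ t) (x - x₀) (b t)

    weighted-square : (∀ t j → j < d → σ t (suc d +ℕ j) ≡ 0#) → ∀ x t →
      value x t₀ * weight t * value x t ≡ root x t * root x t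
    weighted-square vanish x t = by-cases (b t ≟ 0#) degenerate generic
      where
      -- Where b(t) = 0 the expansion at x₀ carries no information. The outer factors b in `weight`
      -- and `root` make both sides vanish.
      degenerate : b t ≡ 0# → value x t₀ * weight t * value x t ≡ root x t * root x t
      degenerate e = ≡trans (≡cong (λ w → value x t₀ * w * value x t) (≡trans (≡cong (_* (b t ^ d * b t ^ d)) e) (F.zeroˡ _)))
        (≡trans (≡trans (≡cong (_* value x t) (F.zeroʳ _)) (F.zeroˡ _))
          (≡sym (≡trans (≡cong (_* root x t) (≡trans (≡cong (_* homogenised d (σ t) (x - x₀) (b t)) e) (F.zeroˡ _))) (F.zeroˡ _))))
      generic : b t ≢ 0# → value x t₀ * weight t * value x t ≡ root x t * root x t
      generic b≢0 = begin
        value x t₀ * weight t * value x t ≡⟨ solve 4 (λ v b c w → v :* (b :* (c :* c)) :* w := b :* (c :* c) :* (v :* w)) ≡refl (value x t₀) (b t) (b t ^ d) (value x t) ⟩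
        weight t * (value x t₀ * value x t) ≡⟨ ≡cong (weight t *_) (≡trans (≡sym (ev-h x t)) (≡trans (≡cong (Id.ev (suc (d +ℕ d)) (h t)) x≡) on-line)) ⟩
        weight t * (b t * (u * u)) ≡⟨ solve 3 (λ b c u → b :* (c :* c) :* (b :* (u :* u)) := (b :* (c :* u)) :* (b :* (c :* u))) ≡refl (b t) (b t ^ d) u ⟩
        (b t * (b t ^ d * u)) * (b t * (b t ^ d * u)) ≡⟨ ≡cong (λ v → (b t * v) * (b t * v)) (≡sym scaled) ⟩
        root x t * root x t ∎
        where
        b⁻¹ = b t ⁻¹⟨ b≢0 ⟩
        z = b⁻¹ * (x - x₀)
        bz≡ : b t * z ≡ x - x₀
        bz≡ = ≡trans (≡sym (F.*-assoc _ _ _)) (≡trans (≡cong (_* (x - x₀)) (proj₂ (inverse (b t) b≢0))) (F.*-identityˡ _))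
        x≡ : x ≡ x₀ + b t * z
        x≡ = ≡trans (solve 2 (λ x y → x := y :+ (x :- y)) ≡refl x x₀) (≡cong (x₀ +_) (≡sym bz≡))
        p u : _
        p = low (suc d) (σ t)
        u = Id.ev (suc d) (σ t) z
        scaled : homogenised d (σ t) (x - x₀) (b t) ≡ b t ^ d * u
        scaled = ≡trans (≡cong (λ y → homogenised d (σ t) y (b t)) (≡sym bz≡)) (homogenised-ev d (σ t) z (b t))
        Bd-E : Bd (suc (d +ℕ d)) (E t)
        Bd-E j l = cancelˡ b≢0 (≡trans (≡sym (C-⊡ (b t) (E t) j))
          (≡trans (≡sym (ev-expansion (suc (d +ℕ d)) (h t) x₀ j)) (Bd-ev-line (suc (d +ℕ d)) (h t) x₀ (b t) j l)))
        E0 : E t 0 ≡ 1#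
        E0 = ≡trans (≡cong (1# +_) (Z-⊡-zero (Ser.difference (suc (d +ℕ d)) (h t) (C x₀) (C (b t) ⊡ Z)))) (F.+-identityʳ 1#)
        p≈σ : p ≡[ suc (d +ℕ d) ] σ t
        p≈σ i l = by-cases (suc d ℕₚ.≤? i)
          (λ y → high y (ℕₚ.m≤n⇒∃[o]m+o≡n y))
          (λ n → low-agrees (suc d) (σ t) i (ℕₚ.≰⇒> n))
          where
          high : suc d ≤ i → (∃ λ j → suc d +ℕ j ≡ i) → p i ≡ σ t i
          high y (j , e) = ≡trans (Bd-low (suc d) (σ t) i y)
            (≡sym (≡trans (≡cong (σ t) (≡sym e)) (vanish t j (ℕₚ.+-cancelˡ-< d j d (ℕₚ.≤-pred (≡subst (_< suc (d +ℕ d)) (≡sym e) l))))))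
        E≋p² : E t ≋ p ⊡ p
        E≋p² i = by-cases (suc (d +ℕ d) ℕₚ.≤? i)
          (λ y → ≡trans (Bd-E i y) (≡sym (Bd-* {suc d} {d} (Bd-low (suc d) (σ t)) (Bd-low (suc d) (σ t)) i y)))
          (λ n → ≡trans (≡sym (sqrt-square (E t) E0 i))
            (≡sym (trunc-* (suc (d +ℕ d)) {p} {σ t} {p} {σ t} p≈σ p≈σ i (ℕₚ.≰⇒> n))))
        on-line : Id.ev (suc (d +ℕ d)) (h t) (x₀ + b t * z) ≡ b t * (u * u)
        on-line = begin
          Id.ev (suc (d +ℕ d)) (h t) (x₀ + b t * z) ≡⟨ ev-ev-line (suc (d +ℕ d)) (h t) x₀ (b t) z ⟨
          Id.ev (suc (d +ℕ d)) (Ser.ev (suc (d +ℕ d)) (h t) (line x₀ (b t))) z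
            ≡⟨ Id.ev-cong (suc (d +ℕ d)) {q = λ i → b t * (p ⊡ p) i} (λ i → ≡trans (ev-expansion (suc (d +ℕ d)) (h t) x₀ i)
                 (≡trans (C-⊡ (b t) (E t) i) (≡cong (b t *_) (E≋p² i)))) ≡refl ⟩
          Id.ev (suc (d +ℕ d)) (λ i → b t * (p ⊡ p) i) z ≡⟨ Id.ev-scale (suc (d +ℕ d)) (b t) (p ⊡ p) z ⟩
          b t * Id.ev (suc (d +ℕ d)) (p ⊡ p) z
            ≡⟨ ≡cong (b t *_) (≡trans (Id.ev-unique z (Bd-* {suc d} {d} (Bd-low (suc d) (σ t)) (Bd-low (suc d) (σ t)))
                                          (Bd-*′ {suc d} (Bd-low (suc d) (σ t)) (Bd-low (suc d) (σ t))) (λ _ → ≡refl))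
                 (≡trans (Id.ev-* {suc d} z (Bd-low (suc d) (σ t)) (Bd-low (suc d) (σ t))) (≡cong₂ _*_ (ev-low (suc d) (σ t) z) (ev-low (suc d) (σ t) z)))) ⟩
          b t * (u * u) ∎

-- Polynomials in two variables and the identity A(y) B(x) f = U².

-- K[[y]][[x]]: the coefficient of x ^ i y ^ j of V is V i j.
module TwoVariables (K : FiniteField) where
  open FiniteFieldFacts K
  open PolynomialFunctions K
  private module P = CommutativeRing PR
  module X = PowerSeries PR
  XR : CommutativeRing 0ℓ 0ℓ
  XR = PowerSeries.ring-of-series PR

  Bounded : ℕ → X.Series → Set
  Bounded D V = X.Bd D V × (∀ i → Bd D (V i))

  at-y : ℕ → X.Series → Carrier → Series
  at-y D V t i = Id.ev D (V i) t

  Bd-at-y : ∀ {D} E {V : X.Series} t → X.Bd D V → Bd D (at-y E V t)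
  Bd-at-y E t b i l = Id.ev-zero E t (b i l)

  Pol2 : ℕ → (Carrier → Carrier → Carrier) → Set
  Pol2 D φ = Σ X.Series λ V → Bounded D V × ∀ x t → Id.ev D (at-y D V t) x ≡ φ x t

  Bounded-mono : ∀ {D E V} → D ≤ E → Bounded D V → Bounded E V
  Bounded-mono l (b , c) = X.Bd-mono l b , λ i → Bd-mono l (c i)

  Pol2-mono : ∀ {D E φ} → D ≤ E → Pol2 D φ → Pol2 E φ
  Pol2-mono {D} {E} l (V , b , e) = V , Bounded-mono l b , λ x t →
    ≡trans (Id.ev-stable x (Bd-at-y E t (proj₁ b)) l)
      (≡trans (Id.ev-cong D (λ i → Id.ev-stable t (proj₂ b i) l) ≡refl) (e x t))

  Pol2-x : ∀ {D φ} → Pol D φ → Pol2 (suc D) (λ x t → φ x)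
  Pol2-x {D} (p , b , e) = (λ i → C (p i)) , ((λ i l → P.trans (C-cong (b i l)) C-0) , λ i → Bd-C (p i)) , λ x t →
    ≡trans (Id.ev-cong (suc D) (λ i → Id.ev-C D (p i) t) ≡refl) (e x)

  Pol2-y : ∀ {D φ} → Pol D φ → Pol2 (suc D) (λ x t → φ t)
  Pol2-y {D} (p , b , e) = X.C p , (X.Bd-C p , (λ { zero → b ; (suc i) → λ _ _ → ≡refl })) , λ x t →
    ≡trans (Id.ev-cong (suc D) {at-y (suc D) (X.C p) t} {C (Id.ev (suc D) p t)} (λ { zero → ≡refl ; (suc i) → Id.ev-zero (suc D) t (λ _ → ≡refl) }) ≡refl)
      (≡trans (Id.ev-C D (Id.ev (suc D) p t) x) (e t))

  Pol2-+ : ∀ {D φ ψ} → Pol2 D φ → Pol2 D ψ → Pol2 D (λ x t → φ x t + ψ x t)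
  Pol2-+ {D} (V , (b , c) , e) (W , (b′ , c′) , e′) = V X.⊞ W , (X.Bd-+ b b′ , λ i → Bd-+ (c i) (c′ i)) , λ x t →
    ≡trans (Id.ev-cong D (λ i → Id.ev-+ D (V i) (W i) t) ≡refl)
      (≡trans (Id.ev-+ D (at-y D V t) (at-y D W t) x) (≡cong₂ _+_ (e x t) (e′ x t)))

  Bd-⊡ : ∀ {D E} V W → (∀ i → Bd D (V i)) → (∀ i → Bd E (W i)) → ∀ i → Bd (D +ℕ E) ((V X.⊡ W) i)
  Bd-⊡ {D} V W b c zero = Bd-*′ {D} (b 0) (c 0)
  Bd-⊡ {D} V W b c (suc i) = Bd-+ (Bd-*′ {D} (b 0) (c (suc i))) (Bd-⊡ (X.tail V) W (λ i → b (suc i)) c i)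

  at-y-* : ∀ {D E} V W t → (∀ i → Bd D (V i)) → (∀ i → Bd E (W i)) → at-y (D +ℕ E) (V X.⊡ W) t ≋ at-y D V t ⊡ at-y E W t
  at-y-* {D} V W t b c zero = Id.ev-* {D} t (b 0) (c 0)
  at-y-* {D} {E} V W t b c (suc i) = ≡trans (Id.ev-+ (D +ℕ E) (V 0 ⊡ W (suc i)) ((X.tail V X.⊡ W) i) t)
    (≡cong₂ _+_ (Id.ev-* {D} t (b 0) (c (suc i))) (at-y-* (X.tail V) W t (λ i → b (suc i)) c i))

  Pol2-* : ∀ {D E φ ψ} → Pol2 D φ → Pol2 E ψ → Pol2 (D +ℕ E) (λ x t → φ x t * ψ x t)
  Pol2-* {D} {E} (V , (b , c) , e) (W , (b′ , c′) , e′) = V X.⊡ W , (X.Bd-*′ {D} b b′ , Bd-⊡ V W c c′) , λ x t →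
    ≡trans (Id.ev-cong (D +ℕ E) (at-y-* V W t c c′) ≡refl)
      (≡trans (Id.ev-* {D} x (Bd-at-y D t b) (Bd-at-y E t b′)) (≡cong₂ _*_ (e x t) (e′ x t)))

  equal-values : ∀ n p q → Bd n p → Bd n q → n ≤ size → (∀ x → Id.ev n p x ≡ Id.ev n q x) → p ≋ q
  equal-values n p q b c l e i = inverse-unique (vanishing-everywhere n (λ i → p i - q i) (Bd-+ b (Bd-neg c)) l
    (λ x → ≡trans (Id.ev-+ n p (λ i → - q i) x) (≡trans (≡cong (Id.ev n p x +_) (ev-neg n q x))
      (≡trans (≡cong (_- Id.ev n q x) (e x)) (F.-‿inverseʳ _)))) i)
    where
    ev-neg : ∀ n q x → Id.ev n (λ i → - q i) x ≡ - Id.ev n q x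
    ev-neg n q x = ≡trans (Id.ev-cong n {q = λ i → (- 1#) * q i} (λ i → ≡sym (-1*x≈-x (q i))) ≡refl)
      (≡trans (Id.ev-scale n (- 1#) q x) (-1*x≈-x _))
      where open Algebra.Properties.Ring F.ring using (-1*x≈-x)

  -- Coefficients are recovered from values in one variable at a time, which works only for lengths
  -- up to q. This is one source of the lower bound on q in the main case.
  Pol2-unique : ∀ {D φ ψ} → D ≤ size → (a : Pol2 D φ) (b : Pol2 D ψ) → (∀ x t → φ x t ≡ ψ x t) → proj₁ a X.≋ proj₁ b
  Pol2-unique {D} l (V , (b , c) , e) (W , (b′ , c′) , e′) same i =
    equal-values D (V i) (W i) (c i) (c′ i) l λ t →
      equal-values D (at-y D V t) (at-y D W t) (Bd-at-y D t b) (Bd-at-y D t b′) l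
        (λ x → ≡trans (e x t) (≡trans (same x t) (≡sym (e′ x t)))) i

-- Length sufficient for the coefficients of the identity weighted-square.
identity-length : ℕ → ℕ
identity-length d = (root-length +ℕ root-length) +ℕ (suc d +ℕ weight-length +ℕ suc d)
  module IdentityLength where
  term-length : ℕ
  term-length = suc (d *ℕ d) +ℕ suc (d *ℕ d)
  homogenised-length : ℕ → ℕ
  homogenised-length zero = term-length
  homogenised-length (suc n) = term-length +ℕ (2 +ℕ homogenised-length n)
  root-length weight-length : ℕ
  root-length = suc d +ℕ homogenised-length d
  weight-length = suc (d +ℕ (d *ℕ d +ℕ d *ℕ d))

module SquareIdentity (K : FiniteField) (odd : OddPrimePower (FiniteField.size K))
              (f : Poly2 K) (d : ℕ) (degree : HasDegree K f d) (x₀ t₀ : FiniteField.Carrier K) where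
  open Slices K odd f d degree
  open TwoVariables K public
  open Pairs x₀ t₀
  open IdentityLength d

  private
    Pol-^ : ∀ {D φ} → Pol D φ → ∀ k → Pol (k *ℕ D) (λ x → φ x ^ k)
    Pol-^ p zero = Pol-const 1#
    Pol-^ p (suc k) = Pol-* p (Pol-^ p k)

    b^ : ∀ k → k ≤ d → Pol2 (suc (d *ℕ d)) (λ x t → b t ^ k)
    b^ k l = Pol2-y (Pol-mono (ℕₚ.*-monoˡ-≤ d l) (Pol-^ Pol-b k))

    Pol2-homogenised : ∀ n (p : Carrier → Series) → n ≤ d → (∀ i → i ≤ n → Pol (d *ℕ d) (λ t → p t i)) →
      Pol2 (homogenised-length n) (λ x t → homogenised n (p t) (x - x₀) (b t))
    Pol2-homogenised zero p l q = Pol2-mono (ℕₚ.m≤m+n _ _) (Pol2-y (q 0 z≤n))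
    Pol2-homogenised (suc n) p l q = Pol2-+
      (Pol2-mono (ℕₚ.m≤m+n term-length _) (Pol2-* (Pol2-y (q 0 z≤n)) (b^ (suc n) l)))
      (Pol2-mono (ℕₚ.m≤n+m _ term-length) (Pol2-* (Pol2-x (Pol-+ Pol-id (Pol-const (- x₀))))
        (Pol2-homogenised n (λ t → tail (p t)) (ℕₚ.≤-trans (ℕₚ.n≤1+n n) l) (λ i i≤n → q (suc i) (s≤s i≤n)))))

    Pol2-root : Pol2 root-length root
    Pol2-root = Pol2-* (Pol2-y Pol-b) (Pol2-homogenised d σ ℕₚ.≤-refl (λ i l → Pol-mono (ℕₚ.*-monoˡ-≤ d l) (PolS-σ i)))

    Pol2-weight : Pol2 weight-length (λ x t → weight t)
    Pol2-weight = Pol2-y (Pol-* Pol-b (Pol-* (Pol-^ Pol-b d) (Pol-^ Pol-b d)))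

    Pol2-slice : Pol2 (suc d) (λ x t → value x t₀)
    Pol2-slice = Pol2-x (slice t₀ , Bd-slice t₀ , λ x → ≡refl)

    Pol2-value : Pol2 (suc d) value
    Pol2-value = coef f , ((λ i l j → proj₂ degree i j (ℕₚ.≤-trans l (ℕₚ.m≤m+n i j))) , Bd-coef) , λ x t → ≡refl

  -- A is the polynomial of `weight` and B is the slice at t₀; the single condition b(t₁) ≠ 0 shows
  -- that neither is zero.
  square-identity : identity-length d ≤ size → (∀ t j → j < d → σ t (suc d +ℕ j) ≡ 0#) → ∀ t₁ → b t₁ ≢ 0# →
    ∃ λ D → ∃₂ λ A B → ∃ λ U → Bd D A × Bd D B × Bounded D U × ¬ Zero A × ¬ Zero B ×
      ((λ i → C (B i)) X.⊡ X.C A) X.⊡ coef f X.≋ U X.⊡ U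
  square-identity l vanish t₁ b≢0 = identity-length d , A , slice t₀ , proj₁ Pol2-root ,
    Bd-mono weight≤ Bd-A , Bd-mono (slice≤) (Bd-slice t₀) , Bounded-mono root≤ (proj₁ (proj₂ Pol2-root)) ,
    (λ z → weight≢0 (≡trans (≡sym (proj₂ (proj₂ weight-pol) t₁)) (Id.ev-zero (suc (d +ℕ (d *ℕ d +ℕ d *ℕ d))) t₁ z))) ,
    (λ z → b≢0 (≡trans (ev-h x₀ t₁) (≡trans (≡cong (_* value x₀ t₁) (Id.ev-zero (suc d) x₀ z)) (F.zeroˡ _)))) ,
    Pol2-unique l
      (Pol2-mono (ℕₚ.m≤n+m _ (root-length +ℕ root-length)) (Pol2-* (Pol2-* Pol2-slice Pol2-weight) Pol2-value))
      (Pol2-mono (ℕₚ.m≤m+n (root-length +ℕ root-length) _) (Pol2-* Pol2-root Pol2-root))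
      (weighted-square vanish)
    where
    weight-pol : Pol (d +ℕ (d *ℕ d +ℕ d *ℕ d)) weight
    weight-pol = Pol-* Pol-b (Pol-* (Pol-^ Pol-b d) (Pol-^ Pol-b d))
    A = proj₁ weight-pol
    Bd-A : Bd weight-length A
    Bd-A = proj₁ (proj₂ weight-pol)
    ^≢0 : ∀ k → b t₁ ^ k ≢ 0#
    ^≢0 zero e = 0≢1 (≡sym e)
    ^≢0 (suc k) = *-nonzero b≢0 (^≢0 k)
    weight≢0 : weight t₁ ≢ 0#
    weight≢0 = *-nonzero b≢0 (*-nonzero (^≢0 d) (^≢0 d))
    weight≤ : weight-length ≤ identity-length d
    weight≤ = ℕₚ.≤-trans (ℕₚ.≤-trans (ℕₚ.m≤n+m weight-length (suc d)) (ℕₚ.m≤m+n _ (suc d))) (ℕₚ.m≤n+m _ (root-length +ℕ root-length))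
    slice≤ : suc d ≤ identity-length d
    slice≤ = ℕₚ.≤-trans (ℕₚ.m≤n+m (suc d) (suc d +ℕ weight-length)) (ℕₚ.m≤n+m _ (root-length +ℕ root-length))
    root≤ : root-length ≤ identity-length d
    root≤ = ℕₚ.≤-trans (ℕₚ.m≤m+n root-length root-length) (ℕₚ.m≤m+n _ _)

-- Division, irreducible factors and Gauss's lemma.

module PolynomialArithmetic (K : FiniteField) where
  open FiniteFieldFacts K public
  open SeriesDomain KR domain public
  module P = CommutativeRing PR
  private module I = Identities PR

  Zero : Series → Set
  Zero p = p ≋ (λ _ → 0#)

  Polynomial : Series → Set
  Polynomial p = ∃ λ n → Bd n p

  Nonconst : Series → Set
  Nonconst p = ∃ λ i → p (suc i) ≢ 0#

  infix 4 _∣_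
  _∣_ : Series → Series → Set
  p ∣ v = ∃ λ q → Polynomial q × v ≋ p ⊡ q

  Polynomial-* : ∀ {p q} → Polynomial p → Polynomial q → Polynomial (p ⊡ q)
  Polynomial-* (m , b) (n , c) = m +ℕ n , Bd-*′ {m} b c

  Polynomial-+ : ∀ {p q} → Polynomial p → Polynomial q → Polynomial (p ⊞ q)
  Polynomial-+ (m , b) (n , c) = m +ℕ n , Bd-+ (Bd-mono (ℕₚ.m≤m+n m n) b) (Bd-mono (ℕₚ.m≤n+m n m) c)

  Polynomial-- : ∀ {p q} → Polynomial p → Polynomial q → Polynomial (p P.- q)
  Polynomial-- a (n , c) = Polynomial-+ a (n , Bd-neg c)

  ∣-cong : ∀ {p v w} → v ≋ w → p ∣ v → p ∣ w
  ∣-cong e (q , b , f) = q , b , P.trans (P.sym e) f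

  ∣-0 : ∀ {p v} → Zero v → p ∣ v
  ∣-0 {p} z = (λ _ → 0#) , (0 , λ _ _ → ≡refl) , P.trans z (P.sym (P.zeroʳ p))

  ∣-minus : ∀ {p v w} → p ∣ v → p ∣ w → p ∣ (v P.- w)
  ∣-minus {p} (q , b , e) (r , c , f) = q P.- r , Polynomial-- b c ,
    P.trans (P.+-cong e (P.-‿cong f)) (P.sym (I.*-distrib-minus p q r))

  ∣-* : ∀ {p v} w → Polynomial w → p ∣ v → p ∣ v ⊡ w
  ∣-* {p} w b (q , c , e) = q ⊡ w , Polynomial-* c b , P.trans (P.*-congʳ {w} e) (P.*-assoc p q w)

  ∣-*ʳ : ∀ {p v} w → Polynomial w → p ∣ v → p ∣ w ⊡ v
  ∣-*ʳ {p} {v} w b d = ∣-cong (P.*-comm v w) (∣-* w b d)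

  ∣-trans : ∀ {p q v} → p ∣ q → q ∣ v → p ∣ v
  ∣-trans {p} {q} {v} (r , b , e) (s , c , f) = r ⊡ s , Polynomial-* b c ,
    P.trans f (P.trans (P.*-congʳ {s} e) (P.*-assoc p r s))

  Degree : ℕ → Series → Set
  Degree e p = p e ≢ 0# × Bd (suc e) p

  top-coefficient : ∀ e f p q → Bd (suc e) p → Bd (suc f) q → (p ⊡ q) (e +ℕ f) ≡ p e * q f
  top-coefficient zero zero p q b c = ≡refl
  top-coefficient zero (suc f) p q b c = ≡trans (≡cong (p 0 * q (suc f) +_) (⊡-zeroˡ (tail p) q (λ i → b (suc i) (s≤s z≤n)) f)) (F.+-identityʳ _)
  top-coefficient (suc e) f p q b c =
    ≡trans (≡cong₂ _+_ (≡trans (≡cong (p 0 *_) (c (suc (e +ℕ f)) (s≤s (ℕₚ.m≤n+m f e)))) (F.zeroʳ _))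
                       (top-coefficient e f (tail p) q (Bd-tail b) c)) (F.+-identityˡ _)

  degree-of : ∀ n p → Bd n p → ∀ i → p i ≢ 0# → ∃ λ e → i ≤ e × e < n × Degree e p
  degree-of zero p b i ne = ⊥-elim (ne (b i z≤n))
  degree-of (suc n) p b i ne = by-cases (p n ≟ 0#)
    (λ e → lift (degree-of n p (λ j l → low e j (ℕₚ.m≤n⇒m<n∨m≡n l)) i ne))
    (λ nz → n , ℕₚ.≤-pred (ℕₚ.≰⇒> (λ l → ne (b i l))) , ℕₚ.≤-refl , nz , b)
    where
    low : p n ≡ 0# → ∀ j → n < j ⊎ n ≡ j → p j ≡ 0#
    low e j (inj₁ l) = b j l
    low e j (inj₂ ≡refl) = e
    lift : (∃ λ e → i ≤ e × e < n × Degree e p) → ∃ λ e → i ≤ e × e < suc n × Degree e p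
    lift (e , l , l′ , dg) = e , l , ℕₚ.m≤n⇒m≤1+n l′ , dg

  factor-degree : ∀ {e b a n} → Degree e b → Polynomial a → Bd n (b ⊡ a) → ∀ i → a i ≢ 0# → e +ℕ i < n
  factor-degree {e} {b} {a} {n} (be , bb) (m , c) bd i ne = from (degree-of m a c i ne)
    where
    from : (∃ λ f → i ≤ f × f < m × Degree f a) → e +ℕ i < n
    from (f , i≤f , _ , af , ba) = ℕₚ.≤-<-trans (ℕₚ.+-monoʳ-≤ e i≤f)
      (ℕₚ.≰⇒> λ l → *-nonzero be af (≡trans (≡sym (top-coefficient e f b a bb ba)) (bd (e +ℕ f) l)))

  Bd-factor : ∀ {e b a n} → Degree (suc e) b → Polynomial a → Bd (suc n) (b ⊡ a) → Bd n a
  Bd-factor {e} {b} {a} {n} dg pa bd i l = decidable-stable (a i ≟ 0#) λ ne →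
    ℕₚ.<⇒≱ (factor-degree dg pa bd i ne) (ℕₚ.≤-trans (s≤s l) (s≤s (ℕₚ.m≤n+m i e)))

  term : ℕ → Carrier → Series
  term zero c = C c
  term (suc k) c = constant 0# (term k c)

  Bd-term : ∀ k c → Bd (suc k) (term k c)
  Bd-term zero c = Bd-C c
  Bd-term (suc k) c (suc i) (s≤s l) = Bd-term k c i l

  term-at : ∀ k c → term k c k ≡ c
  term-at zero c = ≡refl
  term-at (suc k) c = term-at k c

  Division : Series → ℕ → Series → Set
  Division b e a = ∃ λ q → ∃ λ r → Polynomial q × Bd e r × a ≋ b ⊡ q ⊞ r

  divide : ∀ {e b} → Degree e b → ∀ n a → Bd n a → Division b e a
  divide {e} {b} dg zero a bd = (λ _ → 0#) , a , (0 , λ _ _ → ≡refl) , Bd-mono z≤n bd ,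
    P.sym (P.trans (P.+-congʳ {a} (P.zeroʳ b)) (P.+-identityˡ a))
  divide {e} {b} dg@(be , bb) (suc n) a bd = by-cases (suc n ℕₚ.≤? e)
    (λ l → (λ _ → 0#) , a , (0 , λ _ _ → ≡refl) , Bd-mono l bd , P.sym (P.trans (P.+-congʳ {a} (P.zeroʳ b)) (P.+-identityˡ a)))
    (λ n≰e → from (ℕₚ.m≤n⇒∃[o]m+o≡n (ℕₚ.≤-pred (ℕₚ.≰⇒> n≰e))))
    where
    from : (∃ λ k → e +ℕ k ≡ n) → Division b e a
    from (k , e+k≡n) = add (divide dg n a′ Bd-a′)
      where
      c : Carrier
      c = b e ⁻¹⟨ be ⟩ * a n
      t a′ : Series
      t = term k c
      a′ = a P.- b ⊡ t
      top : (b ⊡ t) n ≡ a n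
      top = ≡trans (≡cong (b ⊡ t) (≡sym e+k≡n)) (≡trans (top-coefficient e k b t bb (Bd-term k c))
        (≡trans (≡cong (b e *_) (term-at k c)) (≡trans (≡sym (F.*-assoc _ _ _))
          (≡trans (≡cong (_* a n) (proj₂ (inverse (b e) be))) (F.*-identityˡ _)))))
      Bd-a′ : Bd n a′
      Bd-a′ i l = step (ℕₚ.m≤n⇒m<n∨m≡n l)
        where
        step : n < i ⊎ n ≡ i → a′ i ≡ 0#
        step (inj₁ l′) = Bd-+ bd (Bd-neg (≡subst (λ m → Bd m (b ⊡ t)) (≡cong suc e+k≡n) (Bd-* {suc e} {k} bb (Bd-term k c)))) i l′
        step (inj₂ ≡refl) = ≡trans (≡cong (λ y → a n - y) top) (F.-‿inverseʳ _)
      add : Division b e a′ → Division b e a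
      add (q , r , pq , br , eq) = t ⊞ q , r , Polynomial-+ (suc k , Bd-term k c) pq , br ,
        P.trans (I.plus-minus a (b ⊡ t)) (P.trans (P.+-congʳ {b ⊡ t} eq) (I.regroup-division b q r t))

  record Irreducible (π : Series) : Set where
    field
      e : ℕ
      degree : Degree (suc e) π
      irreducible : ∀ a b → Polynomial a → Polynomial b → π ≋ a ⊡ b → Nonconst a → Nonconst b → ⊥

  -- The continuation form with goal ⊥ avoids deciding irreducibility: p itself is offered as the
  -- factor, and any nontrivial factorisation that refutes this supplies a shorter polynomial to
  -- continue with.
  irreducible-factor : ∀ n p → Bd n p → Nonconst p →
    (∀ π q → Irreducible π → Polynomial q → p ≋ π ⊡ q → ⊥) → ⊥
  irreducible-factor zero p bd (i , ne) k = ne (bd (suc i) z≤n)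
  irreducible-factor (suc n) p bd (i , ne) k = from (degree-of (suc n) p bd (suc i) ne)
    where
    from : (∃ λ e → suc i ≤ e × e < suc n × Degree e p) → ⊥
    from (suc e , _ , _ , dg) = k p (C 1#) (record { e = e ; degree = dg ; irreducible = irr }) (1 , Bd-C 1#)
        (P.sym (P.*-identityʳ p))
      where
      irr : ∀ a b → Polynomial a → Polynomial b → p ≋ a ⊡ b → Nonconst a → Nonconst b → ⊥
      irr a b pa pb eq na (j , nb) = smaller (degree-of (proj₁ pb) b (proj₂ pb) (suc j) nb)
        where
        smaller : (∃ λ e → suc j ≤ e × e < proj₁ pb × Degree e b) → ⊥
        smaller (suc e , _ , _ , dg) = irreducible-factor n a
          (Bd-factor dg pa (Bd-cong (P.trans eq (P.*-comm a b)) bd)) na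
          (λ π q iπ pq eq′ → k π (q ⊡ b) iπ (Polynomial-* pq pb) (P.trans eq (P.trans (P.*-congʳ {b} eq′) (P.*-assoc π q b))))

  nonzero-coefficient : ∀ {p} → ¬ Zero p → ¬ ¬ (∃ λ i → p i ≢ 0#)
  nonzero-coefficient {p} nz k = nz λ i → decidable-stable (p i ≟ 0#) (λ ne → k (i , ne))

  module PrimeDivisor {π : Series} (irr : Irreducible π) where
    open Irreducible irr

    private
      π≢0 : ¬ Zero π
      π≢0 z = proj₁ degree (z (suc e))

      divides-unit : ∀ c v w → c ≢ 0# → C c ⊡ v ≋ π ⊡ w → Polynomial w → π ∣ v
      divides-unit c v w nc eq pw = C c⁻¹ ⊡ w , Polynomial-* (1 , Bd-C c⁻¹) pw ,
        P.trans (P.sym unit) (P.trans (P.*-congˡ {C c⁻¹} eq) (I.swap (C c⁻¹) π w))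
        where
        c⁻¹ : Carrier
        c⁻¹ = c ⁻¹⟨ nc ⟩
        unit : C c⁻¹ ⊡ (C c ⊡ v) ≋ v
        unit i = ≡trans (C-⊡ c⁻¹ (C c ⊡ v) i) (≡trans (≡cong (c⁻¹ *_) (C-⊡ c v i)) (≡trans (≡sym (F.*-assoc c⁻¹ c (v i)))
          (≡trans (≡cong (_* v i) (≡trans (F.*-comm c⁻¹ c) (proj₂ (inverse c nc)))) (F.*-identityˡ _))))

      -- Write π = u a + r with r shorter than u. Then π divides r v as well, so a nonzero r
      -- replaces u. If r = 0, then π = u a with a nonconstant because u is shorter than π;
      -- irreducibility makes u a nonzero constant, and π divides v.
      euclid : ∀ n u v → Bd n u → n ≤ suc e → ¬ Zero u → Polynomial v → π ∣ u ⊡ v → ¬ π ∣ v → ⊥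
      euclid zero u v bu l nz pv d nd = nz (Bd-zero bu)
      euclid (suc n) u v bu l nz pv (w , pw , uv≋πw) nd = nonzero-coefficient nz
          (λ ui → from (proj₁ (dg ui) , proj₂ (proj₂ (dg ui))))
        where
        dg : (ui : ∃ λ i → u i ≢ 0#) → ∃ λ du → proj₁ ui ≤ du × du < suc n × Degree du u
        dg (i , ne) = degree-of (suc n) u bu i ne
        from : (∃ λ du → du < suc n × Degree du u) → ⊥
        from (du , du<n , dg) = reduce (divide dg (suc (suc e)) π (proj₂ degree))
          where
          reduce : Division u du π → ⊥
          reduce (a , r , pa , br , eq) = nr (λ i → decidable-stable (r i ≟ 0#) (λ ne → nz-r (λ z → ne (z i))))
            where
            r≋ : r ≋ π P.- u ⊡ a
            r≋ = P.trans (I.minus-plusˡ r (u ⊡ a)) (P.+-congʳ { P.- (u ⊡ a)} (P.sym eq))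
            nz-r : ¬ ¬ Zero r
            nz-r nzr = euclid n r v (Bd-mono (ℕₚ.≤-pred du<n) br) (ℕₚ.≤-trans (ℕₚ.n≤1+n n) l) nzr pv
              (v P.- w ⊡ a , Polynomial-- pv (Polynomial-* pw pa) ,
                P.trans (P.*-congʳ {v} r≋) (P.trans (I.distribute π u a v)
                  (P.trans (P.+-congˡ {π ⊡ v} (P.-‿cong (P.*-congʳ {a} uv≋πw))) (I.collect π v w a)))) nd
            nr : ¬ Zero r
            nr z = constant-or-not du dg du<n
              where
              π≋ua : π ≋ u ⊡ a
              π≋ua = P.trans eq (P.trans (P.+-congˡ {u ⊡ a} z) (P.+-identityʳ (u ⊡ a)))
              nonconst-a : ∀ du → Bd (suc du) u → du < suc n → ¬ ¬ Nonconst a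
              nonconst-a du bu l′ nc = proj₁ degree (≡trans (π≋ua (suc e))
                (Bd-* {suc du} {0} bu (λ { (suc i) _ → decidable-stable (a (suc i) ≟ 0#) (λ ne → nc (i , ne)) }) (suc e)
                  (≡subst (_≤ suc e) (≡sym (ℕₚ.+-identityʳ (suc du))) (ℕₚ.≤-trans l′ l))))
              constant-or-not : ∀ du → Degree du u → du < suc n → ⊥
              constant-or-not zero (u0 , bu) l′ = nd (divides-unit (u 0) v w u0 (P.trans (P.*-congʳ {v} u≋C) uv≋πw) pw)
                where
                u≋C : C (u 0) ≋ u
                u≋C zero = ≡refl
                u≋C (suc i) = ≡sym (bu (suc i) (s≤s z≤n))
              constant-or-not (suc du) (udu , bu) l′ = nonconst-a (suc du) bu l′ λ na →
                irreducible u a (suc n , λ i l → ≡trans ≡refl (Bd-mono l′ bu i l)) pa π≋ua (du , udu) na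

    prime : ∀ u v → Polynomial u → Polynomial v → π ∣ u ⊡ v → ¬ π ∣ u → ¬ π ∣ v → ⊥
    prime u v (n , bu) pv (w , pw , eq) nu nv = from (divide degree n u bu)
      where
      from : Division π (suc e) u → ⊥
      from (a , r , pa , br , eq′) = euclid (suc e) r v br ℕₚ.≤-refl
        (λ z → nu (a , pa , P.trans eq′ (P.trans (P.+-congˡ {π ⊡ a} z) (P.+-identityʳ (π ⊡ a))))) pv
        (w P.- a ⊡ v , Polynomial-- pw (Polynomial-* pa pv) ,
          P.trans (P.*-congʳ {v} (P.trans (I.minus-plusˡ r (π ⊡ a)) (P.+-congʳ { P.- (π ⊡ a)} (P.sym eq′))))
            (P.trans (I.distributeʳ u π a v) (P.trans (P.+-congʳ { P.- (π ⊡ (a ⊡ v))} eq) (P.sym (I.*-distrib-minus π w (a ⊡ v))))))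
        nv

-- In these arguments the goal is ⊥, so that irreducible factors may be chosen freely.
module GaussLemma (K : FiniteField) where
  open PolynomialArithmetic K public
  open TwoVariables K public
  private
    module I = Identities XR
    XD : Domain XR
    XD = SeriesDomain.domain-of-series PR domain-of-series
  module XP = CommutativeRing XR

  Content : Series → X.Series → Set
  Content π V = ∀ i → π ∣ V i

  Coefficients : X.Series → Set
  Coefficients V = ∀ i → Polynomial (V i)

  -- Since π divides V₀ W₀, it divides V₀ or W₀. Dropping that coefficient changes the coefficients
  -- of the product only by multiples of π, which gives an induction on the two lengths.
  gauss : ∀ {π} → Irreducible π → ∀ m n V W → X.Bd m V → X.Bd n W → Coefficients V → Coefficients W →
    Content π (V X.⊡ W) → ¬ Content π V → ¬ Content π W → ⊥
  gauss irr zero n V W bv bw pv pw d nv nw = nv (λ i → ∣-0 (bv i z≤n))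
  gauss irr (suc m) zero V W bv bw pv pw d nv nw = nw (λ i → ∣-0 (bw i z≤n))
  gauss {π} irr (suc m) (suc n) V W bv bw pv pw d nv nw = PrimeDivisor.prime irr (V 0) (W 0) (pv 0) (pw 0) (d 0)
    (λ d₀ → gauss irr m (suc n) (X.tail V) W (X.Bd-tail bv) bw (λ i → pv (suc i)) pw
      (λ i → ∣-cong (P.sym (recover (V 0 ⊡ W (suc i)) _)) (∣-minus (d (suc i)) (∣-* (W (suc i)) (pw (suc i)) d₀)))
      (λ c → nv (λ { zero → d₀ ; (suc i) → c i })) nw)
    (λ d₀ → gauss irr (suc m) n V (X.tail W) bv (X.Bd-tail bw) pv (λ i → pw (suc i))
      (λ i → ∣-cong (P.sym (recover (V (suc i) ⊡ W 0) _))
        (∣-minus (∣-cong (X.⊡-last V W i) (d (suc i))) (∣-*ʳ (V (suc i)) (pv (suc i)) d₀)))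
      nv (λ c → nw (λ { zero → d₀ ; (suc i) → c i })))
    where
    recover : ∀ a r → r ≋ (a ⊞ r) P.- a
    recover a r = Identities.minus-plusˡ PR r a

  X-zero : X.Series → Set
  X-zero V = V X.≋ (λ _ _ → 0#)

  X-cancel : ∀ {A V W} → ¬ Zero A → X.C A X.⊡ V X.≋ X.C A X.⊡ W → V X.≋ W
  X-cancel {A} {V} {W} nz e i j = inverse-unique (Domain.cancel XD {X.C A} {V XP.- W} (λ z → nz (z 0))
    (XP.trans (I.*-distrib-minus (X.C A) V W) (XP.trans (XP.+-congʳ { XP.- (X.C A X.⊡ W)} e) (XP.-‿inverseʳ (X.C A X.⊡ W)))) i j)

  -- The length in y drops because π is nonconstant, while the length in x does not grow. The
  -- descent to a primitive V is driven by this drop.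
  record Factored (π : Series) (V : X.Series) : Set where
    field
      quotient-series : X.Series
      factorisation   : V X.≋ X.C π X.⊡ quotient-series
      outer-bound     : ∀ {n} → X.Bd n V → X.Bd n quotient-series
      inner-bound     : ∀ {n} → (∀ i → Bd (suc n) (V i)) → ∀ i → Bd n (quotient-series i)

  factor : ∀ {π V} → Irreducible π → Content π V → Factored π V
  factor {π} {V} irr c = record
    { quotient-series = λ i → proj₁ (c i)
    ; factorisation = λ i → P.trans (proj₂ (proj₂ (c i))) (P.sym (X.C-⊡ π (λ i → proj₁ (c i)) i))
    ; outer-bound = λ b i l → Domain.cancel domain-of-series (λ z → proj₁ degree (z (suc e))) (P.trans (P.sym (proj₂ (proj₂ (c i)))) (b i l))
    ; inner-bound = λ b i → Bd-factor degree (proj₁ (proj₂ (c i))) (Bd-cong (proj₂ (proj₂ (c i))) (b i)) }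
    where open Irreducible irr

  -- The embedding p(x) of K[x], as opposed to `X.C p`, which is p(y).
  outer : Series → X.Series
  outer p i = C (p i)

  Bd-outer : ∀ {n p} → Bd n p → X.Bd n (outer p)
  Bd-outer b i l = P.trans (C-cong (b i l)) C-0

  outer-* : ∀ p q → outer (p ⊡ q) X.≋ outer p X.⊡ outer q
  outer-* p q zero = C-* (p 0) (q 0)
  outer-* p q (suc i) = P.trans (C-+ (p 0 F.* q (suc i)) ((tail p ⊡ q) i)) (P.+-cong (C-* (p 0) (q (suc i))) (outer-* (tail p) q i))

  Coefficients-* : ∀ {V W} → Coefficients V → Coefficients W → Coefficients (V X.⊡ W)
  Coefficients-* {V} {W} a b zero = Polynomial-* (a 0) (b 0)
  Coefficients-* {V} {W} a b (suc i) = Polynomial-+ (Polynomial-* (a 0) (b (suc i))) (Coefficients-* (λ i → a (suc i)) b i)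

  Coefficients-C : ∀ {p} → Polynomial p → Coefficients (X.C p)
  Coefficients-C a zero = a
  Coefficients-C a (suc i) = 0 , λ _ _ → ≡refl

  unit-content : ∀ {π} c → Irreducible π → c ≢ 0# → ¬ π ∣ C c
  unit-content {π} c irr c≢0 (q , pq , eq) = nonzero-coefficient {q}
      (λ z → c≢0 (≡trans (eq 0) (≡trans (P.*-congˡ {π} z 0) (P.zeroʳ π 0))))
      (λ (i , ne) → ℕₚ.<⇒≱ (factor-degree degree pq (Bd-cong eq (Bd-C {0} c)) i ne) (s≤s z≤n))
    where open Irreducible irr

  module _ (o : Series) (o-polynomial : Polynomial o) (i₀ : ℕ) (o≢0 : o i₀ ≢ 0#) (g : X.Series) (pg : Coefficients g) (N D : ℕ) where
    Goal : Set
    Goal = ∀ φ U → Polynomial φ → X.Bd N U → (∀ i → Bd D (U i)) → g X.≋ (outer o X.⊡ X.C φ) X.⊡ (U X.⊡ U) → ⊥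

    -- Removes the factor A(y) from A g = o(x) φ(y) U², one irreducible factor at a time.
    strip : ∀ n A φ U → Bd n A → ¬ Zero A → Polynomial φ → X.Bd N U → (∀ i → Bd D (U i)) →
      X.C A X.⊡ g X.≋ (outer o X.⊡ X.C φ) X.⊡ (U X.⊡ U) → Goal → ⊥
    strip zero A φ U bA nA pφ bU cU eq k = nA (Bd-zero bA)
    strip (suc n) A φ U bA nA pφ bU cU eq k = constant-case (λ nc → irreducible-factor (suc n) A bA nc remove)
      where
      constant-case : ¬ ¬ Nonconst A
      constant-case nc = k (C c⁻¹ ⊡ φ) U (Polynomial-* (1 , Bd-C c⁻¹) pφ) bU cU
        (XP.trans (XP.sym (X.⊡-identityˡ g)) (XP.trans (XP.*-congʳ {g} (XP.trans (X.C-cong (P.sym unit)) (X.C-* (C c⁻¹) A)))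
          (XP.trans (XP.*-assoc (X.C (C c⁻¹)) (X.C A) g) (XP.trans (XP.*-congˡ {X.C (C c⁻¹)} eq)
            (XP.trans (I.absorb-constant (X.C (C c⁻¹)) (outer o) (X.C φ) (U X.⊡ U))
              (XP.*-congʳ {U X.⊡ U} (XP.*-congˡ {outer o} (XP.sym (X.C-* (C c⁻¹) φ)))))))))
        where
        A0 : A 0 ≢ 0#
        A0 e = nA λ { zero → e ; (suc i) → decidable-stable (A (suc i) ≟ 0#) (λ ne → nc (i , ne)) }
        c⁻¹ : Carrier
        c⁻¹ = A 0 ⁻¹⟨ A0 ⟩
        unit : C c⁻¹ ⊡ A ≋ C 1#
        unit zero = ≡trans (F.*-comm c⁻¹ (A 0)) (proj₂ (inverse (A 0) A0))
        unit (suc i) = ≡trans (C-⊡ c⁻¹ A (suc i)) (≡trans (≡cong (c⁻¹ F.*_) (decidable-stable (A (suc i) ≟ 0#) (λ ne → nc (i , ne)))) (F.zeroʳ c⁻¹))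
      remove : ∀ π A′ → Irreducible π → Polynomial A′ → A ≋ π ⊡ A′ → ⊥
      -- The factor π(y) divides o(x) φ(y) U². It cannot divide o(x), whose coefficients are
      -- constants, one of them nonzero; so Gauss's lemma leaves φ and U.
      remove π A′ irr pA′ A≋ = gauss irr _ _ (outer o X.⊡ X.C φ) (U X.⊡ U)
          (X.Bd-*′ {proj₁ o-polynomial} (Bd-outer (proj₂ o-polynomial)) (X.Bd-C {0} φ)) (X.Bd-*′ {N} bU bU)
          (Coefficients-* coef-o (Coefficients-C pφ)) (Coefficients-* coef-U coef-U)
          content
          (λ c → gauss irr _ _ (outer o) (X.C φ) (Bd-outer (proj₂ o-polynomial)) (X.Bd-C {0} φ) coef-o (Coefficients-C pφ) c
            (λ c′ → unit-content (o i₀) irr o≢0 (c′ i₀)) (λ c′ → not-φ (c′ 0)))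
          (λ c → gauss irr N N U U bU bU coef-U coef-U c not-U not-U)
        where
        open Irreducible irr
        π≢0 : ¬ Zero π
        π≢0 z = proj₁ degree (z (suc e))
        coef-o : Coefficients (outer o)
        coef-o i = 1 , Bd-C (o i)
        coef-U : Coefficients U
        coef-U i = D , cU i
        CA : X.C A X.≋ X.C π X.⊡ X.C A′
        CA = XP.trans (X.C-cong A≋) (X.C-* π A′)
        Bd-A′ : Bd n A′
        Bd-A′ = Bd-factor degree pA′ (Bd-cong A≋ bA)
        A′≢0 : ¬ Zero A′
        A′≢0 z = nA (P.trans A≋ (P.trans (P.*-congˡ {π} z) (P.zeroʳ π)))
        eq′ : X.C π X.⊡ (X.C A′ X.⊡ g) X.≋ (outer o X.⊡ X.C φ) X.⊡ (U X.⊡ U)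
        eq′ = XP.trans (XP.sym (XP.*-assoc (X.C π) (X.C A′) g)) (XP.trans (XP.*-congʳ {g} (XP.sym CA)) eq)
        content : ∀ i → π ∣ ((outer o X.⊡ X.C φ) X.⊡ (U X.⊡ U)) i
        content i = (X.C A′ X.⊡ g) i , Coefficients-* (Coefficients-C pA′) pg i ,
          P.trans (P.sym (eq′ i)) (X.C-⊡ π (X.C A′ X.⊡ g) i)
        not-φ : ¬ π ∣ φ
        not-φ (φ′ , pφ′ , φ≋) = strip n A′ φ′ U Bd-A′ A′≢0 pφ′ bU cU
          (X-cancel π≢0 (XP.trans eq′ (XP.trans (XP.*-congʳ {U X.⊡ U} (XP.*-congˡ {outer o} (XP.trans (X.C-cong φ≋) (X.C-* π φ′))))
            (I.cancel-φ (outer o) (X.C π) (X.C φ′) U)))) k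
        -- If π divides U then U² contains π²: one copy cancels against A and the other is moved
        -- into φ.
        not-U : ¬ Content π U
        not-U c = strip n A′ (φ ⊡ π) U′ Bd-A′ A′≢0 (Polynomial-* pφ (suc (suc e) , proj₂ degree)) (outer-bound bU)
          (inner-bound (λ i → Bd-mono (ℕₚ.n≤1+n D) (cU i)))
          (X-cancel π≢0 (XP.trans eq′ (XP.trans (XP.*-congˡ {outer o X.⊡ X.C φ} (XP.*-cong factorisation factorisation))
            (XP.trans (I.cancel-u (outer o) (X.C φ) (X.C π) U′)
              (XP.*-congˡ {X.C π} (XP.*-congʳ {U′ X.⊡ U′} (XP.*-congˡ {outer o} (XP.sym (X.C-* φ π))))))))) k
          where
          open Factored (factor irr c) renaming (quotient-series to U′)

-- The primitive kernel and the contradiction with admissibility.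

module Kernel (K : FiniteField) where
  open GaussLemma K
  open SumTo K
  private module I = Identities XR
  open Relation.Binary.PropositionalEquality.≡-Reasoning

  private
    ⊡-sum : ∀ p q j → (p ⊡ q) j ≡ sumTo K j (λ b → p b F.* q (j ∸ℕ b))
    ⊡-sum p q zero = ≡refl
    ⊡-sum p q (suc j) = ≡trans (≡cong (p 0 F.* q (suc j) F.+_) (⊡-sum (tail p) q j)) (≡sym (sumTo-head j _))

    convolution : X.Series → X.Series → ℕ → ℕ → Carrier
    convolution V W i j = sumTo K i λ a → sumTo K j λ b → V a b F.* W (i ∸ℕ a) (j ∸ℕ b)

    X-⊡-sum : ∀ V W i j → (V X.⊡ W) i j ≡ sumTo K i (λ a → (V a ⊡ W (i ∸ℕ a)) j)
    X-⊡-sum V W zero j = ≡refl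
    X-⊡-sum V W (suc i) j = ≡trans (≡cong ((V 0 ⊡ W (suc i)) j F.+_) (X-⊡-sum (X.tail V) W i j)) (≡sym (sumTo-head i _))

  -- The bridge to `IsProd`. The double sum is symmetric in the two variables, which also makes
  -- `flip` multiplicative.
  product-convolution : ∀ V W i j → (V X.⊡ W) i j ≡ convolution V W i j
  product-convolution V W i j = ≡trans (X-⊡-sum V W i j) (sumTo-cong i (λ a → ⊡-sum (V a) (W (i ∸ℕ a)) j))

  -- Exchanging x and y lets the one version of Gauss's lemma, for contents in K[y], treat factors
  -- in K[x] too.
  flip : X.Series → X.Series
  flip V i j = V j i

  flip-cong : ∀ {V W} → V X.≋ W → flip V X.≋ flip W
  flip-cong e i j = e j i

  flip-* : ∀ V W → flip (V X.⊡ W) X.≋ flip V X.⊡ flip W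
  flip-* V W i j = ≡trans (product-convolution V W j i)
    (≡trans (sumTo-comm j i (λ a b → V a b F.* W (j ∸ℕ a) (i ∸ℕ b))) (≡sym (product-convolution (flip V) (flip W) i j)))

  flip-outer : ∀ p → flip (outer p) X.≋ X.C p
  flip-outer p zero j = ≡refl
  flip-outer p (suc i) j = ≡refl

  flip-C : ∀ p → flip (X.C p) X.≋ outer p
  flip-C p i zero = ≡refl
  flip-C p i (suc j) = ≡refl

  toPoly2 : ∀ V m n → X.Bd m V → (∀ i → Bd n (V i)) → Poly2 K
  toPoly2 V m n b c = record { coef = V ; bound = m +ℕ n ; vanish = vanishing }
    where
    vanishing : ∀ i j → m +ℕ n < i +ℕ j → V i j ≡ FiniteField.0# K
    vanishing i j l = by-cases (m ℕₚ.≤? i) (λ m≤i → b i m≤i j)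
      (λ m≰i → c i j (ℕₚ.≮⇒≥ (λ j<n → ℕₚ.<⇒≱ l (ℕₚ.+-mono-≤ (ℕₚ.<⇒≤ (ℕₚ.≰⇒> m≰i)) (ℕₚ.<⇒≤ j<n)))))

  Polynomial-row : ∀ (Q : Poly2 K) i → Polynomial (coef Q i)
  Polynomial-row Q i = suc (bound Q) , λ j l → vanish Q i j (ℕₚ.≤-trans l (ℕₚ.m≤n+m j i))

  Polynomial-column : ∀ (Q : Poly2 K) j → Polynomial (λ i → coef Q i j)
  Polynomial-column Q j = suc (bound Q) , λ i l → vanish Q i j (ℕₚ.≤-trans l (ℕₚ.m≤m+n i j))

  module _ (f : Poly2 K) (f≢0 : ¬ X-zero (coef f)) (admissible : ∀ H → IsPrimitiveKernel K f H → ¬ ConstTimesSquare K H) where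

    reducible-square : ∀ N V p → X.Bd N V → Coefficients V → Polynomial p → Nonconst p →
      (∀ i → p ∣ (V X.⊡ V) i) → (∀ π → Irreducible π → Factored π V → ⊥) → ⊥
    reducible-square N V p bV cV (n , bp) nc d k = irreducible-factor n p bp nc λ π q irr pq eq →
      gauss irr N N V V bV bV cV cV (λ i → ∣-trans (q , pq , eq) (d i)) (λ c → k π irr (factor irr c)) (λ c → k π irr (factor irr c))

    -- An irreducible factor π(x) or π(y) of V² divides V, and π² is moved into F or G;
    -- this lowers nx or ny, so eventually V² is primitive.
    no-square-factorisation : ∀ nx ny F G V → Polynomial F → Polynomial G → X.Bd nx V → (∀ i → Bd ny (V i)) →
      coef f X.≋ (outer F X.⊡ X.C G) X.⊡ (V X.⊡ V) → ⊥
    no-square-factorisation zero ny F G V pF pG bV cV eq =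
      f≢0 (XP.trans eq (XP.trans (XP.*-congˡ {outer F X.⊡ X.C G} (X.⊡-zeroˡ V V (X.Bd-zero bV))) (XP.zeroʳ (outer F X.⊡ X.C G))))
    no-square-factorisation (suc nx) zero F G V pF pG bV cV eq =
      f≢0 (XP.trans eq (XP.trans (XP.*-congˡ {outer F X.⊡ X.C G} (X.⊡-zeroˡ V V (λ i → Bd-zero (cV i)))) (XP.zeroʳ (outer F X.⊡ X.C G))))
    no-square-factorisation (suc nx) (suc ny) F G V pF pG bV cV eq =
      admissible H (Fp , Gp , FG , (λ { i (suc j) _ → ≡refl }) , (λ { (suc i) j _ → ≡refl }) ,
        product-convolution (outer F) (X.C G) ,
        (λ i j → ≡trans (eq i j) (product-convolution (outer F X.⊡ X.C G) (V X.⊡ V) i j)) , primitive-x , primitive-y)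
        (FiniteField.1# K , toPoly2 V (suc nx) (suc ny) bV cV , H , product-convolution V V , λ i j → ≡sym (F.*-identityˡ _))
      where
      H Fp Gp FG : Poly2 K
      H = toPoly2 (V X.⊡ V) _ _ (X.Bd-*′ {suc nx} bV bV) (Bd-⊡ V V cV cV)
      Fp = toPoly2 (outer F) (proj₁ pF) 1 (Bd-outer (proj₂ pF)) (λ i → Bd-C (F i))
      Gp = toPoly2 (X.C G) 1 (proj₁ pG) (X.Bd-C G) (λ { zero → proj₂ pG ; (suc i) → λ _ _ → ≡refl })
      FG = toPoly2 (outer F X.⊡ X.C G) _ _ (X.Bd-*′ {proj₁ pF} (Bd-outer (proj₂ pF)) (X.Bd-C {0} G))
        (Bd-⊡ {1} {proj₁ pG} (outer F) (X.C G) (λ i → Bd-C (F i)) (λ { zero → proj₂ pG ; (suc i) → λ _ _ → ≡refl }))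

      primitive-y : ∀ P → InFy K P → _∣ₚ_ K P H → ¬ Nonconstant K P
      primitive-y P inFy (Q , H≡PQ) (zero , zero , () , ne)
      primitive-y P inFy (Q , H≡PQ) (suc i , j , _ , ne) = ne (inFy (suc i) j (s≤s z≤n))
      primitive-y P inFy (Q , H≡PQ) (zero , suc j , _ , ne) = reducible-square (suc nx) V (coef P 0) bV (λ i → suc ny , cV i)
        (Polynomial-row P 0) (j , ne)
        (λ i → coef Q i , Polynomial-row Q i , P.trans (λ k → H≋ i k) (X.C-⊡ (coef P 0) (coef Q) i)) λ π irr fac →
          let open Factored fac renaming (quotient-series to V′) in
          no-square-factorisation (suc nx) ny F (G ⊡ (π ⊡ π)) V′ pF
            (Polynomial-* pG (Polynomial-* (_ , proj₂ (Irreducible.degree irr)) (_ , proj₂ (Irreducible.degree irr))))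
            (outer-bound bV) (inner-bound cV)
            (XP.trans eq (XP.trans (XP.*-congˡ {outer F X.⊡ X.C G} (XP.*-cong factorisation factorisation))
              (XP.trans (I.absorb-square (outer F) (X.C G) (X.C π) V′)
                (XP.*-congʳ {V′ X.⊡ V′} (XP.*-congˡ {outer F} (XP.sym (XP.trans (X.C-* G (π ⊡ π)) (XP.*-congˡ {X.C G} (X.C-* π π)))))))))
        where
        P≋ : coef P X.≋ X.C (coef P 0)
        P≋ zero k = ≡refl
        P≋ (suc i) k = inFy (suc i) k (s≤s z≤n)
        H≋ : V X.⊡ V X.≋ X.C (coef P 0) X.⊡ coef Q
        H≋ = XP.trans (λ i k → ≡trans (H≡PQ i k) (≡sym (product-convolution (coef P) (coef Q) i k))) (XP.*-congʳ {coef Q} P≋)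

      primitive-x : ∀ P → InFx K P → _∣ₚ_ K P H → ¬ Nonconstant K P
      primitive-x P inFx (Q , H≡PQ) (zero , zero , () , ne)
      primitive-x P inFx (Q , H≡PQ) (i , suc j , _ , ne) = ne (inFx i (suc j) (s≤s z≤n))
      primitive-x P inFx (Q , H≡PQ) (suc i , zero , _ , ne) = reducible-square (suc ny) (flip V) p (λ j l i → cV i j l)
        (λ j → suc nx , λ i l → bV i l j) (Polynomial-column P 0) (i , ne)
        (λ j → (λ i → coef Q i j) , Polynomial-column Q j , P.trans (λ k → H≋ j k) (X.C-⊡ p (flip (coef Q)) j)) λ π irr fac →
          let open Factored fac renaming (quotient-series to W) in
          no-square-factorisation nx (suc ny) (F ⊡ (π ⊡ π)) G (flip W)
            (Polynomial-* pF (Polynomial-* (_ , proj₂ (Irreducible.degree irr)) (_ , proj₂ (Irreducible.degree irr)))) pG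
            (λ i l j → inner-bound (λ j i l → bV i l j) j i l) (λ i j l → outer-bound (λ j l i → cV i j l) j l i)
            (XP.trans eq (XP.trans (XP.*-congˡ {outer F X.⊡ X.C G} (XP.*-cong (V≋ factorisation) (V≋ factorisation)))
              (XP.trans (I.absorb-square′ (outer F) (X.C G) (outer π) (flip W))
                (XP.*-congʳ {flip W X.⊡ flip W} (XP.*-congʳ {X.C G}
                  (XP.sym (XP.trans (outer-* F (π ⊡ π)) (XP.*-congˡ {outer F} (outer-* π π)))))))))
        where
        p : Series
        p i = coef P i 0
        P≋ : flip (coef P) X.≋ X.C p
        P≋ zero k = ≡refl
        P≋ (suc j) k = inFx k (suc j) (s≤s z≤n)
        H≋ : flip V X.⊡ flip V X.≋ X.C p X.⊡ flip (coef Q)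
        H≋ = XP.trans (XP.sym (flip-* V V)) (XP.trans (λ j k → ≡trans (H≡PQ k j) (≡sym (product-convolution (coef P) (coef Q) k j)))
          (XP.trans (flip-* (coef P) (coef Q)) (XP.*-congʳ {flip (coef Q)} P≋)))
        V≋ : ∀ {π W} → flip V X.≋ X.C π X.⊡ W → V X.≋ outer π X.⊡ flip W
        V≋ {π} {W} e = XP.trans (flip-cong e) (XP.trans (flip-* (X.C π) W) (XP.*-congʳ {flip W} (flip-C π)))

    -- `strip` is used twice: it removes A(y) from A (B f) = U², and after exchanging the variables
    -- it removes B(x). In the second pass the factor φ(y) left by the first plays the role of `o`,
    -- which may not be divided by any irreducible polynomial in x.
    no-weighted-square : ∀ D A B U → Bd D A → Bd D B → Bounded D U → ¬ Zero A → ¬ Zero B →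
      (outer B X.⊡ X.C A) X.⊡ coef f X.≋ U X.⊡ U → ⊥
    no-weighted-square D A B U bA bB (bU , cU) nA nB eq =
      strip (C 1#′) (1 , Bd-C 1#′) 0 (λ e → FiniteField.0≢1 K (≡sym e)) (outer B X.⊡ coef f)
        (Coefficients-* (λ i → 1 , Bd-C (B i)) (Polynomial-row f)) D D D A (C 1#′) U bA nA (1 , Bd-C 1#′) bU cU start then
      where
      1#′ = FiniteField.1# K
      outer-1 : outer (C 1#′) X.≋ X.C (C 1#′)
      outer-1 zero = P.refl
      outer-1 (suc i) = C-0
      units : outer (C 1#′) X.⊡ X.C (C 1#′) X.≋ X.C (C 1#′)
      units = XP.trans (XP.*-congʳ {X.C (C 1#′)} outer-1) (XP.*-identityˡ (X.C (C 1#′)))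
      start : X.C A X.⊡ (outer B X.⊡ coef f) X.≋ (outer (C 1#′) X.⊡ X.C (C 1#′)) X.⊡ (U X.⊡ U)
      start = XP.trans (I.rotate-factors (X.C A) (outer B) (coef f))
        (XP.trans eq (XP.trans (XP.sym (XP.*-identityˡ (U X.⊡ U))) (XP.*-congʳ {U X.⊡ U} (XP.sym units))))
      outer-B≢0 : ¬ X-zero (outer B)
      outer-B≢0 z = nB (λ i → z i 0)
      then : ∀ φ V → Polynomial φ → X.Bd D V → (∀ i → Bd D (V i)) →
        outer B X.⊡ coef f X.≋ (outer (C 1#′) X.⊡ X.C φ) X.⊡ (V X.⊡ V) → ⊥
      then φ V pφ bV cV e₁ = nonzero-coefficient φ≢0 λ (i , ne) →
        strip φ pφ i ne (flip (coef f)) (Polynomial-column f) D D D B (C 1#′) (flip V) bB nB (1 , Bd-C 1#′)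
          (λ j l i → cV i j l) (λ j i l → bV i l j) flipped finish
        where
        e₁′ : outer B X.⊡ coef f X.≋ X.C φ X.⊡ (V X.⊡ V)
        e₁′ = XP.trans e₁ (XP.*-congʳ {V X.⊡ V} (XP.trans (XP.*-congʳ {X.C φ} outer-1) (XP.*-identityˡ (X.C φ))))
        φ≢0 : ¬ Zero φ
        φ≢0 z = f≢0 (Domain.cancel (SeriesDomain.domain-of-series PR domain-of-series) {outer B} {coef f} outer-B≢0
          (XP.trans e₁′ (X.⊡-zeroˡ (X.C φ) (V X.⊡ V) (λ { zero → z ; (suc i) _ → ≡refl }))))
        flipped : X.C B X.⊡ flip (coef f) X.≋ (outer φ X.⊡ X.C (C 1#′)) X.⊡ (flip V X.⊡ flip V)
        flipped = XP.trans (XP.sym (XP.trans (flip-* (outer B) (coef f)) (XP.*-congʳ {flip (coef f)} (flip-outer B))))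
          (XP.trans (flip-cong e₁′) (XP.trans (flip-* (X.C φ) (V X.⊡ V))
            (XP.*-cong (XP.trans (flip-C φ) (XP.sym (XP.*-identityʳ (outer φ)))) (flip-* V V))))
        finish : ∀ ψ W → Polynomial ψ → X.Bd D W → (∀ i → Bd D (W i)) →
          flip (coef f) X.≋ (outer φ X.⊡ X.C ψ) X.⊡ (W X.⊡ W) → ⊥
        finish ψ W pψ bW cW e₂ = no-square-factorisation D D ψ φ (flip W) pψ pφ
          (λ i l j → cW j i l) (λ i j l → bW j l i)
          (XP.trans (flip-cong e₂) (XP.trans (flip-* (outer φ X.⊡ X.C ψ) (W X.⊡ W))
            (XP.*-cong (XP.trans (flip-* (outer φ) (X.C ψ)) (XP.trans (XP.*-cong (flip-outer φ) (flip-C ψ)) (XP.*-comm (X.C φ) (outer ψ)))) (flip-* W W))))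

-- Counting and the second moment method.

module Counting (K : FiniteField) where
  private
    shift-right : ∀ {c} a b → c ≤ a +ℕ b → suc c ≤ a +ℕ suc b
    shift-right {c} a b l = ≡subst (suc c ≤_) (≡sym (ℕₚ.+-suc a b)) (s≤s l)

  count-≤ : ∀ {m} (p : Fin m → Bool) → count K p ≤ m
  count-≤ {zero} p = z≤n
  count-≤ {suc m} p with p Fin.zero
  ... | true  = s≤s (count-≤ (p ∘ Fin.suc))
  ... | false = ℕₚ.m≤n⇒m≤1+n (count-≤ (p ∘ Fin.suc))

  count-∨ : ∀ {m} (p q : Fin m → Bool) → count K (λ i → p i ∨ q i) ≤ count K p +ℕ count K q
  count-∨ {zero} p q = z≤n
  count-∨ {suc m} p q with p Fin.zero | q Fin.zero | count-∨ (p ∘ Fin.suc) (q ∘ Fin.suc)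
  ... | true  | true  | l = s≤s (ℕₚ.≤-trans l (ℕₚ.+-monoʳ-≤ (count K (p ∘ Fin.suc)) (ℕₚ.n≤1+n _)))
  ... | true  | false | l = s≤s l
  ... | false | true  | l = shift-right (count K (p ∘ Fin.suc)) _ l
  ... | false | false | l = l

  count-split : ∀ {m} (p q : Fin m → Bool) → count K p ≤ count K (λ i → p i ∧ not (q i)) +ℕ count K q
  count-split {zero} p q = z≤n
  count-split {suc m} p q with p Fin.zero | q Fin.zero | count-split (p ∘ Fin.suc) (q ∘ Fin.suc)
  ... | true  | true  | l = shift-right (count K (λ i → p (Fin.suc i) ∧ not (q (Fin.suc i)))) _ l
  ... | true  | false | l = s≤s l
  ... | false | true  | l = ℕₚ.≤-trans (ℕₚ.≤-trans (ℕₚ.n≤1+n _) (s≤s l)) (ℕₚ.≤-reflexive (≡sym (ℕₚ.+-suc (count K (λ i → p (Fin.suc i) ∧ not (q (Fin.suc i)))) _)))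
  ... | false | false | l = l

  count-none : ∀ m → count K {m} (λ _ → false) ≡ 0
  count-none zero = ≡refl
  count-none (suc m) = count-none m

  count-point : ∀ {m} (j : Fin m) → count K (λ i → does (i Fin.≟ j)) ≤ 1
  count-point {suc m} Fin.zero = s≤s (ℕₚ.≤-reflexive (count-none m))
  count-point {suc m} (Fin.suc j) = count-point j

-- The second moment method. With ε = 2 adj - 1 and X = Σ_S Σ_T ε, Cauchy-Schwarz
-- gives X² ≤ |S| Σ_{j,k ∈ T} c j k for the correlations c j k = Σ_i ε i j ε i k.
module Correlations (K : FiniteField) where
  open Data.Integer using (ℤ; +_; -[1+_]; ∣_∣; 0ℤ; 1ℤ; -1ℤ; +≤+) renaming (_+_ to _+ᶻ_; _*_ to _*ᶻ_; _-_ to _-ᶻ_; _≤_ to _≤ᶻ_)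
  open Counting K
  module ℤₚ = Data.Integer.Properties
  open Algebra.Properties.Semiring.Sum ℤₚ.+-*-semiring using (sum; sum-cong-≋; ∑-comm; ∑-distrib-+; *-distribˡ-sum; *-distribʳ-sum)

  χ ε : Bool → ℤ
  χ true  = 1ℤ
  χ false = 0ℤ
  ε true  = 1ℤ
  ε false = -1ℤ

  agree : Bool → Bool → Bool
  agree true  b = b
  agree false b = not b

  private
    sum-mono : ∀ {n} {f g : Fin n → ℤ} → (∀ i → f i ≤ᶻ g i) → sum f ≤ᶻ sum g
    sum-mono {zero} l = ℤₚ.≤-refl
    sum-mono {suc n} l = ℤₚ.+-mono-≤ (l Fin.zero) (sum-mono (λ i → l (Fin.suc i)))

    count-sum : ∀ {n} (p : Fin n → Bool) → + count K p ≡ sum (χ ∘ p)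
    count-sum {zero} p = ≡refl
    count-sum {suc n} p with p Fin.zero
    ... | true  = ≡cong (1ℤ +ᶻ_) (count-sum (p ∘ Fin.suc))
    ... | false = ≡trans (count-sum (p ∘ Fin.suc)) (≡sym (ℤₚ.+-identityˡ _))

    sumFin-sum : ∀ {n} (g : Fin n → ℕ) → + sumFin K g ≡ sum (λ i → + g i)
    sumFin-sum {zero} g = ≡refl
    sumFin-sum {suc n} g = ≡cong (+ g Fin.zero +ᶻ_) (sumFin-sum (g ∘ Fin.suc))

    sum-product : ∀ {m n} (f : Fin m → ℤ) (g : Fin n → ℤ) → sum (λ i → sum (λ j → f i *ᶻ g j)) ≡ sum f *ᶻ sum g
    sum-product f g = ≡trans (sum-cong-≋ (λ i → ≡sym (*-distribˡ-sum (f i) g))) (≡sym (*-distribʳ-sum (sum g) f))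

    sum-minus : ∀ {n} (f g : Fin n → ℤ) → sum (λ i → f i -ᶻ g i) ≡ sum f -ᶻ sum g
    sum-minus {zero} f g = ≡refl
    sum-minus {suc n} f g = ≡trans (≡cong (f Fin.zero -ᶻ g Fin.zero +ᶻ_) (sum-minus (f ∘ Fin.suc) (g ∘ Fin.suc))) (lemma (f Fin.zero) (g Fin.zero) (sum (f ∘ Fin.suc)) (sum (g ∘ Fin.suc)))
      where
      lemma : ∀ a b c d → (a -ᶻ b) +ᶻ (c -ᶻ d) ≡ (a +ᶻ c) -ᶻ (b +ᶻ d)
      lemma = solve-∀ℤ

    0≤square : ∀ x → 0ℤ ≤ᶻ x *ᶻ x
    0≤square (+ zero) = +≤+ z≤n
    0≤square (+ suc n) = +≤+ z≤n
    0≤square -[1+ n ] = +≤+ z≤n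

    2xy≤x²+y² : ∀ x y → x *ᶻ y +ᶻ x *ᶻ y ≤ᶻ x *ᶻ x +ᶻ y *ᶻ y
    2xy≤x²+y² x y = ℤₚ.0≤i-j⇒j≤i (≡subst (0ℤ ≤ᶻ_) (≡sym (lemma x y)) (0≤square (x -ᶻ y)))
      where
      lemma : ∀ x y → (x *ᶻ x +ᶻ y *ᶻ y) -ᶻ (x *ᶻ y +ᶻ x *ᶻ y) ≡ (x -ᶻ y) *ᶻ (x -ᶻ y)
      lemma = solve-∀ℤ

    weighted-2xy : ∀ s t x y → (χ s *ᶻ x) *ᶻ (χ t *ᶻ y) +ᶻ (χ s *ᶻ x) *ᶻ (χ t *ᶻ y) ≤ᶻ χ t *ᶻ (x *ᶻ x) +ᶻ χ s *ᶻ (y *ᶻ y)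
    weighted-2xy true true x y rewrite ℤₚ.*-identityˡ x | ℤₚ.*-identityˡ y | ℤₚ.*-identityˡ (x *ᶻ x) | ℤₚ.*-identityˡ (y *ᶻ y) = 2xy≤x²+y² x y
    weighted-2xy true false x y rewrite ℤₚ.*-zeroˡ y | ℤₚ.*-zeroʳ (1ℤ *ᶻ x) | ℤₚ.*-zeroˡ (x *ᶻ x) | ℤₚ.*-identityˡ (y *ᶻ y) | ℤₚ.+-identityˡ (y *ᶻ y) = 0≤square y
    weighted-2xy false true x y rewrite ℤₚ.*-zeroˡ x | ℤₚ.*-zeroˡ (1ℤ *ᶻ y) | ℤₚ.*-zeroˡ (y *ᶻ y) | ℤₚ.*-identityˡ (x *ᶻ x) | ℤₚ.+-identityʳ (x *ᶻ x) = 0≤square x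
    weighted-2xy false false x y rewrite ℤₚ.*-zeroˡ x | ℤₚ.*-zeroˡ y | ℤₚ.*-zeroˡ (x *ᶻ x) | ℤₚ.*-zeroˡ (y *ᶻ y) = ℤₚ.≤-refl

    halve : ∀ x y → x +ᶻ x ≤ᶻ y +ᶻ y → x ≤ᶻ y
    halve x y l = ℤₚ.*-cancelˡ-≤-pos x y (+ 2) (≡subst (λ a → a ≤ᶻ + 2 *ᶻ y) (double x) (≡subst (λ a → x +ᶻ x ≤ᶻ a) (double y) l))
      where
      double : ∀ x → x +ᶻ x ≡ + 2 *ᶻ x
      double = solve-∀ℤ

  -- The sum of squares runs over all indices and not only over S, so that opening it produces
  -- complete sums over the field, the ones which Stepanov's method controls.
  cauchy-schwarz : ∀ {n} (S : Fin n → Bool) (w : Fin n → ℤ) →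
    sum (λ i → χ (S i) *ᶻ w i) *ᶻ sum (λ i → χ (S i) *ᶻ w i) ≤ᶻ sum (χ ∘ S) *ᶻ sum (λ i → w i *ᶻ w i)
  cauchy-schwarz S w = halve _ _ (begin
    P *ᶻ P +ᶻ P *ᶻ P ≡⟨ ≡cong₂ _+ᶻ_ (sum-product p p) (sum-product p p) ⟨
    sum (λ i → sum (λ k → p i *ᶻ p k)) +ᶻ sum (λ i → sum (λ k → p i *ᶻ p k))
      ≡⟨ ∑-distrib-+ (λ i → sum (λ k → p i *ᶻ p k)) (λ i → sum (λ k → p i *ᶻ p k)) ⟨
    sum (λ i → sum (λ k → p i *ᶻ p k) +ᶻ sum (λ k → p i *ᶻ p k))
      ≡⟨ sum-cong-≋ (λ i → ∑-distrib-+ (λ k → p i *ᶻ p k) (λ k → p i *ᶻ p k)) ⟨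
    sum (λ i → sum (λ k → p i *ᶻ p k +ᶻ p i *ᶻ p k)) ≤⟨ sum-mono (λ i → sum-mono (λ k → weighted-2xy (S i) (S k) (w i) (w k))) ⟩
    sum (λ i → sum (λ k → χ (S k) *ᶻ w² i +ᶻ χ (S i) *ᶻ w² k)) ≡⟨ sum-cong-≋ (λ i → ∑-distrib-+ (λ k → χ (S k) *ᶻ w² i) (λ k → χ (S i) *ᶻ w² k)) ⟩
    sum (λ i → sum (λ k → χ (S k) *ᶻ w² i) +ᶻ sum (λ k → χ (S i) *ᶻ w² k)) ≡⟨ ∑-distrib-+ (λ i → sum (λ k → χ (S k) *ᶻ w² i)) (λ i → sum (λ k → χ (S i) *ᶻ w² k)) ⟩
    sum (λ i → sum (λ k → χ (S k) *ᶻ w² i)) +ᶻ sum (λ i → sum (λ k → χ (S i) *ᶻ w² k))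
      ≡⟨ ≡cong₂ _+ᶻ_ (≡trans (∑-comm (λ i k → χ (S k) *ᶻ w² i)) (sum-product (χ ∘ S) w²)) (sum-product (χ ∘ S) w²) ⟩
    sum (χ ∘ S) *ᶻ sum w² +ᶻ sum (χ ∘ S) *ᶻ sum w² ∎)
    where
    open ℤₚ.≤-Reasoning
    p w² : Fin _ → ℤ
    p i = χ (S i) *ᶻ w i
    w² i = w i *ᶻ w i
    P = sum p

  module _ {n : ℕ} (adj : Fin n → Fin n → Bool) where
    correlation : Fin n → Fin n → ℤ
    correlation j k = sum (λ i → ε (adj i j) *ᶻ ε (adj i k))

    correlation-count : ∀ j k → correlation j k ≡ + (2 *ℕ count K (λ i → agree (adj i j) (adj i k))) -ᶻ + n
    correlation-count j k = begin
      correlation j k ≡⟨ sum-cong-≋ (λ i → pointwise (adj i j) (adj i k)) ⟩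
      sum (λ i → + 2 *ᶻ χ (a i) -ᶻ 1ℤ) ≡⟨ sum-minus (λ i → + 2 *ᶻ χ (a i)) (λ _ → 1ℤ) ⟩
      sum (λ i → + 2 *ᶻ χ (a i)) -ᶻ sum {n} (λ _ → 1ℤ)
        ≡⟨ ≡cong₂ _-ᶻ_ (≡trans (≡sym (*-distribˡ-sum (+ 2) (χ ∘ a))) (≡trans (≡cong (+ 2 *ᶻ_) (≡sym (count-sum a))) (≡sym (ℤₚ.pos-* 2 (count K a))))) (ones n) ⟩
      + (2 *ℕ count K a) -ᶻ + n ∎
      where
      open Relation.Binary.PropositionalEquality.≡-Reasoning
      a : Fin n → Bool
      a i = agree (adj i j) (adj i k)
      pointwise : ∀ x y → ε x *ᶻ ε y ≡ + 2 *ᶻ χ (agree x y) -ᶻ 1ℤ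
      pointwise true true = ≡refl
      pointwise true false = ≡refl
      pointwise false true = ≡refl
      pointwise false false = ≡refl
      ones : ∀ m → sum {m} (λ _ → 1ℤ) ≡ + m
      ones zero = ≡refl
      ones (suc m) = ≡cong (1ℤ +ᶻ_) (ones m)

    second-moment : (T : Fin n → Bool) → let w = λ i → sum (λ j → χ (T j) *ᶻ ε (adj i j)) in
      sum (λ i → w i *ᶻ w i) ≡ sum (λ j → sum (λ k → (χ (T j) *ᶻ χ (T k)) *ᶻ correlation j k))
    second-moment T = begin
      sum (λ i → w i *ᶻ w i) ≡⟨ sum-cong-≋ (λ i → sum-product (v i) (v i)) ⟨
      sum (λ i → sum (λ j → sum (λ k → v i j *ᶻ v i k))) ≡⟨ ∑-comm (λ i j → sum (λ k → v i j *ᶻ v i k)) ⟩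
      sum (λ j → sum (λ i → sum (λ k → v i j *ᶻ v i k))) ≡⟨ sum-cong-≋ (λ j → ∑-comm (λ i k → v i j *ᶻ v i k)) ⟩
      sum (λ j → sum (λ k → sum (λ i → v i j *ᶻ v i k)))
        ≡⟨ sum-cong-≋ (λ j → sum-cong-≋ (λ k → ≡trans (sum-cong-≋ (λ i → regroup (χ (T j)) (χ (T k)) (ε (adj i j)) (ε (adj i k))))
             (≡sym (*-distribˡ-sum (χ (T j) *ᶻ χ (T k)) (λ i → ε (adj i j) *ᶻ ε (adj i k)))))) ⟩
      sum (λ j → sum (λ k → (χ (T j) *ᶻ χ (T k)) *ᶻ correlation j k)) ∎
      where
      open Relation.Binary.PropositionalEquality.≡-Reasoning
      v : Fin n → Fin n → ℤ
      v i j = χ (T j) *ᶻ ε (adj i j)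
      w : Fin n → ℤ
      w i = sum (v i)
      regroup : ∀ a b c d → (a *ᶻ c) *ᶻ (b *ᶻ d) ≡ (a *ᶻ b) *ᶻ (c *ᶻ d)
      regroup = solve-∀ℤ

    module _ (bad₀ : Fin n → Bool) (bad₁ : Fin n → Fin n → Bool) (B D₀ D₁ : ℕ)
             (few₀ : count K bad₀ ≤ D₀) (few₁ : ∀ j → count K (bad₁ j) ≤ D₁)
             (good : ∀ j k → bad₀ j ≡ false → bad₁ j k ≡ false →
               2 *ℕ count K (λ i → agree (adj i j) (adj i k)) ≤ n +ℕ B) where
      private
        correlation≤ : ∀ j k b → 2 *ℕ count K (λ i → agree (adj i j) (adj i k)) ≤ n +ℕ b → correlation j k ≤ᶻ + b
        correlation≤ j k b l = ≡subst (_≤ᶻ + b) (≡sym (correlation-count j k))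
          (≡subst (+ (2 *ℕ count K a) -ᶻ + n ≤ᶻ_) (lemma (+ n) (+ b)) (ℤₚ.+-monoˡ-≤ (Data.Integer.- (+ n)) (+≤+ l)))
          where
          a : Fin n → Bool
          a i = agree (adj i j) (adj i k)
          lemma : ∀ x y → (x +ᶻ y) -ᶻ x ≡ y
          lemma = solve-∀ℤ

        always : ∀ j k → correlation j k ≤ᶻ + n
        always j k = correlation≤ j k n (≡subst (_≤ n +ℕ n) (≡cong (count K a +ℕ_) (≡sym (ℕₚ.+-identityʳ _))) (ℕₚ.+-mono-≤ (count-≤ a) (count-≤ a)))
          where
          a : Fin n → Bool
          a i = agree (adj i j) (adj i k)

        -- Exceptional pairs come as few bad j or, for given j, few bad k. In the term for the
        -- second kind j still ranges over T, in the term for the first kind k does, so both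
        -- contributions keep a factor |T|; counting bad pairs without regard to T would lose it.
        majorant : Bool → Bool → Bool → Bool → ℤ
        majorant t t′ b₁ b₀ = (χ t *ᶻ χ t′) *ᶻ + B +ᶻ + n *ᶻ (χ t *ᶻ χ b₁ +ᶻ χ b₀ *ᶻ χ t′)

        0≤χ : ∀ b → 0ℤ ≤ᶻ χ b
        0≤χ true = +≤+ z≤n
        0≤χ false = +≤+ z≤n

        0≤* : ∀ {x y} → 0ℤ ≤ᶻ x → 0ℤ ≤ᶻ y → 0ℤ ≤ᶻ x *ᶻ y
        0≤* {+ x} {+ y} _ _ = ≡subst (0ℤ ≤ᶻ_) (ℤₚ.pos-* x y) (+≤+ z≤n)

        0≤majorant : ∀ t t′ b₁ b₀ → 0ℤ ≤ᶻ majorant t t′ b₁ b₀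
        0≤majorant t t′ b₁ b₀ = ℤₚ.+-mono-≤ {0ℤ} {_} {0ℤ} (0≤* (0≤* (0≤χ t) (0≤χ t′)) (+≤+ z≤n))
          (0≤* {+ n} (+≤+ z≤n) (ℤₚ.+-mono-≤ {0ℤ} {_} {0ℤ} (0≤* (0≤χ t) (0≤χ b₁)) (0≤* (0≤χ b₀) (0≤χ t′))))

        majorant-11 : ∀ b₁ b₀ → majorant true true b₁ b₀ ≡ + B +ᶻ + n *ᶻ (χ b₁ +ᶻ χ b₀)
        majorant-11 b₁ b₀ = lemma (+ B) (+ n) (χ b₁) (χ b₀)
          where
          lemma : ∀ B n x y → (1ℤ *ᶻ 1ℤ) *ᶻ B +ᶻ n *ᶻ (1ℤ *ᶻ x +ᶻ y *ᶻ 1ℤ) ≡ B +ᶻ n *ᶻ (x +ᶻ y)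
          lemma = solve-∀ℤ

        n≤ : ∀ m → + n ≤ᶻ + B +ᶻ + n *ᶻ + suc m
        n≤ m = ≡subst (λ x → + n ≤ᶻ + B +ᶻ x) (ℤₚ.pos-* n (suc m))
          (+≤+ (ℕₚ.≤-trans (ℕₚ.≤-trans (ℕₚ.m≤m+n n (n *ℕ m)) (ℕₚ.≤-reflexive (≡sym (ℕₚ.*-suc n m)))) (ℕₚ.m≤n+m (n *ℕ suc m) B)))

        correlation≤majorant : ∀ j k → correlation j k ≤ᶻ majorant true true (bad₁ j k) (bad₀ j)
        correlation≤majorant j k = ≡subst (correlation j k ≤ᶻ_) (≡sym (majorant-11 (bad₁ j k) (bad₀ j))) (cases (bad₁ j k) (bad₀ j) ≡refl ≡refl)
          where
          cases : ∀ b₁ b₀ → bad₁ j k ≡ b₁ → bad₀ j ≡ b₀ → correlation j k ≤ᶻ + B +ᶻ + n *ᶻ (χ b₁ +ᶻ χ b₀)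
          cases false false e₁ e₀ = ≡subst (correlation j k ≤ᶻ_) (≡sym (≡trans (≡cong (+ B +ᶻ_) (ℤₚ.*-zeroʳ (+ n))) (ℤₚ.+-identityʳ (+ B)))) (correlation≤ j k B (good j k e₀ e₁))
          cases true false _ _ = ℤₚ.≤-trans (always j k) (n≤ 0)
          cases false true _ _ = ℤₚ.≤-trans (always j k) (n≤ 0)
          cases true true _ _ = ℤₚ.≤-trans (always j k) (n≤ 1)

        weighted≤majorant : ∀ t t′ b₁ b₀ c → c ≤ᶻ majorant true true b₁ b₀ → (χ t *ᶻ χ t′) *ᶻ c ≤ᶻ majorant t t′ b₁ b₀
        weighted≤majorant true true b₁ b₀ c l = ≡subst (_≤ᶻ majorant true true b₁ b₀) (≡sym (ℤₚ.*-identityˡ c)) l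
        weighted≤majorant true false b₁ b₀ c l = ≡subst (_≤ᶻ majorant true false b₁ b₀) (≡sym (ℤₚ.*-zeroˡ c)) (0≤majorant true false b₁ b₀)
        weighted≤majorant false t′ b₁ b₀ c l = ≡subst (_≤ᶻ majorant false t′ b₁ b₀)
          (≡sym (≡trans (≡cong (_*ᶻ c) (ℤₚ.*-zeroˡ (χ t′))) (ℤₚ.*-zeroˡ c))) (0≤majorant false t′ b₁ b₀)

      second-moment-bound : (T : Fin n → Bool) →
        sum (λ j → sum (λ k → (χ (T j) *ᶻ χ (T k)) *ᶻ correlation j k)) ≤ᶻ + (count K T *ℕ (n *ℕ (B +ℕ D₀ +ℕ D₁)))
      second-moment-bound T = begin
        sum (λ j → sum (λ k → (χ (T j) *ᶻ χ (T k)) *ᶻ correlation j k))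
          ≤⟨ sum-mono (λ j → sum-mono (λ k → weighted≤majorant (T j) (T k) (bad₁ j k) (bad₀ j) _ (correlation≤majorant j k))) ⟩
        sum (λ j → sum (λ k → majorant (T j) (T k) (bad₁ j k) (bad₀ j)))
          ≡⟨ sum-cong-≋ (λ j → ≡trans (∑-distrib-+ (λ k → (χ (T j) *ᶻ χ (T k)) *ᶻ + B) (λ k → + n *ᶻ (χ (T j) *ᶻ χ (bad₁ j k) +ᶻ χ (bad₀ j) *ᶻ χ (T k))))
               (≡cong₂ _+ᶻ_ (≡trans (≡sym (*-distribʳ-sum (+ B) (λ k → χ (T j) *ᶻ χ (T k)))) (≡cong (_*ᶻ + B) (≡sym (*-distribˡ-sum (χ (T j)) (χ ∘ T)))))
                 (≡trans (≡sym (*-distribˡ-sum (+ n) (λ k → χ (T j) *ᶻ χ (bad₁ j k) +ᶻ χ (bad₀ j) *ᶻ χ (T k))))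
                   (≡cong (+ n *ᶻ_) (≡trans (∑-distrib-+ (λ k → χ (T j) *ᶻ χ (bad₁ j k)) (λ k → χ (bad₀ j) *ᶻ χ (T k)))
                     (≡cong₂ _+ᶻ_ (≡sym (*-distribˡ-sum (χ (T j)) (χ ∘ bad₁ j))) (≡sym (*-distribˡ-sum (χ (bad₀ j)) (χ ∘ T)))))))) ) ⟩
        sum (λ j → (χ (T j) *ᶻ t) *ᶻ + B +ᶻ + n *ᶻ (χ (T j) *ᶻ sum (χ ∘ bad₁ j) +ᶻ χ (bad₀ j) *ᶻ t))
          ≤⟨ sum-mono (λ j → ℤₚ.+-monoʳ-≤ ((χ (T j) *ᶻ t) *ᶻ + B) (ℤₚ.*-monoˡ-≤-nonNeg (+ n) (ℤₚ.+-monoˡ-≤ (χ (bad₀ j) *ᶻ t)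
               (mono-χ (T j) (≡subst (_≤ᶻ + D₁) (count-sum (bad₁ j)) (+≤+ (few₁ j))))))) ⟩
        sum (λ j → (χ (T j) *ᶻ t) *ᶻ + B +ᶻ + n *ᶻ (χ (T j) *ᶻ + D₁ +ᶻ χ (bad₀ j) *ᶻ t))
          ≡⟨ sum-cong-≋ (λ j → regroup (χ (T j)) (χ (bad₀ j)) t (+ B) (+ n) (+ D₁)) ⟩
        sum (λ j → χ (T j) *ᶻ (t *ᶻ + B +ᶻ + n *ᶻ + D₁) +ᶻ χ (bad₀ j) *ᶻ (+ n *ᶻ t))
          ≡⟨ ≡trans (∑-distrib-+ (λ j → χ (T j) *ᶻ (t *ᶻ + B +ᶻ + n *ᶻ + D₁)) (λ j → χ (bad₀ j) *ᶻ (+ n *ᶻ t)))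
               (≡cong₂ _+ᶻ_ (≡sym (*-distribʳ-sum (t *ᶻ + B +ᶻ + n *ᶻ + D₁) (χ ∘ T))) (≡sym (*-distribʳ-sum (+ n *ᶻ t) (χ ∘ bad₀)))) ⟩
        t *ᶻ (t *ᶻ + B +ᶻ + n *ᶻ + D₁) +ᶻ sum (χ ∘ bad₀) *ᶻ (+ n *ᶻ t)
          ≡⟨ ≡cong₂ (λ t b → t *ᶻ (t *ᶻ + B +ᶻ + n *ᶻ + D₁) +ᶻ b *ᶻ (+ n *ᶻ t)) (≡sym (count-sum T)) (≡sym (count-sum bad₀)) ⟩
        + τ *ᶻ (+ τ *ᶻ + B +ᶻ + n *ᶻ + D₁) +ᶻ + count K bad₀ *ᶻ (+ n *ᶻ + τ) ≡⟨ to-ℕ ⟨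
        + (τ *ℕ (τ *ℕ B +ℕ n *ℕ D₁) +ℕ count K bad₀ *ℕ (n *ℕ τ)) ≤⟨ +≤+ final ⟩
        + (τ *ℕ (n *ℕ (B +ℕ D₀ +ℕ D₁))) ∎
        where
        open ℤₚ.≤-Reasoning
        t : ℤ
        t = sum (χ ∘ T)
        τ : ℕ
        τ = count K T
        mono-χ : ∀ b {x y} → x ≤ᶻ y → χ b *ᶻ x ≤ᶻ χ b *ᶻ y
        mono-χ true {x} {y} l = ≡subst (_≤ᶻ 1ℤ *ᶻ y) (≡sym (ℤₚ.*-identityˡ x)) (≡subst (x ≤ᶻ_) (≡sym (ℤₚ.*-identityˡ y)) l)
        mono-χ false {x} {y} l = ℤₚ.≤-reflexive (≡trans (ℤₚ.*-zeroˡ x) (≡sym (ℤₚ.*-zeroˡ y)))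
        regroup : ∀ x b t B n D → (x *ᶻ t) *ᶻ B +ᶻ n *ᶻ (x *ᶻ D +ᶻ b *ᶻ t) ≡ x *ᶻ (t *ᶻ B +ᶻ n *ᶻ D) +ᶻ b *ᶻ (n *ᶻ t)
        regroup = solve-∀ℤ
        to-ℕ : + (τ *ℕ (τ *ℕ B +ℕ n *ℕ D₁) +ℕ count K bad₀ *ℕ (n *ℕ τ)) ≡ + τ *ᶻ (+ τ *ᶻ + B +ᶻ + n *ᶻ + D₁) +ᶻ + count K bad₀ *ᶻ (+ n *ᶻ + τ)
        to-ℕ = ≡cong₂ _+ᶻ_ (≡trans (ℤₚ.pos-* τ _) (≡cong (+ τ *ᶻ_) (≡cong₂ _+ᶻ_ (ℤₚ.pos-* τ B) (ℤₚ.pos-* n D₁))))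
          (≡trans (ℤₚ.pos-* (count K bad₀) (n *ℕ τ)) (≡cong (+ count K bad₀ *ᶻ_) (ℤₚ.pos-* n τ)))
        final : τ *ℕ (τ *ℕ B +ℕ n *ℕ D₁) +ℕ count K bad₀ *ℕ (n *ℕ τ) ≤ τ *ℕ (n *ℕ (B +ℕ D₀ +ℕ D₁))
        final = ℕₚ.≤-trans (ℕₚ.+-mono-≤ (ℕₚ.*-monoʳ-≤ τ (ℕₚ.+-monoˡ-≤ (n *ℕ D₁) (ℕₚ.*-monoˡ-≤ B (count-≤ T)))) (ℕₚ.*-monoˡ-≤ (n *ℕ τ) few₀))
          (ℕₚ.≤-reflexive (lemma τ n B D₁ D₀))
          where
          lemma : ∀ τ n B D₁ D₀ → τ *ℕ (n *ℕ B +ℕ n *ℕ D₁) +ℕ D₀ *ℕ (n *ℕ τ) ≡ τ *ℕ (n *ℕ (B +ℕ D₀ +ℕ D₁))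
          lemma = solve-∀

      edge-deviation : ∀ (S T : Fin n → Bool) →
        let X = + (2 *ℕ sumFin K (λ i → count K (λ j → S i ∧ T j ∧ adj i j))) -ᶻ + (count K S *ℕ count K T) in
        ∣ X ∣ *ℕ ∣ X ∣ ≤ count K S *ℕ (count K T *ℕ (n *ℕ (B +ℕ D₀ +ℕ D₁)))
      edge-deviation S T = ℤₚ.drop‿+≤+ (begin
        + (∣ X ∣ *ℕ ∣ X ∣) ≡⟨ ≡cong +_ (ℤₚ.abs-* X X) ⟨
        + ∣ X *ᶻ X ∣ ≡⟨ ℤₚ.0≤i⇒+∣i∣≡i (0≤square X) ⟩
        X *ᶻ X ≡⟨ ≡cong₂ _*ᶻ_ X≡ X≡ ⟩
        sum (λ i → χ (S i) *ᶻ w i) *ᶻ sum (λ i → χ (S i) *ᶻ w i) ≤⟨ cauchy-schwarz S w ⟩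
        sum (χ ∘ S) *ᶻ sum (λ i → w i *ᶻ w i) ≡⟨ ≡cong₂ _*ᶻ_ (≡sym (count-sum S)) (second-moment T) ⟩
        + count K S *ᶻ sum (λ j → sum (λ k → (χ (T j) *ᶻ χ (T k)) *ᶻ correlation j k))
          ≤⟨ ℤₚ.*-monoˡ-≤-nonNeg (+ count K S) (second-moment-bound T) ⟩
        + count K S *ᶻ + (count K T *ℕ (n *ℕ (B +ℕ D₀ +ℕ D₁))) ≡⟨ ℤₚ.pos-* (count K S) _ ⟨
        + (count K S *ℕ (count K T *ℕ (n *ℕ (B +ℕ D₀ +ℕ D₁)))) ∎)
        where
        open ℤₚ.≤-Reasoning
        X : ℤ
        X = + (2 *ℕ sumFin K (λ i → count K (λ j → S i ∧ T j ∧ adj i j))) -ᶻ + (count K S *ℕ count K T)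
        w : Fin n → ℤ
        w i = sum (λ j → χ (T j) *ᶻ ε (adj i j))
        pointwise : ∀ s t a → + 2 *ᶻ χ (s ∧ t ∧ a) -ᶻ χ s *ᶻ χ t ≡ χ s *ᶻ (χ t *ᶻ ε a)
        pointwise true true true = ≡refl
        pointwise true true false = ≡refl
        pointwise true false a = ≡refl
        pointwise false t a = ≡cong (Data.Integer.-_) (ℤₚ.*-zeroˡ (χ t))
        edges : Fin n → Fin n → Bool
        edges i j = S i ∧ T j ∧ adj i j
        X≡ : X ≡ sum (λ i → χ (S i) *ᶻ w i)
        X≡ = begin-equality
          X ≡⟨ ≡cong₂ _-ᶻ_ (≡trans (ℤₚ.pos-* 2 (sumFin K (λ i → count K (edges i)))) (≡cong (+ 2 *ᶻ_) (≡trans (sumFin-sum (λ i → count K (edges i))) (sum-cong-≋ (λ i → count-sum (edges i))))))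
                (≡trans (ℤₚ.pos-* (count K S) (count K T)) (≡trans (≡cong₂ _*ᶻ_ (count-sum S) (count-sum T)) (≡sym (sum-product (χ ∘ S) (χ ∘ T))))) ⟩
          + 2 *ᶻ sum (λ i → sum (λ j → χ (edges i j))) -ᶻ sum (λ i → sum (λ j → χ (S i) *ᶻ χ (T j)))
            ≡⟨ ≡cong (_-ᶻ sum (λ i → sum (λ j → χ (S i) *ᶻ χ (T j)))) (≡trans (*-distribˡ-sum (+ 2) (λ i → sum (λ j → χ (edges i j))))
                 (sum-cong-≋ (λ i → *-distribˡ-sum (+ 2) (λ j → χ (edges i j))))) ⟩
          sum (λ i → sum (λ j → + 2 *ᶻ χ (edges i j))) -ᶻ sum (λ i → sum (λ j → χ (S i) *ᶻ χ (T j)))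
            ≡⟨ sum-minus (λ i → sum (λ j → + 2 *ᶻ χ (edges i j))) (λ i → sum (λ j → χ (S i) *ᶻ χ (T j))) ⟨
          sum (λ i → sum (λ j → + 2 *ᶻ χ (edges i j)) -ᶻ sum (λ j → χ (S i) *ᶻ χ (T j)))
            ≡⟨ sum-cong-≋ (λ i → sum-minus (λ j → + 2 *ᶻ χ (edges i j)) (λ j → χ (S i) *ᶻ χ (T j))) ⟨
          sum (λ i → sum (λ j → + 2 *ᶻ χ (edges i j) -ᶻ χ (S i) *ᶻ χ (T j)))
            ≡⟨ sum-cong-≋ (λ i → ≡trans (sum-cong-≋ (λ j → pointwise (S i) (T j) (adj i j))) (≡sym (*-distribˡ-sum (χ (S i)) (λ j → χ (T j) *ᶻ ε (adj i j))))) ⟩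
          sum (λ i → χ (S i) *ᶻ w i) ∎

-- Constants, and the bound for large and small q.

module Constants where
  -- The coefficient of r in an upper bound for B + D₀ + D₁, each of its constant terms being
  -- enlarged by a factor r.
  deviation : ℕ → ℕ
  deviation d = 4 *ℕ Parameters.κ d +ℕ 2 *ℕ (2 +ℕ (d +ℕ d)) +ℕ d +ℕ ((d +ℕ d) *ℕ d +ℕ d)

  -- The square ensures r ≥ 16 + 4 d, as `few-conditions` demands; the other summand ensures that
  -- `Pol2-unique` applies to the square identity.
  threshold : ℕ → ℕ
  threshold d = (17 +ℕ 4 *ℕ d) *ℕ (17 +ℕ 4 *ℕ d) +ℕ identity-length d

  -- The summand with `deviation` serves large q. The other serves q ≤ `threshold d`, where
  -- correlations are bounded trivially by q and q² ≤ `threshold d` · q. The `suc` makes the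
  -- constant positive.
  constant-of : ℕ → ℕ
  constant-of d = suc (deviation d *ℕ deviation d +ℕ threshold d)

  -- Fourth powers clear both q^(3/4) and √(|S||T|). The bound G = O(√n) enters as G² ≤ c n, and
  -- squaring the second moment estimate brings it in.
  fourth-power : ∀ Y s t n G c → Y *ℕ Y ≤ s *ℕ (t *ℕ (n *ℕ G)) → G *ℕ G ≤ c *ℕ n →
    Y ^ℕ 4 ≤ c *ℕ (n ^ℕ 3) *ℕ ((s *ℕ t) ^ℕ 2)
  fourth-power Y s t n G c l m = begin
    Y ^ℕ 4 ≡⟨ quartic Y ⟩
    (Y *ℕ Y) *ℕ (Y *ℕ Y) ≤⟨ ℕₚ.*-mono-≤ l l ⟩
    (s *ℕ (t *ℕ (n *ℕ G))) *ℕ (s *ℕ (t *ℕ (n *ℕ G))) ≡⟨ regroup s t n G ⟩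
    (s *ℕ t *ℕ n) *ℕ (s *ℕ t *ℕ n) *ℕ (G *ℕ G) ≤⟨ ℕₚ.*-monoʳ-≤ ((s *ℕ t *ℕ n) *ℕ (s *ℕ t *ℕ n)) m ⟩
    (s *ℕ t *ℕ n) *ℕ (s *ℕ t *ℕ n) *ℕ (c *ℕ n) ≡⟨ collect s t n c ⟩
    c *ℕ (n ^ℕ 3) *ℕ ((s *ℕ t) ^ℕ 2) ∎
    where
    open ℕₚ.≤-Reasoning
    quartic : ∀ Y → Y *ℕ (Y *ℕ (Y *ℕ (Y *ℕ 1))) ≡ (Y *ℕ Y) *ℕ (Y *ℕ Y)
    quartic = solve-∀
    regroup : ∀ s t n G → (s *ℕ (t *ℕ (n *ℕ G))) *ℕ (s *ℕ (t *ℕ (n *ℕ G))) ≡ (s *ℕ t *ℕ n) *ℕ (s *ℕ t *ℕ n) *ℕ (G *ℕ G)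
    regroup = solve-∀
    collect : ∀ s t n c → (s *ℕ t *ℕ n) *ℕ (s *ℕ t *ℕ n) *ℕ (c *ℕ n) ≡ c *ℕ (n *ℕ (n *ℕ (n *ℕ 1))) *ℕ ((s *ℕ t) *ℕ ((s *ℕ t) *ℕ 1))
    collect = solve-∀

module EdgeBound (K : FiniteField) (odd : OddPrimePower (FiniteField.size K))
                 (f : Poly2 K) (d : ℕ) (degree : HasDegree K f d) (admissible : Admissible K f) where
  open Slices K odd f d degree
  open Correlations K
  open Counting K
  open Constants
  open Parameters using (κ)

  adjacent : Fin size → Fin size → Bool
  adjacent i j = not (does (i Fin.≟ j)) ∧ does (isSquare? K (eval K f (elt K i) (elt K j)))

  gap : (S T : Carrier → Bool) → ℕ
  gap S T = ∣ (pos (2 *ℕ eST K f S T)) -ᶻ (pos (card K S *ℕ card K T)) ∣ᶻ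

  private
    _·_ = FiniteField._*_ K

    ∧-true : ∀ {a b} → a ∧ b ≡ true → a ≡ true × b ≡ true
    ∧-true {true} {true} _ = ≡refl , ≡refl

    ∨-false : ∀ {a b} → a ∨ b ≡ false → a ≡ false × b ≡ false
    ∨-false {false} {false} _ = ≡refl , ≡refl

    not-true : ∀ {a} → not a ≡ true → a ≡ false
    not-true {false} _ = ≡refl

    -- Two squares give 1 · 1 and two nonsquares (-1)(-1), so both kinds of agreement fall under a
    -- single Stepanov count with a = 1.
    signs : ∀ {v w} → v ≢ 0# → w ≢ 0# → agree (does (isSquare? K v)) (does (isSquare? K w)) ≡ true → (v · w) ^ half ≡ 1#
    signs {v} {w} nv nw e = cases (isSquare? K v) (isSquare? K w) e
      where
      cases : (a : Dec (IsSquare K v)) (b : Dec (IsSquare K w)) → agree (does a) (does b) ≡ true → (v · w) ^ half ≡ 1#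
      cases (yes a) (yes b) _ = ≡trans (^-distrib-* v w half)
        (≡trans (≡cong₂ _·_ (square-criterion nv a) (square-criterion nw b)) (F.*-identityˡ 1#))
      cases (no a) (no b) _ = ≡trans (^-distrib-* v w half)
        (≡trans (≡cong₂ _·_ (nonsquare-criterion a) (nonsquare-criterion b))
          (≡trans (Identities.neg-square KR 1#) (F.*-identityˡ 1#)))

  module Large (large : threshold d ≤ size) where
    private
      17+4d : ℕ
      17+4d = 17 +ℕ 4 *ℕ d

      square≤ : 17+4d *ℕ 17+4d ≤ size
      square≤ = ℕₚ.≤-trans (ℕₚ.m≤m+n (17+4d *ℕ 17+4d) (identity-length d)) large

      r : ℕ
      r = proj₁ (integer-sqrt size)
      r²≤ : r *ℕ r ≤ size
      r²≤ = proj₁ (proj₂ (integer-sqrt size))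
      <r² : size < suc r *ℕ suc r
      <r² = proj₂ (proj₂ (integer-sqrt size))

      r-large : 16 +ℕ 4 *ℕ d ≤ r
      r-large = ℕₚ.≮⇒≥ λ l → ℕₚ.<⇒≱ (ℕₚ.<-≤-trans <r² (ℕₚ.*-mono-≤ (ℕₚ.m≤n⇒m≤1+n l) (ℕₚ.m≤n⇒m≤1+n l))) square≤

      d<size : suc (d +ℕ d) ≤ size
      d<size = ℕₚ.≤-trans (ℕₚ.≤-trans (s≤s (ℕₚ.≤-trans (ℕₚ.≤-reflexive (two d)) (ℕₚ.≤-trans (ℕₚ.*-monoˡ-≤ d {2} {4} (s≤s (s≤s z≤n))) (ℕₚ.m≤n+m (4 *ℕ d) 16)))) (ℕₚ.m≤m+n 17+4d (16 *ℕ 17+4d +ℕ 4 *ℕ d *ℕ 17+4d)))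
        (ℕₚ.≤-trans (ℕₚ.≤-reflexive (expand 17+4d (4 *ℕ d))) square≤)
        where
        two : ∀ d → d +ℕ d ≡ 2 *ℕ d
        two = solve-∀
        expand : ∀ m e → m +ℕ (16 *ℕ m +ℕ e *ℕ m) ≡ (17 +ℕ e) *ℕ m
        expand = solve-∀

      d≤half : d ≤ half
      d≤half = ℕₚ.≮⇒≥ λ l → ℕₚ.<⇒≱ (ℕₚ.+-mono-<-≤ l (ℕₚ.<⇒≤ l)) (ℕₚ.≤-pred (≡subst (suc (d +ℕ d) ≤_) size-odd d<size))

      -- One base point x₀ serves all pairs. It is chosen with f(x₀, ·) not identically zero, so
      -- that at most d values of t are lost.
      base : ∃ λ x → ∃ λ t → value x t ≢ 0#
      base = nonzero-value (ℕₚ.≤-trans (s≤s (ℕₚ.m≤m+n d d)) d<size)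

      x₀ t₁ : Carrier
      x₀ = proj₁ base
      t₁ = proj₁ (proj₂ base)

      few-zeros-of : ∀ {φ : Carrier → Carrier} → Pol d φ → ∀ x → φ x ≢ 0# → count K (λ i → does (φ (elt K i) ≟ 0#)) ≤ d
      few-zeros-of {φ} p x ne = ℕₚ.≮⇒≥ λ l → ne (Pol-zero p _ (λ i e → affirm (φ (elt K i) ≟ 0#) e) l x)

      bad₀ : Fin size → Bool
      bad₀ j = does (value x₀ (elt K j) ≟ 0#)

      few-bad₀ : count K bad₀ ≤ d
      few-bad₀ = few-zeros-of (Pol-value x₀) t₁ (proj₂ (proj₂ base))

      few-bad : ∀ t₀ → value x₀ t₀ ≢ 0# → count K (Pairs.bad x₀ t₀) ≤ (d +ℕ d) *ℕ d
      few-bad t₀ ne = ℕₚ.≮⇒≥ λ l → contradict (SquareIdentity.square-identity K odd f d degree x₀ t₀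
          (ℕₚ.≤-trans (ℕₚ.m≤n+m (identity-length d) (17+4d *ℕ 17+4d)) large) (Pairs.all-bad x₀ t₀ l) t₁
          (λ e → *-nonzero ne (proj₂ (proj₂ base)) (≡trans (≡sym (Pairs.ev-h x₀ t₀ x₀ t₁)) e)))
        where
        f≢0 : ¬ GaussLemma.X-zero K (coef f)
        f≢0 z = proj₂ (proj₂ base) (Id.ev-zero (suc d) x₀ (λ i → Id.ev-zero (suc d) t₁ (λ j → z i j)))
        open TwoVariables K using (Bounded; module X)
        contradict : ¬ (∃ λ D → ∃₂ λ A B → ∃ λ U → Bd D A × Bd D B × Bounded D U × ¬ Zero A × ¬ Zero B ×
          ((λ i → C (B i)) X.⊡ X.C A) X.⊡ coef f X.≋ U X.⊡ U)
        contradict (D , A , B , U , bA , bB , bU , nA , nB , eq) =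
          Kernel.no-weighted-square K f f≢0 (proj₂ admissible) D A B U bA bB bU nA nB eq

      -- `few-bad` says nothing about j with f(x₀, t_j) = 0. The guard empties those rows, so the
      -- bound on bad k holds for every j.
      bad₁ : Fin size → Fin size → Bool
      bad₁ j k = not (bad₀ j) ∧ (Pairs.bad x₀ (elt K j) k ∨ bad₀ k)

      few-bad₁ : ∀ j → count K (bad₁ j) ≤ (d +ℕ d) *ℕ d +ℕ d
      few-bad₁ j = by-cases (value x₀ (elt K j) ≟ 0#)
        (λ e → ≡subst (λ b → count K (λ k → not b ∧ (Pairs.bad x₀ (elt K j) k ∨ bad₀ k)) ≤ (d +ℕ d) *ℕ d +ℕ d)
          (≡sym (dec-true (value x₀ (elt K j) ≟ 0#) e)) (ℕₚ.≤-trans (ℕₚ.≤-reflexive (count-none size)) z≤n))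
        (λ ne → ≡subst (λ b → count K (λ k → not b ∧ (Pairs.bad x₀ (elt K j) k ∨ bad₀ k)) ≤ (d +ℕ d) *ℕ d +ℕ d)
          (≡sym (dec-false (value x₀ (elt K j) ≟ 0#) ne))
          (ℕₚ.≤-trans (count-∨ (Pairs.bad x₀ (elt K j)) bad₀) (ℕₚ.+-mono-≤ (few-bad (elt K j) ne) few-bad₀)))

      -- Stepanov's error plus twice the largest number of exceptional points i.
      B : ℕ
      B = 4 *ℕ κ d *ℕ r +ℕ 2 *ℕ (2 +ℕ (d +ℕ d))

      good : ∀ j k → bad₀ j ≡ false → bad₁ j k ≡ false →
        2 *ℕ count K (λ i → agree (adjacent i j) (adjacent i k)) ≤ size +ℕ B
      good j k e₀ e₁ = begin
        2 *ℕ count K agreement ≤⟨ ℕₚ.*-monoʳ-≤ 2 (count-split agreement exceptional) ⟩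
        2 *ℕ (count K generic +ℕ count K exceptional) ≡⟨ ℕₚ.*-distribˡ-+ 2 (count K generic) (count K exceptional) ⟩
        2 *ℕ count K generic +ℕ 2 *ℕ count K exceptional ≤⟨ ℕₚ.+-mono-≤ generic-count (ℕₚ.*-monoʳ-≤ 2 exceptional-count) ⟩
        size +ℕ 4 *ℕ κ d *ℕ r +ℕ 2 *ℕ (2 +ℕ (d +ℕ d)) ≡⟨ ℕₚ.+-assoc size (4 *ℕ κ d *ℕ r) _ ⟩
        size +ℕ B ∎
        where
        open ℕₚ.≤-Reasoning
        tⱼ tₖ : Carrier
        tⱼ = elt K j
        tₖ = elt K k
        split : Pairs.bad x₀ tⱼ k ≡ false × bad₀ k ≡ false
        split = ∨-false (≡trans (≡cong (λ b → not b ∧ (Pairs.bad x₀ tⱼ k ∨ bad₀ k)) (≡sym e₀)) e₁)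
        nzⱼ : value x₀ tⱼ ≢ 0#
        nzⱼ = refute (value x₀ tⱼ ≟ 0#) e₀
        nzₖ : value x₀ tₖ ≢ 0#
        nzₖ = refute (value x₀ tₖ ≟ 0#) (proj₂ split)
        agreement vⱼ vₖ exceptional generic : Fin size → Bool
        agreement i = agree (adjacent i j) (adjacent i k)
        vⱼ i = does (value (elt K i) tⱼ ≟ 0#)
        vₖ i = does (value (elt K i) tₖ ≟ 0#)
        -- The removed loops i = j and i = k, at most two, and the zeros of f(·, t_j) and f(·, t_k),
        -- at most d each, where Euler's criterion gives no sign.
        exceptional i = (does (i Fin.≟ j) ∨ does (i Fin.≟ k)) ∨ (vⱼ i ∨ vₖ i)
        generic i = agreement i ∧ not (exceptional i)
        exceptional-count : count K exceptional ≤ 2 +ℕ (d +ℕ d)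
        exceptional-count = ℕₚ.≤-trans (count-∨ (λ i → does (i Fin.≟ j) ∨ does (i Fin.≟ k)) (λ i → vⱼ i ∨ vₖ i))
          (ℕₚ.+-mono-≤ (ℕₚ.≤-trans (count-∨ (λ i → does (i Fin.≟ j)) (λ i → does (i Fin.≟ k))) (ℕₚ.+-mono-≤ (count-point j) (count-point k)))
            (ℕₚ.≤-trans (count-∨ vⱼ vₖ) (ℕₚ.+-mono-≤ (few-zeros-of (slice tⱼ , Bd-slice tⱼ , λ _ → ≡refl) x₀ nzⱼ)
                                                       (few-zeros-of (slice tₖ , Bd-slice tₖ , λ _ → ≡refl) x₀ nzₖ))))
        open Pairs x₀ tⱼ using (h; Bd-h; ev-h; b; nonsquare)
        b≢0 : b tₖ ≢ 0#
        b≢0 e = *-nonzero nzⱼ nzₖ (≡trans (≡sym (ev-h x₀ tₖ)) e)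
        generic-sound : ∀ i → generic i ≡ true →
          Id.ev (suc (d +ℕ d)) (h tₖ) (elt K i) ≢ 0# × Id.ev (suc (d +ℕ d)) (h tₖ) (elt K i) ^ half ≡ 1#
        generic-sound i e = (λ z → *-nonzero nv nw (≡trans (≡sym (ev-h (elt K i) tₖ)) z)) ,
          ≡trans (≡cong (_^ half) (ev-h (elt K i) tₖ)) (signs nv nw agrees)
          where
          unexceptional = ∨-false (not-true (proj₂ (∧-true {agreement i} e)))
          off-diagonal = ∨-false {does (i Fin.≟ j)} (proj₁ unexceptional)
          nonvanishing = ∨-false {vⱼ i} (proj₂ unexceptional)
          nv : value (elt K i) tⱼ ≢ 0#
          nv = refute (value (elt K i) tⱼ ≟ 0#) (proj₁ nonvanishing)
          nw : value (elt K i) tₖ ≢ 0#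
          nw = refute (value (elt K i) tₖ ≟ 0#) (proj₂ nonvanishing)
          adjacent≡ : ∀ l → does (i Fin.≟ l) ≡ false → adjacent i l ≡ does (isSquare? K (value (elt K i) (elt K l)))
          adjacent≡ l off = ≡trans (≡cong (λ c → not c ∧ does (isSquare? K (eval K f (elt K i) (elt K l)))) off)
            (≡cong (λ v → does (isSquare? K v)) (eval-value (elt K i) (elt K l)))
          agrees : agree (does (isSquare? K (value (elt K i) tⱼ))) (does (isSquare? K (value (elt K i) tₖ))) ≡ true
          agrees = ≡trans (≡sym (≡cong₂ agree (adjacent≡ j (proj₁ off-diagonal)) (adjacent≡ k (proj₂ off-diagonal)))) (proj₁ (∧-true {agreement i} e))
        c+d : ∃ λ c → d +ℕ c ≡ half
        c+d = ℕₚ.m≤n⇒∃[o]m+o≡n d≤half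
        generic-count : 2 *ℕ count K generic ≤ size +ℕ 4 *ℕ κ d *ℕ r
        generic-count = HalfCount.half-count K odd d (h tₖ) (Bd-h tₖ) x₀ (proj₁ c+d)
          (≡trans (≡sym (proj₂ c+d)) (ℕₚ.+-comm d (proj₁ c+d)))
          (nonsquare (proj₁ c+d) k (proj₁ split) b≢0) r r-large r²≤ <r² 1# generic generic-sound

      G : ℕ
      G = B +ℕ d +ℕ ((d +ℕ d) *ℕ d +ℕ d)

      G≤ : G ≤ deviation d *ℕ r
      G≤ = begin
        4 *ℕ κ d *ℕ r +ℕ 2 *ℕ (2 +ℕ (d +ℕ d)) +ℕ d +ℕ ((d +ℕ d) *ℕ d +ℕ d)
          ≤⟨ ℕₚ.+-mono-≤ (ℕₚ.+-mono-≤ (ℕₚ.+-monoʳ-≤ (4 *ℕ κ d *ℕ r) (grow (2 *ℕ (2 +ℕ (d +ℕ d))))) (grow d)) (grow ((d +ℕ d) *ℕ d +ℕ d)) ⟩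
        4 *ℕ κ d *ℕ r +ℕ 2 *ℕ (2 +ℕ (d +ℕ d)) *ℕ r +ℕ d *ℕ r +ℕ ((d +ℕ d) *ℕ d +ℕ d) *ℕ r
          ≡⟨ collect (4 *ℕ κ d) (2 *ℕ (2 +ℕ (d +ℕ d))) d ((d +ℕ d) *ℕ d +ℕ d) r ⟩
        deviation d *ℕ r ∎
        where
        open ℕₚ.≤-Reasoning
        grow : ∀ m → m ≤ m *ℕ r
        grow m = ≡subst (_≤ m *ℕ r) (ℕₚ.*-identityʳ m) (ℕₚ.*-monoʳ-≤ m (ℕₚ.≤-trans (s≤s z≤n) r-large))
        collect : ∀ a b c e r → a *ℕ r +ℕ b *ℕ r +ℕ c *ℕ r +ℕ e *ℕ r ≡ (a +ℕ b +ℕ c +ℕ e) *ℕ r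
        collect = solve-∀

      G² : G *ℕ G ≤ constant-of d *ℕ size
      G² = begin
        G *ℕ G ≤⟨ ℕₚ.*-mono-≤ G≤ G≤ ⟩
        (deviation d *ℕ r) *ℕ (deviation d *ℕ r) ≡⟨ regroup (deviation d) r ⟩
        (deviation d *ℕ deviation d) *ℕ (r *ℕ r) ≤⟨ ℕₚ.*-mono-≤ (ℕₚ.≤-trans (ℕₚ.m≤m+n (deviation d *ℕ deviation d) (threshold d)) (ℕₚ.n≤1+n _)) r²≤ ⟩
        constant-of d *ℕ size ∎
        where
        open ℕₚ.≤-Reasoning
        regroup : ∀ a r → (a *ℕ r) *ℕ (a *ℕ r) ≡ (a *ℕ a) *ℕ (r *ℕ r)
        regroup = solve-∀

    bounded : ∀ S T → gap S T ^ℕ 4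
      ≤ constant-of d *ℕ (size ^ℕ 3) *ℕ ((card K S *ℕ card K T) ^ℕ 2)
    bounded S T = fourth-power (gap S T) (card K S) (card K T) size G (constant-of d)
      (edge-deviation adjacent bad₀ bad₁ B d ((d +ℕ d) *ℕ d +ℕ d) few-bad₀ few-bad₁ good (S ∘ elt K) (T ∘ elt K)) G²

  module Small (small : size ≤ threshold d) where
    bounded : ∀ S T → gap S T ^ℕ 4
      ≤ constant-of d *ℕ (size ^ℕ 3) *ℕ ((card K S *ℕ card K T) ^ℕ 2)
    bounded S T = fourth-power (gap S T) (card K S) (card K T) size (size +ℕ 0 +ℕ 0) (constant-of d)
      (edge-deviation adjacent (λ _ → false) (λ _ _ → false) size 0 0 (ℕₚ.≤-reflexive (count-none size)) (λ _ → ℕₚ.≤-reflexive (count-none size))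
        (λ j k _ _ → trivial (λ i → agree (adjacent i j) (adjacent i k))) (S ∘ elt K) (T ∘ elt K))
      (≡subst (λ n → n *ℕ n ≤ constant-of d *ℕ size) (≡sym (≡trans (ℕₚ.+-identityʳ _) (ℕₚ.+-identityʳ size)))
        (ℕₚ.*-monoˡ-≤ size (ℕₚ.≤-trans small (ℕₚ.≤-trans (ℕₚ.m≤n+m (threshold d) (deviation d *ℕ deviation d)) (ℕₚ.n≤1+n _)))))
      where
      trivial : ∀ (p : Fin size → Bool) → 2 *ℕ count K p ≤ size +ℕ size
      trivial p = ℕₚ.≤-trans (ℕₚ.≤-reflexive (≡cong (count K p +ℕ_) (ℕₚ.+-identityʳ _))) (ℕₚ.+-mono-≤ (count-≤ p) (count-≤ p))

  edge-bound : ∀ S T → gap S T ^ℕ 4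
    ≤ constant-of d *ℕ (size ^ℕ 3) *ℕ ((card K S *ℕ card K T) ^ℕ 2)
  edge-bound with ℕₚ.≤-total (threshold d) size
  ... | inj₁ large = Large.bounded large
  ... | inj₂ small = Small.bounded small

open import Data.Nat using (ℕ; _≤_; _<_; _+_; _*_; _^_)
open import Data.Integer using (+_; ∣_∣) renaming (_-_ to _-ℤ_)
open import Data.Bool using (Bool)
open import Data.Product using (∃; _×_)

theorem1p4 : (d : ℕ) → 1 ≤ d →
    ∃ λ C → 0 < C ×
    ((K : FiniteField) → OddPrimePower (FiniteField.size K) →
    (f : Poly2 K) → HasDegree K f d → Admissible K f →
    (S T : FiniteField.Carrier K → Bool) →
    ∣ (+ (2 * eST K f S T)) -ℤ (+ (card K S * card K T)) ∣ ^ 4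
    ≤ C * (FiniteField.size K ^ 3) * ((card K S * card K T) ^ 2))
theorem1p4 d _ = Constants.constant-of d , s≤s z≤n ,
  λ K odd f degree admissible → EdgeBound.edge-bound K odd f d degree admissible
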